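{- The operator $\Delta_2(\alpha)$ of multiplication by the stable series $\widehat p_2$ for the product $\times_\alpha$ is $$\Delta_2(\alpha)=\alpha\sum_{i,j\ge1}p_ip_jD_{i+j}+\sum_{i,j\ge1}p_{i+j}D_iD_j+(\alpha-1)\sum_{k\ge1}(k-1)p_kD_k .$$ Its eigenvalue, in the dual Jack convention, is $2C_1^{(\alpha)}(\lambda)$; that is, $\Delta_2(\alpha)Q'_\lambda=2C_1^{(\alpha)}(\lambda)\,Q'_\lambda$ for every partition $\lambda$.
   Context: Let $\alpha$ be an indeterminate and $\Lambda=\mathbb Q(\alpha)[p_1,p_2,\dots]$ the ring of symmetric functions, $\Lambda^n$ its degree-$n$ component. $D_k=k\,\partial/\partial p_k$. The Hall scalar product is $\langle p_\lambda,p_\mu\rangle_{\mathrm{Hall}}=\delta_{\lambda\mu}z_\lambda$. $P_\lambda^{(\alpha)}$ is the monic Jack function, orthogonal for $\langle p_\lambda,p_\mu\rangle_\alpha=\delta_{\lambda\mu}z_\lambda\alpha^{\ell(\lambda)}$, and $J_\lambda^{(\alpha)}$ the integral Jack function (the multiple of $P_\lambda^{(\alpha)}$ in which, for $|\lambda|=n$, the coefficient of $p_1^n$ is $1$). $(Q'_\lambda)$ is the basis of $\Lambda$ dual to $(P_\lambda^{(\alpha)})$ for the Hall scalar product. Goulden--Jackson product: define a coproduct on $\Lambda^n$ by $\Gamma_\alpha(J_\lambda^{(\alpha)})=\frac1{n!}J_\lambda^{(\alpha)}\otimes J_\lambda^{(\alpha)}$ ($\lambda\vdash n$), and let $\times_\alpha$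 be the commutative associative product on $\Lambda^n$ with $\langle f\times_\alpha g,h\rangle_{\mathrm{Hall}}=\langle f\otimes g,\Gamma_\alpha(h)\rangle_{\mathrm{Hall}\otimes\mathrm{Hall}}$. It is extended componentwise to $\prod_n\Lambda^n$. For a partition $\mu$, the stable series is $\widehat p_\mu=\sum_{n\ge|\mu|}(n)_{|\mu|}\,p_\mu p_1^{\,n-|\mu|}$, where $(n)_m=n(n-1)\cdots(n-m+1)$. The operator $\Delta_\mu(\alpha)$ is $f\mapsto\widehat p_\mu\times_\alpha f$; on $f\in\Lambda^n$ it is multiplication by the degree-$n$ component of $\widehat p_\mu$. For a box $\square=(i,j)$ (row $i$, column $j$), $c_\alpha(\square)=\alpha(j-1)-(i-1)$, and $C_1^{(\alpha)}(\lambda)=\sum_{\square\in\lambda}c_\alpha(\square)$. -}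

module Defs where

open import Data.Bool.Base using (if_then_else_; true; false)
import Data.Integer.Base as ℤ
open import Data.List.Base
  using (List; []; _∷_; [_]; _++_; map; concatMap; foldr; length; filter;
         take; replicate; upTo; applyUpTo)
open import Data.List.Relation.Binary.Permutation.Propositional using (↭-sym)
open import Data.List.Relation.Binary.Permutation.Propositional.Properties
  using (All-resp-↭)
open import Data.List.Relation.Unary.All using (All; []; _∷_)
open import Data.List.Relation.Unary.All.Properties using (++⁺; replicate⁺)
open import Data.List.Relation.Unary.AllPairs using (AllPairs; []; _∷_)
open import Data.List.Relation.Unary.Linked using (Linked)
open import Data.List.Relation.Unary.Linked.Properties
  using (Linked⇒AllPairs; AllPairs⇒Linked)
import Data.List.Properties as List
import Data.List.Sort.Base
import Data.List.Sort.InsertionSort as InsertionSort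
open import Data.Nat.Base
  using (ℕ; zero; suc; _+_; _*_; _∸_; _^_; _≤_; _≥_; _⊔_; NonZero; _!)
open import Data.Nat.Combinatorics using () renaming (_P_ to _fallingBy_)
open import Data.Nat.ListAction using (sum; product)
open import Data.Nat.ListAction.Properties using (sum-++; sum-↭)
import Data.Nat.Properties as ℕ
open import Data.Product.Base using (∃; ∃-syntax; _×_; _,_)
open import Data.Product.Properties using (≡-dec)
open import Data.Rational.Base as ℚ using (ℚ; 0ℚ; 1ℚ)
import Data.Rational.Properties as ℚ
open import Function.Base using (flip)
open import Relation.Binary.Definitions using (DecidableEquality)
open import Relation.Binary.PropositionalEquality
  using (_≡_; _≢_; refl; sym; trans; cong; module ≡-Reasoning)
open import Relation.Binary.PropositionalEquality.Properties using (isDecEquivalence)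
open import Relation.Binary.TypeClasses using (IsDecEquivalence; _≟_)
open import Relation.Binary.Properties.DecTotalOrder ℕ.≤-decTotalOrder
  using (≥-decTotalOrder)
open import Relation.Nullary using (¬_; yes; no; does; contradiction)
open import Relation.Nullary.Decidable using (map′)

open InsertionSort ≥-decTotalOrder using (insertionSort)
open Data.List.Sort.Base.SortingAlgorithm insertionSort using (sort; sort-↭; sort-↗)

------------------------------------------------------------------------
-- The polynomial ring ℚ[α]: lists of coefficients, constant term first;
-- trailing zeros are allowed.

ℚ[α] : Set
ℚ[α] = List ℚ

coefᵖ : ℚ[α] → ℕ → ℚ
coefᵖ []      _       = 0ℚ
coefᵖ (a ∷ p) zero    = a
coefᵖ (a ∷ p) (suc k) = coefᵖ p k

infix  4 _≈ᵖ_
infixl 6 _+ᵖ_ _-ᵖ_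
infixl 7 _*ᵖ_

_≈ᵖ_ : ℚ[α] → ℚ[α] → Set
p ≈ᵖ q = ∀ k → coefᵖ p k ≡ coefᵖ q k

_+ᵖ_ : ℚ[α] → ℚ[α] → ℚ[α]
[]      +ᵖ q       = q
(a ∷ p) +ᵖ []      = a ∷ p
(a ∷ p) +ᵖ (b ∷ q) = (a ℚ.+ b) ∷ (p +ᵖ q)

_-ᵖ_ : ℚ[α] → ℚ[α] → ℚ[α]
p -ᵖ q = p +ᵖ map ℚ.-_ q

_*ᵖ_ : ℚ[α] → ℚ[α] → ℚ[α]
[]      *ᵖ q = []
(a ∷ p) *ᵖ q = map (a ℚ.*_) q +ᵖ (0ℚ ∷ p *ᵖ q)

NonZeroᵖ : ℚ[α] → Set
NonZeroᵖ p = ∃[ k ] coefᵖ p k ≢ 0ℚ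

coefᵖ-+ : ∀ p q k → coefᵖ (p +ᵖ q) k ≡ coefᵖ p k ℚ.+ coefᵖ q k
coefᵖ-+ []      q       k       = sym (ℚ.+-identityˡ _)
coefᵖ-+ (a ∷ p) []      k       = sym (ℚ.+-identityʳ _)
coefᵖ-+ (a ∷ p) (b ∷ q) zero    = refl
coefᵖ-+ (a ∷ p) (b ∷ q) (suc k) = coefᵖ-+ p q k

coefᵖ-scale : ∀ a q k → coefᵖ (map (a ℚ.*_) q) k ≡ a ℚ.* coefᵖ q k
coefᵖ-scale a []      k       = sym (ℚ.*-zeroʳ a)
coefᵖ-scale a (b ∷ q) zero    = refl
coefᵖ-scale a (b ∷ q) (suc k) = coefᵖ-scale a q k

coefᵖ-* : ∀ a p q k →
  coefᵖ ((a ∷ p) *ᵖ q) k ≡ a ℚ.* coefᵖ q k ℚ.+ coefᵖ (0ℚ ∷ p *ᵖ q) k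
coefᵖ-* a p q k = trans (coefᵖ-+ (map (a ℚ.*_) q) _ k)
  (cong (ℚ._+ coefᵖ (0ℚ ∷ p *ᵖ q) k) (coefᵖ-scale a q k))

*ᵖ-shift : ∀ p q k → coefᵖ (p *ᵖ (0ℚ ∷ q)) k ≡ coefᵖ (0ℚ ∷ p *ᵖ q) k
*ᵖ-shift []      q zero    = refl
*ᵖ-shift []      q (suc k) = refl
*ᵖ-shift (a ∷ p) q zero    =
  trans (ℚ.+-identityʳ (a ℚ.* 0ℚ)) (ℚ.*-zeroʳ a)
*ᵖ-shift (a ∷ p) q (suc k) = trans (coefᵖ-* a p (0ℚ ∷ q) (suc k))
  (trans (cong (a ℚ.* coefᵖ q k ℚ.+_) (*ᵖ-shift p q k)) (sym (coefᵖ-* a p q k)))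

ℚ-*-nonZero : ∀ {a b} → a ≢ 0ℚ → b ≢ 0ℚ → a ℚ.* b ≢ 0ℚ
ℚ-*-nonZero {a} {b} a≢0 b≢0 ab≡0 = b≢0 (begin
  b                        ≡⟨ ℚ.*-identityˡ b ⟨
  1ℚ ℚ.* b                 ≡⟨ cong (ℚ._* b) (ℚ.*-inverseˡ a) ⟨
  (ℚ.1/ a) ℚ.* a ℚ.* b     ≡⟨ ℚ.*-assoc (ℚ.1/ a) a b ⟩
  (ℚ.1/ a) ℚ.* (a ℚ.* b)   ≡⟨ cong ((ℚ.1/ a) ℚ.*_) ab≡0 ⟩
  (ℚ.1/ a) ℚ.* 0ℚ          ≡⟨ ℚ.*-zeroʳ (ℚ.1/ a) ⟩
  0ℚ                       ∎)
  where
  open ≡-Reasoning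
  instance _ = ℚ.≢-nonZero a≢0

*ᵖ-nonZero : ∀ p q → NonZeroᵖ p → NonZeroᵖ q → NonZeroᵖ (p *ᵖ q)
*ᵖ-nonZero []      q       (_ , p≢0) _         = contradiction refl p≢0
*ᵖ-nonZero (a ∷ p) []      _         (_ , q≢0) = contradiction refl q≢0
*ᵖ-nonZero (a ∷ p) (b ∷ q) p≢0 q≢0 with a ℚ.≟ 0ℚ | b ℚ.≟ 0ℚ
*ᵖ-nonZero (a ∷ p) (b ∷ q) (zero  , a≢0) _ | yes a≡0 | _ = contradiction a≡0 a≢0
*ᵖ-nonZero (a ∷ p) (b ∷ q) (suc i , p≢0) q≢0 | yes refl | _
  with *ᵖ-nonZero p (b ∷ q) (i , p≢0) q≢0
... | k , pq≢0 = suc k , λ eq → pq≢0 (begin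
  coefᵖ (p *ᵖ (b ∷ q)) k                              ≡⟨ ℚ.+-identityˡ _ ⟨
  0ℚ ℚ.+ coefᵖ (p *ᵖ (b ∷ q)) k                       ≡⟨ cong (ℚ._+ coefᵖ (p *ᵖ (b ∷ q)) k) (ℚ.*-zeroˡ (coefᵖ q k)) ⟨
  0ℚ ℚ.* coefᵖ q k ℚ.+ coefᵖ (p *ᵖ (b ∷ q)) k         ≡⟨ coefᵖ-* 0ℚ p (b ∷ q) (suc k) ⟨
  coefᵖ ((0ℚ ∷ p) *ᵖ (b ∷ q)) (suc k)                 ≡⟨ eq ⟩
  0ℚ                                                  ∎)
  where open ≡-Reasoning
*ᵖ-nonZero (a ∷ p) (b ∷ q) _ _ | no a≢0 | no b≢0 =
  zero , λ eq → ℚ-*-nonZero a≢0 b≢0 (trans (sym (ℚ.+-identityʳ (a ℚ.* b))) eq)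
*ᵖ-nonZero (a ∷ p) (b ∷ q) _ (zero  , b≢0) | no _ | yes b≡0 = contradiction b≡0 b≢0
*ᵖ-nonZero (a ∷ p) (b ∷ q) p≢0 (suc j , q≢0) | no _ | yes refl
  with *ᵖ-nonZero (a ∷ p) q p≢0 (j , q≢0)
... | k , pq≢0 = suc k , λ eq → pq≢0 (trans (sym (*ᵖ-shift (a ∷ p) q (suc k))) eq)

------------------------------------------------------------------------
-- The field ℚ(α) of rational functions: fractions of polynomials, compared
-- by cross-multiplication.

record ℚ⟨α⟩ : Set where
  constructor frac
  field
    num   : ℚ[α]
    den   : ℚ[α]
    den≢0 : NonZeroᵖ den

open ℚ⟨α⟩

infix  4 _≈ᴷ_
infixl 6 _+ᴷ_ _-ᴷ_
infixl 7 _*ᴷ_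

_≈ᴷ_ : ℚ⟨α⟩ → ℚ⟨α⟩ → Set
x ≈ᴷ y = num x *ᵖ den y ≈ᵖ num y *ᵖ den x

_+ᴷ_ _*ᴷ_ _-ᴷ_ : ℚ⟨α⟩ → ℚ⟨α⟩ → ℚ⟨α⟩
frac a b b≢0 +ᴷ frac c d d≢0 =
  frac (a *ᵖ d +ᵖ c *ᵖ b) (b *ᵖ d) (*ᵖ-nonZero b d b≢0 d≢0)
frac a b b≢0 *ᴷ frac c d d≢0 =
  frac (a *ᵖ c) (b *ᵖ d) (*ᵖ-nonZero b d b≢0 d≢0)
frac a b b≢0 -ᴷ frac c d d≢0 =
  frac (a *ᵖ d -ᵖ c *ᵖ b) (b *ᵖ d) (*ᵖ-nonZero b d b≢0 d≢0)

polyᴷ : ℚ[α] → ℚ⟨α⟩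
polyᴷ p = frac p [ 1ℚ ] (zero , λ ())

fromℚ : ℚ → ℚ⟨α⟩
fromℚ a = polyᴷ [ a ]

fromℕ : ℕ → ℚ⟨α⟩
fromℕ n = fromℚ ((ℤ.+ n) ℚ./ 1)

0ᴷ 1ᴷ α : ℚ⟨α⟩
0ᴷ = fromℚ 0ℚ
1ᴷ = fromℚ 1ℚ
α  = polyᴷ (0ℚ ∷ 1ℚ ∷ [])

------------------------------------------------------------------------

record Partition : Set where
  constructor mk
  field
    parts     : List ℕ
    .sorted   : Linked _≥_ parts
    .positive : All NonZero parts

open Partition public

∣_∣ : Partition → ℕ
∣ ν ∣ = sum (parts ν)

_≟ᴾ_ : DecidableEquality Partition
mk xs _ _ ≟ᴾ mk ys _ _ =
  map′ (λ { refl → refl }) (cong parts) (List.≡-dec ℕ._≟_ xs ys)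

instance
  partition-≡ : IsDecEquivalence {A = Partition} _≡_
  partition-≡ = isDecEquivalence _≟ᴾ_

  partition²-≡ : IsDecEquivalence {A = Partition × Partition} _≡_
  partition²-≡ = isDecEquivalence (≡-dec _≟ᴾ_ _≟ᴾ_)

instance
  i+j≢0 : ∀ {i j} .{{_ : NonZero i}} → NonZero (i + j)
  i+j≢0 {suc i} = _

sortParts : (xs : List ℕ) → .(All NonZero xs) → Partition
sortParts xs xs>0 = mk (sort xs) (sort-↗ xs) (All-resp-↭ (↭-sym (sort-↭ xs)) xs>0)

rows : (ℓ k : ℕ) .{{_ : NonZero k}} → Partition
rows ℓ k {{k>0}} = sortParts (replicate ℓ k) (replicate⁺ ℓ k>0)

⟦_⟧ : (k : ℕ) .{{_ : NonZero k}} → Partition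
⟦ k ⟧ = rows 1 k

_∪_ : Partition → Partition → Partition
mk xs _ xs>0 ∪ mk ys _ ys>0 = sortParts (xs ++ ys) (++⁺ xs>0 ys>0)

deletePart : ℕ → List ℕ → List ℕ
deletePart k []       = []
deletePart k (x ∷ xs) = if does (k ℕ.≟ x) then xs else x ∷ deletePart k xs

deletePart-All : ∀ {R : ℕ → Set} k {xs} → All R xs → All R (deletePart k xs)
deletePart-All k []                    = []
deletePart-All k (_∷_ {x} px pxs) with does (k ℕ.≟ x)
... | true  = pxs
... | false = px ∷ deletePart-All k pxs

deletePart-AllPairs : ∀ k {xs} → AllPairs _≥_ xs → AllPairs _≥_ (deletePart k xs)
deletePart-AllPairs k []                     = []
deletePart-AllPairs k (_∷_ {x} px pxs) with does (k ℕ.≟ x)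
... | true  = pxs
... | false = deletePart-All k px ∷ deletePart-AllPairs k pxs

-- ν with one part equal to k removed (and ν itself if there is none).
_∖_ : Partition → ℕ → Partition
mk xs xs↘ xs>0 ∖ k = mk (deletePart k xs)
  (AllPairs⇒Linked (deletePart-AllPairs k (Linked⇒AllPairs (flip ℕ.≤-trans) xs↘)))
  (deletePart-All k xs>0)

mult : ℕ → Partition → ℕ
mult k ν = length (filter (k ℕ.≟_) (parts ν))

z : Partition → ℕ
z ν = product (map (λ i → i ^ mult i ν * mult i ν !) (applyUpTo suc ∣ ν ∣))

infix 4 _⊴_

_⊴_ : Partition → Partition → Set
μ ⊴ ν = ∣ μ ∣ ≡ ∣ ν ∣ × (∀ k → sum (take k (parts μ)) ≤ sum (take k (parts ν)))

-- Boxes (i , j) of the diagram in zero-based coordinates: row i + 1, column j + 1.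
boxesFrom : ℕ → List ℕ → List (ℕ × ℕ)
boxesFrom i []       = []
boxesFrom i (r ∷ rs) = map (i ,_) (upTo r) ++ boxesFrom (suc i) rs

boxes : Partition → List (ℕ × ℕ)
boxes ν = boxesFrom 0 (parts ν)

content : ℕ × ℕ → ℚ⟨α⟩
content (i , j) = α *ᴷ fromℕ j -ᴷ fromℕ i

C₁ : Partition → ℚ⟨α⟩
C₁ ν = foldr (λ b s → content b +ᴷ s) 0ᴷ (boxes ν)

------------------------------------------------------------------------
-- Free ℚ(α)-modules: finite formal linear combinations of elements of B,
-- compared by their coefficients.

Lin : Set → Set
Lin B = List (ℚ⟨α⟩ × B)

extend : {B : Set} → (B → ℚ⟨α⟩) → Lin B → ℚ⟨α⟩
extend φ = foldr (λ (c , b) s → c *ᴷ φ b +ᴷ s) 0ᴷ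

infixr 7 _·_
infixl 6 _⊕_

_⊕_ : {B : Set} → Lin B → Lin B → Lin B
_⊕_ = _++_

_·_ : {B : Set} → ℚ⟨α⟩ → Lin B → Lin B
c · f = map (λ (d , b) → c *ᴷ d , b) f

linear : {A B : Set} → (A → Lin B) → Lin A → Lin B
linear T = concatMap (λ (c , a) → c · T a)

module _ {B : Set} {{_ : IsDecEquivalence {A = B} _≡_}} where

  infix 4 _≈_

  δ : B → B → ℚ⟨α⟩
  δ a b = if does (a ≟ b) then 1ᴷ else 0ᴷ

  coeff : Lin B → B → ℚ⟨α⟩
  coeff f b = extend (δ b) f

  _≈_ : Lin B → Lin B → Set
  f ≈ g = ∀ b → coeff f b ≈ᴷ coeff g b

------------------------------------------------------------------------
-- Λ = ℚ(α)[p₁, p₂, …] is the free module on the monomials p_ν, ν a partition.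

Λ Λ⊗Λ : Set
Λ   = Lin Partition
Λ⊗Λ = Lin (Partition × Partition)

p[_] : Partition → Λ
p[ ν ] = [ (1ᴷ , ν) ]

p : (k : ℕ) .{{_ : NonZero k}} → Λ
p k = p[ ⟦ k ⟧ ]

infixr 7 _⊛_

_⊛_ : Λ → Λ → Λ
f ⊛ g = linear (λ μ → linear (λ ν → p[ μ ∪ ν ]) g) f

_⊗_ : Λ → Λ → Λ⊗Λ
f ⊗ g = linear (λ μ → linear (λ ν → [ (1ᴷ , μ , ν) ]) g) f

-- D k = k ∂/∂p_k.
D : ℕ → Λ → Λ
D k = linear (λ ν → [ (fromℕ (k * mult k ν) , ν ∖ k) ])

-- Σ_{k ≥ 1} T k f for operators T k that vanish on polynomials of degree below k:
-- the terms with k greater than every degree occurring in f are then zero.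
deg : Λ → ℕ
deg = foldr (λ (_ , ν) d → ∣ ν ∣ ⊔ d) 0

∑≥1 : ((k : ℕ) .{{_ : NonZero k}} → Λ → Λ) → Λ → Λ
∑≥1 T f = concatMap (λ k → T (suc k) f) (upTo (deg f))

record Λ^ (n : ℕ) : Set where
  constructor graded
  field
    poly        : Λ
    homogeneous : All (λ (_ , ν) → ∣ ν ∣ ≡ n) poly

open Λ^ public

------------------------------------------------------------------------

-- ⟨p_μ , p_ν⟩ = δ_{μν} w(ν), extended bilinearly.
pairing : (Partition → ℚ⟨α⟩) → Λ → Λ → ℚ⟨α⟩
pairing w f g = extend (λ μ → extend (λ ν → δ μ ν *ᴷ w ν) g) f

_^ᴷ_ : ℚ⟨α⟩ → ℕ → ℚ⟨α⟩
x ^ᴷ zero  = 1ᴷ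
x ^ᴷ suc n = x *ᴷ (x ^ᴷ n)

⟨_,_⟩ᴴ ⟨_,_⟩α : Λ → Λ → ℚ⟨α⟩
⟨_,_⟩ᴴ = pairing (λ ν → fromℕ (z ν))
⟨_,_⟩α = pairing (λ ν → fromℕ (z ν) *ᴷ (α ^ᴷ length (parts ν)))

⟨_,_⟩ᴴᴴ : Λ⊗Λ → Λ⊗Λ → ℚ⟨α⟩
⟨ s , t ⟩ᴴᴴ = extend (λ (μ , ν) → extend (λ (μ′ , ν′) →
  ⟨ p[ μ ] , p[ μ′ ] ⟩ᴴ *ᴷ ⟨ p[ ν ] , p[ ν′ ] ⟩ᴴ) t) s

------------------------------------------------------------------------

-- All lists obtained from the exponent vector β by lowering one entry by r.
lower : ℕ → List ℕ → List (List ℕ)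
lower r []      = []
lower r (b ∷ β) =
  (if does (r ℕ.≤? b) then [ (b ∸ r) ∷ β ] else []) ++ map (b ∷_) (lower r β)

-- The coefficient of x₁^β₁ ⋯ x_N^β_N in ∏_{r ∈ ρ} (x₁^r + ⋯ + x_N^r).
xcoeffᵖ : List ℕ → List ℕ → ℕ
xcoeffᵖ []      β = if does (sum β ℕ.≟ 0) then 1 else 0
xcoeffᵖ (r ∷ ρ) β = sum (map (xcoeffᵖ ρ) (lower r β))

-- The coefficient of the monomial symmetric function m_μ in f, that is,
-- of x^μ in f(x₁, …, x_ℓ(μ)).
[m_]_ : Partition → Λ → ℚ⟨α⟩
[m μ ] f = extend (λ ν → fromℕ (xcoeffᵖ (parts ν) (parts μ))) f

Family : Set
Family = (ν : Partition) → Λ^ ∣ ν ∣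

-- These conditions determine P; existence is a theorem and is not asserted here.
record IsMonicJack (P : Family) : Set where
  field
    monic      : ∀ ν → [m ν ] poly (P ν) ≈ᴷ 1ᴷ
    triangular : ∀ ν μ → ¬ (μ ⊴ ν) → [m μ ] poly (P ν) ≈ᴷ 0ᴷ
    orthogonal : ∀ μ ν → μ ≢ ν → ⟨ poly (P μ) , poly (P ν) ⟩α ≈ᴷ 0ᴷ

record IsIntegralJack (P J : Family) : Set where
  field
    multiple : ∀ ν → ∃[ c ] poly (J ν) ≈ c · poly (P ν)
    p₁-coeff : ∀ ν → coeff (poly (J ν)) (rows ∣ ν ∣ 1) ≈ᴷ 1ᴷ

IsHallDual : Family → Family → Set
IsHallDual P Q′ = ∀ μ ν → ⟨ poly (P μ) , poly (Q′ ν) ⟩ᴴ ≈ᴷ δ μ ν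

------------------------------------------------------------------------

-- The coproducts of all the Λ^n, assembled into one linear map on Λ = ⊕ Λ^n.
-- It sends Λ^n to Λ^n ⊗ Λ^n because the J_ν with ν ⊢ n span Λ^n.
record IsCoproduct (J : Family) (Γ : Λ → Λ⊗Λ) : Set where
  field
    cong-≈  : ∀ {f g} → f ≈ g → Γ f ≈ Γ g
    homo-⊕  : ∀ f g → Γ (f ⊕ g) ≈ Γ f ⊕ Γ g
    homo-·  : ∀ c f → Γ (c · f) ≈ c · Γ f
    on-Jack : ∀ ν → let instance _ = ∣ ν ∣ ℕ.!≢0 in
      Γ (poly (J ν)) ≈ fromℚ ((ℤ.+ 1) ℚ./ (∣ ν ∣ !)) · (poly (J ν) ⊗ poly (J ν))

Product : Set
Product = ∀ {n} → Λ^ n → Λ^ n → Λ^ n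

-- The adjunction determines the product; bilinearity, commutativity and
-- associativity follow from it.
IsGouldenJackson : (Λ → Λ⊗Λ) → Product → Set
IsGouldenJackson Γ _✶_ = ∀ {n} (f g h : Λ^ n) →
  ⟨ poly (f ✶ g) , poly h ⟩ᴴ ≈ᴷ ⟨ poly f ⊗ poly g , Γ (poly h) ⟩ᴴᴴ

------------------------------------------------------------------------

∣∪∣ : ∀ μ ν → ∣ μ ∪ ν ∣ ≡ ∣ μ ∣ + ∣ ν ∣
∣∪∣ μ ν = trans (sum-↭ (sort-↭ (parts μ ++ parts ν))) (sum-++ (parts μ) (parts ν))

∣rows1∣ : ∀ ℓ → ∣ rows ℓ 1 ∣ ≡ ℓ
∣rows1∣ ℓ = trans (sum-↭ (sort-↭ (replicate ℓ 1))) (sum-ones ℓ)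
  where
  sum-ones : ∀ m → sum (replicate m 1) ≡ m
  sum-ones zero    = refl
  sum-ones (suc m) = cong suc (sum-ones m)

-- n fallingBy m = n(n-1)⋯(n-m+1), and p_μ p₁^{n-|μ|} is the monomial of μ ∪ (1^{n-|μ|}).
p̂ : Partition → (n : ℕ) → Λ^ n
p̂ μ n with ∣ μ ∣ ℕ.≤? n
... | no  _   = graded [] []
... | yes m≤n = graded (fromℕ (n fallingBy ∣ μ ∣) · p[ ν ]) (∣ν∣ ∷ [])
  where
  ν = μ ∪ rows (n ∸ ∣ μ ∣) 1
  ∣ν∣ = trans (∣∪∣ μ (rows (n ∸ ∣ μ ∣) 1))
          (trans (cong (∣ μ ∣ +_) (∣rows1∣ (n ∸ ∣ μ ∣))) (ℕ.m+[n∸m]≡n m≤n))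

-- On a series in ∏ Λ^n the operator acts by this map in each degree n.
Δ : Product → Partition → ∀ {n} → Λ^ n → Λ^ n
Δ _✶_ μ {n} f = p̂ μ n ✶ f

{-# OPTIONS --safe #-}

-- Write L for the operator obtained from Δ₂(α) by exchanging multiplication by p_k with D_k; it is the
-- Hall adjoint of the right-hand side L* of the theorem, and it is self-adjoint for ⟨ , ⟩α.
--
-- On coefficients of monomials x^β, the identity xᵢ ∂f/∂xᵢ = Σ_k xᵢ^k D_k f turns L into the
-- Laplace–Beltrami operator: the first and last sum give α Σ βᵢ(βᵢ − 1), and the sum over p_i p_j D_{i+j}
-- gives operators G_lm whose coefficient at β is −min(β_l, β_m) [x^β] f plus coefficients of f at exponents
-- with a larger sum of squares.  Hence L is triangular in the monomial basis with diagonal 2C₁, and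
-- self-adjointness with orthogonality of the P_λ gives L P_λ = 2C₁(λ) P_λ.
--
-- Since p̂₂ in degree n is L* p₁ⁿ, the scalar product ⟨p̂₂ , J_λ⟩ equals 2C₁(λ) ⟨p₁ⁿ , J_λ⟩ = 2C₁(λ) n!.
-- Therefore ⟨p̂₂ ✶ f , J_λ⟩ = 2C₁(λ) ⟨f , J_λ⟩ = ⟨L* f , J_λ⟩, and the J_λ span.

module Submission where

open import Algebra.Bundles using (CommutativeRing)
open import Data.Bool.Base using (Bool; if_then_else_; true; false)
open import Data.Fin.Base using (Fin; zero; suc)
import Data.Fin.Properties as Fin
open import Data.List.Base
  using (List; []; _∷_; [_]; _++_; map; concatMap; foldr; length; filter; take; replicate; upTo; applyUpTo;
         allFin; deduplicate)
import Data.List.Properties as List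
open import Data.List.Membership.Propositional using (_∈_; _∉_)
open import Data.List.Membership.Propositional.Properties
open import Data.List.Relation.Binary.Permutation.Propositional as ↭
  using (_↭_; ↭-sym; ↭-refl; ↭-trans; prep; swap; ↭-reflexive)
open import Data.List.Relation.Binary.Permutation.Propositional.Properties
  using (filter-↭; map⁺; ↭-length; shift; drop-∷)
open import Data.List.Relation.Binary.Pointwise using (Pointwise-≡⇒≡)
open import Data.List.Relation.Unary.All as All using (All; []; _∷_)
import Data.List.Relation.Unary.All.Properties as All
open import Data.List.Relation.Unary.AllPairs using (AllPairs; []; _∷_)
open import Data.List.Relation.Unary.Any as Any using (here; there)
open import Data.List.Relation.Unary.Linked as Linked using (Linked; [-]; _∷_)
open import Data.List.Relation.Unary.Linked.Properties using (Linked⇒AllPairs)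
open import Data.List.Relation.Unary.Sorted.TotalOrder.Properties using (↗↭↗⇒≋)
open import Data.List.Relation.Unary.Unique.DecPropositional.Properties using (deduplicate-!)
open import Data.List.Relation.Unary.Unique.Propositional using (Unique)
open import Data.List.Relation.Unary.Unique.Propositional.Properties using (upTo⁺; allFin⁺)
import Data.List.Sort.Base
import Data.List.Sort.InsertionSort as InsertionSort
open import Data.Nat.Base as ℕ using (ℕ; zero; suc; z≤n; s≤s; NonZero; _≤_; _<_; _≥_; _⊓_; _∸_; _!)
open import Data.Nat.Combinatorics using () renaming (_P_ to _fallingBy_)
open import Data.Nat.ListAction using (sum; product)
open import Data.Nat.ListAction.Properties using (sum-↭)
import Data.Nat.Properties as ℕ
open import Data.Nat.Tactic.RingSolver using (solve-∀)
open import Data.Product.Base using (∃-syntax; ∃₂; _×_; _,_; proj₂)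
open import Data.Sum.Base using (_⊎_; inj₁; inj₂)
open import Data.Vec.Base as Vec using (Vec; []; _∷_; lookup; _[_]≔_; toList)
import Data.Vec.Properties as Vec
open import Function.Base using (_∘_; id)
open import Level using (0ℓ)
open import Relation.Binary.Bundles using (DecTotalOrder)
open import Relation.Binary.PropositionalEquality as ≡ using (_≡_; _≢_)
open import Relation.Binary.Properties.DecTotalOrder ℕ.≤-decTotalOrder using (≥-decTotalOrder)
open import Relation.Binary.Structures using (IsEquivalence)
open import Relation.Binary.TypeClasses using (IsDecEquivalence; _≟_)
open import Relation.Nullary using (¬_; Dec; yes; no; does; contradiction; recompute)
import Relation.Nullary.Decidable as Dec
open import Defs
  using (Partition; mk; parts; rows; ⟦_⟧; _∪_; _∖_; mult; z; ∣_∣; _⊴_; sortParts; deletePart; deletePart-All;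
         lower; xcoeffᵖ; boxesFrom; boxes; partition-≡; partition²-≡)

-- Dominance is only a partial order, and distinct partitions can share an eigenvalue: (4,1,1) and
-- (3,3) both have C₁ = 6α - 3. So P_λ cannot be singled out by its eigenvalue. Dominance is
-- therefore refined to the integer `rank`, the sum of the squares of the parts, which allows plain
-- induction and which also grows when the recursion for G_lm moves a unit of exponent to an entry
-- at least as large. Triangularity places L P_λ - 2C₁(λ) P_λ in the span of the P_μ of smaller
-- rank, and self-adjointness makes it orthogonal to these as well. Spans are expressed by linear
-- functionals: a functional that kills enough of the P_μ kills every polynomial whose monomial
-- coefficients vanish from some rank on. No expansion in a basis has to be written down. The term
-- -min(β_l, β_m) comes from G_lm = (x_m θ_l - x_l θ_m) / (x_l - x_m) with θ_l = x_l ∂/∂x_l.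
-- Clearing the denominator gives a recursion in the exponent of x_l, which stops at exponent zero
-- because every term of G_lm contains x_l. Most identities are arranged without subtraction,
-- negative terms being moved to the other side.

module Combinatorics where

  open import Data.Nat.Base
  open ≡ hiding ([_])
  open InsertionSort ≥-decTotalOrder using (insertionSort)
  open Data.List.Sort.Base.SortingAlgorithm insertionSort using (sort-↭)

  -- Partitions as multisets of parts

  parts-sorted : (ν : Partition) → Linked _≥_ (parts ν)
  -- The proofs stored in a `Partition` are irrelevant; decidability of the property rebuilds one
  -- that is usable in relevant positions.
  parts-sorted (mk xs xs↘ _) = recompute (Linked.linked? ℕ._≥?_ xs) xs↘

  parts-positive : (ν : Partition) → All NonZero (parts ν)
  parts-positive (mk xs _ xs>0) = recompute (All.all? ℕ.nonZero? xs) xs>0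

  parts-injective : ∀ {μ ν} → parts μ ≡ parts ν → μ ≡ ν
  parts-injective {mk _ _ _} {mk _ _ _} refl = refl

  -- Weakly decreasing lists are canonical representatives of multisets, so adding and removing
  -- parts can be computed on unsorted lists.
  ↭⇒≡ : ∀ {μ ν} → parts μ ↭ parts ν → μ ≡ ν
  ↭⇒≡ {μ} {ν} p = parts-injective (Pointwise-≡⇒≡
    (↗↭↗⇒≋ (DecTotalOrder.totalOrder ≥-decTotalOrder) (parts-sorted μ) (parts-sorted ν) (↭.↭⇒↭ₛ p)))

  parts-∪ : ∀ k .{{_ : NonZero k}} ν → parts (⟦ k ⟧ ∪ ν) ↭ k ∷ parts ν
  parts-∪ k ν = sort-↭ (k ∷ parts ν)

  count : ℕ → List ℕ → ℕ
  count k xs = length (filter (k ℕ.≟_) xs)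

  count-↭ : ∀ k {xs ys} → xs ↭ ys → count k xs ≡ count k ys
  count-↭ k p = ↭-length (filter-↭ (k ℕ.≟_) p)

  count-here : ∀ k xs → count k (k ∷ xs) ≡ suc (count k xs)
  count-here k xs = cong length (List.filter-accept (k ℕ.≟_) refl)

  count-there : ∀ {k x} xs → k ≢ x → count k (x ∷ xs) ≡ count k xs
  count-there {k} xs k≢x = cong length (List.filter-reject (k ℕ.≟_) k≢x)

  deletePart-here : ∀ k xs → deletePart k (k ∷ xs) ≡ xs
  deletePart-here k xs rewrite Dec.dec-true (k ℕ.≟ k) refl = refl

  deletePart-there : ∀ {k x} xs → k ≢ x → deletePart k (x ∷ xs) ≡ x ∷ deletePart k xs
  deletePart-there {k} {x} xs k≢x rewrite Dec.dec-false (k ℕ.≟ x) k≢x = refl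

  deletePart-↭ : ∀ k xs → count k xs ≢ 0 → k ∷ deletePart k xs ↭ xs
  deletePart-↭ k []       c = contradiction refl c
  deletePart-↭ k (x ∷ xs) c with k ℕ.≟ x
  ... | yes refl = ↭-reflexive (cong (k ∷_) (deletePart-here k xs))
  ... | no  k≢x  = ↭-trans (↭-reflexive (cong (k ∷_) (deletePart-there xs k≢x)))
    (↭-trans (swap k x ↭-refl) (prep x (deletePart-↭ k xs (c ∘ trans (count-there xs k≢x)))))

  deletePart-cong : ∀ k {xs ys} → count k xs ≢ 0 → xs ↭ ys → deletePart k xs ↭ deletePart k ys
  deletePart-cong k {xs} {ys} c p = drop-∷ (↭-trans (deletePart-↭ k xs c)
    (↭-trans p (↭-sym (deletePart-↭ k ys (c ∘ trans (count-↭ k p))))))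

  ∪-∖ : ∀ k .{{_ : NonZero k}} ν → (⟦ k ⟧ ∪ ν) ∖ k ≡ ν
  ∪-∖ k ν = ↭⇒≡ (↭-trans (deletePart-cong k c (parts-∪ k ν)) (↭-reflexive (deletePart-here k (parts ν))))
    where
    c : count k (parts (⟦ k ⟧ ∪ ν)) ≢ 0
    c eq = contradiction (trans (sym (trans (count-↭ k (parts-∪ k ν)) (count-here k (parts ν)))) eq) λ ()

  ∖-∪ : ∀ k .{{_ : NonZero k}} ν → mult k ν ≢ 0 → ⟦ k ⟧ ∪ (ν ∖ k) ≡ ν
  ∖-∪ k ν c = ↭⇒≡ (↭-trans (parts-∪ k (ν ∖ k)) (deletePart-↭ k (parts ν) c))

  ∣k∪∣ : ∀ k .{{_ : NonZero k}} ν → ∣ ⟦ k ⟧ ∪ ν ∣ ≡ k + ∣ ν ∣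
  ∣k∪∣ k ν = sum-↭ (parts-∪ k ν)

  mult-∪ : ∀ k .{{_ : NonZero k}} ν → mult k (⟦ k ⟧ ∪ ν) ≡ suc (mult k ν)
  mult-∪ k ν = trans (count-↭ k (parts-∪ k ν)) (count-here k (parts ν))

  length-∪ : ∀ k .{{_ : NonZero k}} ν → length (parts (⟦ k ⟧ ∪ ν)) ≡ suc (length (parts ν))
  length-∪ k ν = ↭-length (parts-∪ k ν)

  ∣∖∣ : ∀ k .{{_ : NonZero k}} ν → mult k ν ≢ 0 → k + ∣ ν ∖ k ∣ ≡ ∣ ν ∣
  ∣∖∣ k ν c = sum-↭ (deletePart-↭ k (parts ν) c)

  count-above : ∀ k xs → sum xs < k → count k xs ≡ 0
  count-above k []       _ = refl
  count-above k (x ∷ xs) x+xs<k = trans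
    (count-there {k} {x} xs λ { refl → ℕ.<⇒≱ x+xs<k (ℕ.m≤m+n x (sum xs)) })
    (count-above k xs (ℕ.≤-<-trans (ℕ.m≤n+m (sum xs) x) x+xs<k))

  -- The factor z_ν

  zFactor : Partition → ℕ → ℕ
  zFactor ν i = i ^ mult i ν * mult i ν !

  -- The product in `z` runs up to |ν|, a range that moves with ν. With a free cutoff the values for
  -- ν and for ν with a part added are compared over one range; `z-extend` allows this, since
  -- numbers above |ν| have multiplicity zero and contribute the factor 1.
  zUpTo : (ℕ → ℕ) → ℕ → ℕ
  zUpTo g N = product (map g (applyUpTo suc N))

  zUpTo-suc : ∀ g N → zUpTo g (suc N) ≡ zUpTo g N * g (suc N)
  zUpTo-suc g N = trans (cong product (List.map-applyUpTo suc g (suc N)))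
    (trans (last (g ∘ suc) N) (cong (λ t → product t * g (suc N)) (sym (List.map-applyUpTo suc g N))))
    where
    last : ∀ h N → product (applyUpTo h (suc N)) ≡ product (applyUpTo h N) * h N
    last h zero    = trans (ℕ.*-identityʳ (h 0)) (sym (ℕ.+-identityʳ (h 0)))
    last h (suc N) = trans (cong (h 0 *_) (last (h ∘ suc) N)) (sym (ℕ.*-assoc (h 0) _ _))

  z-extend : ∀ ν d → zUpTo (zFactor ν) (d + ∣ ν ∣) ≡ z ν
  z-extend ν zero    = refl
  z-extend ν (suc d) = trans (zUpTo-suc (zFactor ν) (d + ∣ ν ∣))
    (trans (cong₂ _*_ (z-extend ν d) one) (ℕ.*-identityʳ (z ν)))
    where
    one : zFactor ν (suc (d + ∣ ν ∣)) ≡ 1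
    one rewrite count-above (suc (d + ∣ ν ∣)) (parts ν) (s≤s (ℕ.m≤n+m ∣ ν ∣ d)) = refl

  zUpTo-cong : ∀ {g h} N → (∀ i → 1 ≤ i → i ≤ N → g i ≡ h i) → zUpTo g N ≡ zUpTo h N
  zUpTo-cong zero    eq = refl
  zUpTo-cong {g} {h} (suc N) eq = trans (zUpTo-suc g N) (trans
    (cong₂ _*_ (zUpTo-cong N λ i 1≤i i≤N → eq i 1≤i (ℕ.m≤n⇒m≤1+n i≤N)) (eq (suc N) (s≤s z≤n) ℕ.≤-refl))
    (sym (zUpTo-suc h N)))

  zUpTo-differ : ∀ {g h} k c N → 1 ≤ k → k ≤ N → g k ≡ c * h k → (∀ i → i ≢ k → g i ≡ h i) →
                 zUpTo g N ≡ c * zUpTo h N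
  zUpTo-differ {g} {h} k c zero 1≤k k≤0 _ _ = contradiction (ℕ.≤-trans 1≤k k≤0) λ ()
  zUpTo-differ {g} {h} k c (suc N) 1≤k k≤1+N at off with k ℕ.≟ suc N
  ... | yes refl = trans (zUpTo-suc g N) (trans
    (cong₂ _*_ (zUpTo-cong N λ i _ i≤N → off i λ { refl → ℕ.1+n≰n i≤N }) at)
    (trans (assoc-comm (zUpTo h N) c (h (suc N))) (cong (c *_) (sym (zUpTo-suc h N)))))
    where
    assoc-comm : ∀ a b d → a * (b * d) ≡ b * (a * d)
    assoc-comm = solve-∀
  ... | no k≢ = trans (zUpTo-suc g N) (trans
    (cong₂ _*_ (zUpTo-differ k c N 1≤k (ℕ.≤-pred (ℕ.≤∧≢⇒< k≤1+N k≢)) at off) (off (suc N) (k≢ ∘ sym)))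
    (trans (ℕ.*-assoc c _ _) (cong (c *_) (sym (zUpTo-suc h N)))))

  -- Only the factor at k changes: with m the old multiplicity, k^(m+1) (m+1)! is k (m+1) times k^m
  -- m!. The ratio is the coefficient that D_k produces, which is why D_k is adjoint to
  -- multiplication by p_k.
  z-∪ : ∀ k .{{_ : NonZero k}} ν → z (⟦ k ⟧ ∪ ν) ≡ k * mult k (⟦ k ⟧ ∪ ν) * z ν
  z-∪ k ν = trans (cong (zUpTo (zFactor (⟦ k ⟧ ∪ ν))) (∣k∪∣ k ν))
    (trans (zUpTo-differ k (k * mult k (⟦ k ⟧ ∪ ν)) (k + ∣ ν ∣) (>-nonZero⁻¹ k) (ℕ.m≤m+n k ∣ ν ∣) at off)
      (cong (k * mult k (⟦ k ⟧ ∪ ν) *_) (z-extend ν k)))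
    where
    at : zFactor (⟦ k ⟧ ∪ ν) k ≡ k * mult k (⟦ k ⟧ ∪ ν) * zFactor ν k
    at rewrite mult-∪ k ν = arith k (suc (mult k ν)) (k ^ mult k ν) (mult k ν !)
      where
      arith : ∀ k m t f → k * t * (m * f) ≡ k * m * (t * f)
      arith = solve-∀
    off : ∀ i → i ≢ k → zFactor (⟦ k ⟧ ∪ ν) i ≡ zFactor ν i
    off i i≢k = cong (λ m → i ^ m * m !)
      (trans (count-↭ i (parts-∪ k ν)) (count-there (parts ν) i≢k))

  z-nonZero : ∀ ν → z ν ≢ 0
  z-nonZero ν = go ∣ ν ∣
    where
    go : ∀ N → zUpTo (zFactor ν) N ≢ 0
    go zero    ()
    go (suc N) eq with ℕ.m*n≡0⇒m≡0∨n≡0 (zUpTo (zFactor ν) N) (trans (sym (zUpTo-suc (zFactor ν) N)) eq)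
    ... | inj₁ p = go N p
    ... | inj₂ p with ℕ.m*n≡0⇒m≡0∨n≡0 (suc N ^ mult (suc N) ν) p
    ...   | inj₁ q = contradiction (ℕ.m^n≡0⇒m≡0 (suc N) (mult (suc N) ν) q) λ ()
    ...   | inj₂ q = contradiction q (≢-nonZero⁻¹ _ {{ mult (suc N) ν ℕ.!≢0 }})

  rows-suc : ∀ m → rows (suc m) 1 ≡ ⟦ 1 ⟧ ∪ rows m 1
  rows-suc m = ↭⇒≡ (↭-trans (sort-↭ (1 ∷ replicate m 1))
    (↭-trans (prep 1 (↭-sym (sort-↭ (replicate m 1)))) (↭-sym (parts-∪ 1 (rows m 1)))))

  mult-rows-1 : ∀ m → mult 1 (rows m 1) ≡ m
  mult-rows-1 zero    = refl
  mult-rows-1 (suc m) = trans (cong (mult 1) (rows-suc m)) (trans (mult-∪ 1 (rows m 1)) (cong suc (mult-rows-1 m)))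

  mult-rows-other : ∀ k m → mult (suc (suc k)) (rows m 1) ≡ 0
  mult-rows-other k zero    = refl
  mult-rows-other k (suc m) = trans (cong (mult (2 + k)) (rows-suc m))
    (trans (count-↭ (2 + k) (parts-∪ 1 (rows m 1)))
      (trans (count-there {x = 1} (parts (rows m 1)) λ ()) (mult-rows-other k m)))

  z-rows : ∀ m → z (rows m 1) ≡ m !
  z-rows zero    = refl
  z-rows (suc m) = begin
    z (rows (suc m) 1)                          ≡⟨ cong z (rows-suc m) ⟩
    z (⟦ 1 ⟧ ∪ rows m 1)                        ≡⟨ z-∪ 1 (rows m 1) ⟩
    1 * mult 1 (⟦ 1 ⟧ ∪ rows m 1) * z (rows m 1) ≡⟨ cong₂ (λ a b → 1 * a * b) (trans (mult-∪ 1 (rows m 1)) (cong suc (mult-rows-1 m))) (z-rows m) ⟩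
    1 * suc m * m !                             ≡⟨ cong (_* m !) (ℕ.*-identityˡ (suc m)) ⟩
    suc m * m !                                 ∎
    where open ≡-Reasoning

  rows-∖ : ∀ m → rows (suc m) 1 ∖ 1 ≡ rows m 1
  rows-∖ m = trans (cong (_∖ 1) (rows-suc m)) (∪-∖ 1 (rows m 1))

  -- Coefficients of power sums at monomials

  sumOver : {A : Set} → (A → ℕ) → List A → ℕ
  sumOver F xs = sum (map F xs)

  lowerHead : ℕ → ℕ → List ℕ → (List ℕ → ℕ) → ℕ
  lowerHead r b β F = if does (r ℕ.≤? b) then F (b ∸ r ∷ β) else 0

  sum-lower-∷ : ∀ (F : List ℕ → ℕ) r b β →
    sumOver F (lower r (b ∷ β)) ≡ lowerHead r b β F + sumOver (F ∘ (b ∷_)) (lower r β)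
  sum-lower-∷ F r b β with does (r ℕ.≤? b)
  ... | true  = cong (λ t → F (b ∸ r ∷ β) + sum t) (sym (List.map-∘ (lower r β)))
  ... | false = cong sum (sym (List.map-∘ (lower r β)))

  ↭-Invariant : {A : Set} → (List ℕ → A) → Set
  ↭-Invariant F = ∀ {β γ} → β ↭ γ → F β ≡ F γ

  -- F is arbitrary because the induction passes under a fixed first entry b, where F becomes F ∘ (b
  -- ∷_).
  sum-lower-↭ : ∀ r {F} → ↭-Invariant F → ↭-Invariant (λ β → sumOver F (lower r β))
  sum-lower-↭ r {F} inv ↭.refl = refl
  sum-lower-↭ r {F} inv (prep {β} {γ} b p) = begin
    sumOver F (lower r (b ∷ β))                                     ≡⟨ sum-lower-∷ F r b β ⟩
    lowerHead r b β F + sumOver (F ∘ (b ∷_)) (lower r β)            ≡⟨ cong₂ _+_ head (sum-lower-↭ r (inv ∘ prep b) p) ⟩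
    lowerHead r b γ F + sumOver (F ∘ (b ∷_)) (lower r γ)            ≡⟨ sum-lower-∷ F r b γ ⟨
    sumOver F (lower r (b ∷ γ))                                     ∎
    where
    open ≡-Reasoning
    head : lowerHead r b β F ≡ lowerHead r b γ F
    head with does (r ℕ.≤? b)
    ... | true  = inv (prep (b ∸ r) p)
    ... | false = refl
  sum-lower-↭ r {F} inv (swap {β} {γ} a b p) = begin
    sumOver F (lower r (a ∷ b ∷ β))
      ≡⟨ sum-lower-∷ F r a (b ∷ β) ⟩
    lowerHead r a (b ∷ β) F + sumOver (F ∘ (a ∷_)) (lower r (b ∷ β))
      ≡⟨ cong (lowerHead r a (b ∷ β) F +_) (sum-lower-∷ (F ∘ (a ∷_)) r b β) ⟩
    lowerHead r a (b ∷ β) F + (lowerHead r b β (F ∘ (a ∷_)) + sumOver (λ δ → F (a ∷ b ∷ δ)) (lower r β))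
      ≡⟨ cong₂ _+_ heada (cong₂ _+_ headb rest) ⟩
    lowerHead r a γ (F ∘ (b ∷_)) + (lowerHead r b (a ∷ γ) F + sumOver (λ δ → F (b ∷ a ∷ δ)) (lower r γ))
      ≡⟨ swapAdd (lowerHead r a γ (F ∘ (b ∷_))) (lowerHead r b (a ∷ γ) F) (sumOver (λ δ → F (b ∷ a ∷ δ)) (lower r γ)) ⟩
    lowerHead r b (a ∷ γ) F + (lowerHead r a γ (F ∘ (b ∷_)) + sumOver (λ δ → F (b ∷ a ∷ δ)) (lower r γ))
      ≡⟨ cong (lowerHead r b (a ∷ γ) F +_) (sum-lower-∷ (F ∘ (b ∷_)) r a γ) ⟨
    lowerHead r b (a ∷ γ) F + sumOver (F ∘ (b ∷_)) (lower r (a ∷ γ))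
      ≡⟨ sum-lower-∷ F r b (a ∷ γ) ⟨
    sumOver F (lower r (b ∷ a ∷ γ)) ∎
    where
    open ≡-Reasoning
    swapAdd : ∀ x y z → x + (y + z) ≡ y + (x + z)
    swapAdd = solve-∀
    heada : lowerHead r a (b ∷ β) F ≡ lowerHead r a γ (F ∘ (b ∷_))
    heada with does (r ℕ.≤? a)
    ... | true  = inv (swap (a ∸ r) b p)
    ... | false = refl
    headb : lowerHead r b β (F ∘ (a ∷_)) ≡ lowerHead r b (a ∷ γ) F
    headb with does (r ℕ.≤? b)
    ... | true  = inv (swap a (b ∸ r) p)
    ... | false = refl
    rest : sumOver (λ δ → F (a ∷ b ∷ δ)) (lower r β) ≡ sumOver (λ δ → F (b ∷ a ∷ δ)) (lower r γ)
    rest = trans (cong sum (List.map-cong (λ δ → inv (swap a b ↭-refl)) (lower r β)))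
                 (sum-lower-↭ r (λ q → inv (prep b (prep a q))) p)
  sum-lower-↭ r {F} inv (↭.trans p q) = trans (sum-lower-↭ r inv p) (sum-lower-↭ r inv q)

  xcoeffᵖ-↭ : ∀ ρ → ↭-Invariant (xcoeffᵖ ρ)
  xcoeffᵖ-↭ []      p = cong (λ s → if does (s ℕ.≟ 0) then 1 else 0) (sum-↭ p)
  xcoeffᵖ-↭ (r ∷ ρ)   = sum-lower-↭ r (xcoeffᵖ-↭ ρ)

  nonZeros : List ℕ → List ℕ
  nonZeros = filter ℕ.nonZero?

  xcoeffᵖ-0∷ : ∀ {ρ} → All NonZero ρ → ∀ β → xcoeffᵖ ρ (0 ∷ β) ≡ xcoeffᵖ ρ β
  xcoeffᵖ-0∷ []               β = refl
  xcoeffᵖ-0∷ {suc r ∷ ρ} (_ ∷ ρ>0) β = trans (sum-lower-∷ (xcoeffᵖ ρ) (suc r) 0 β)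
    (cong sum (List.map-cong (xcoeffᵖ-0∷ ρ>0) (lower (suc r) β)))

  -- Independence of the order and of the number of variables. Such a function of exponent vectors
  -- is determined by its values at partitions (`blind-normalise`); coefficients of power sums and
  -- the sum of squares are of this kind.
  record ZeroBlind (F : List ℕ → ℕ) : Set where
    field
      resp-↭ : ↭-Invariant F
      skip-0 : ∀ β → F (0 ∷ β) ≡ F β

  0∷-congruent : ∀ β → ∃[ m ] β ↭ replicate m 0 ++ nonZeros β
  0∷-congruent [] = 0 , ↭-refl
  0∷-congruent (zero  ∷ β) with 0∷-congruent β
  ... | m , p = suc m , prep 0 p
  0∷-congruent (suc b ∷ β) with 0∷-congruent β
  ... | m , p = m , ↭-trans (prep (suc b) p) (↭-sym (shift (suc b) (replicate m 0) (nonZeros β)))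

  nonZeros-all : ∀ β → All NonZero (nonZeros β)
  nonZeros-all = All.all-filter ℕ.nonZero?

  normalise : List ℕ → Partition
  normalise β = sortParts (nonZeros β) (nonZeros-all β)

  blind-normalise : ∀ {F} → ZeroBlind F → ∀ β → F β ≡ F (parts (normalise β))
  blind-normalise {F} blind β with 0∷-congruent β
  ... | m , p = trans (resp-↭ p) (trans (strip m (nonZeros β)) (resp-↭ (↭-sym (sort-↭ (nonZeros β)))))
    where
    open ZeroBlind blind
    strip : ∀ m γ → F (replicate m 0 ++ γ) ≡ F γ
    strip zero    γ = refl
    strip (suc m) γ = trans (skip-0 _) (strip m γ)

  xcoeffᵖ-blind : ∀ {ρ} → All NonZero ρ → ZeroBlind (xcoeffᵖ ρ)
  xcoeffᵖ-blind {ρ} ρ>0 = record { resp-↭ = xcoeffᵖ-↭ ρ ; skip-0 = xcoeffᵖ-0∷ ρ>0 }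

  sumSq : List ℕ → ℕ
  sumSq = sumOver λ b → b * b

  sumSq-blind : ZeroBlind sumSq
  sumSq-blind = record { resp-↭ = λ p → sum-↭ (map⁺ (λ b → b * b) p) ; skip-0 = λ _ → refl }

  All-if : {A P : Set} {Q : A → Set} {xs : List A} (d : Dec P) → (P → All Q xs) →
           All Q (if does d then xs else [])
  All-if (yes p) q = q p
  All-if (no _)  q = []

  lower-↭ : ∀ r β → All (λ γ → ∃₂ λ b δ → r ≤ b × β ↭ b ∷ δ × γ ↭ b ∸ r ∷ δ) (lower r β)
  lower-↭ r []      = []
  lower-↭ r (b ∷ β) = All.++⁺
    (All-if (r ℕ.≤? b) λ r≤b → (b , β , r≤b , ↭-refl , ↭-refl) ∷ [])
    (All.map⁺ (All.map tail (lower-↭ r β)))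
    where
    tail : ∀ {γ} → (∃₂ λ c δ → r ≤ c × β ↭ c ∷ δ × γ ↭ c ∸ r ∷ δ) →
                   ∃₂ λ c δ → r ≤ c × b ∷ β ↭ c ∷ δ × b ∷ γ ↭ c ∸ r ∷ δ
    tail (c , δ , r≤c , p , q) = c , b ∷ δ , r≤c ,
      ↭-trans (prep b p) (swap b c ↭-refl) , ↭-trans (prep b q) (swap b (c ∸ r) ↭-refl)

  sumOver-≢0 : {A : Set} {F : A → ℕ} {Q : A → Set} {xs : List A} → All Q xs → sumOver F xs ≢ 0 →
               ∃[ x ] Q x × F x ≢ 0
  sumOver-≢0 []  s≢0 = contradiction refl s≢0
  sumOver-≢0 {F = F} (_∷_ {x} q qs) s≢0 with F x ℕ.≟ 0
  ... | no  Fx≢0 = x , q , Fx≢0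
  ... | yes Fx≡0 = sumOver-≢0 qs λ eq → s≢0 (cong₂ _+_ Fx≡0 eq)

  sum≡0⇒zero : ∀ β → sum β ≡ 0 → nonZeros β ≡ []
  sum≡0⇒zero []         _ = refl
  sum≡0⇒zero (zero ∷ β) s = sum≡0⇒zero β s

  xcoeffᵖ[]-≢0 : ∀ β → xcoeffᵖ [] β ≢ 0 → sum β ≡ 0
  xcoeffᵖ[]-≢0 β c with sum β
  ... | zero  = refl
  ... | suc _ = contradiction refl c

  xcoeffᵖ-sum : ∀ ρ β → xcoeffᵖ ρ β ≢ 0 → sum β ≡ sum ρ
  xcoeffᵖ-sum []      β c = xcoeffᵖ[]-≢0 β c
  xcoeffᵖ-sum (r ∷ ρ) β c with sumOver-≢0 (lower-↭ r β) c
  ... | γ , (b , δ , r≤b , p , q) , c′ = begin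
    sum β                   ≡⟨ sum-↭ p ⟩
    b + sum δ               ≡⟨ cong (_+ sum δ) (ℕ.m+[n∸m]≡n r≤b) ⟨
    r + (b ∸ r) + sum δ     ≡⟨ ℕ.+-assoc r (b ∸ r) (sum δ) ⟩
    r + sum (b ∸ r ∷ δ)     ≡⟨ cong (r +_) (sum-↭ q) ⟨
    r + sum γ               ≡⟨ cong (r +_) (xcoeffᵖ-sum ρ γ c′) ⟩
    r + sum ρ               ∎
    where open ≡-Reasoning

  -- x^β occurs in p_ρ when the parts of ρ can be distributed over the variables with totals β. Each
  -- nonzero exponent needs at least one part, so when there are at least as many nonzero exponents
  -- as parts, each receives exactly one.
  xcoeffᵖ-triangular : ∀ {ρ} β → All NonZero ρ → xcoeffᵖ ρ β ≢ 0 →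
                       length ρ ≤ length (nonZeros β) → nonZeros β ↭ ρ
  xcoeffᵖ-triangular {[]}    β _           c _ = ↭-reflexive (sum≡0⇒zero β (xcoeffᵖ[]-≢0 β c))
  xcoeffᵖ-triangular {r ∷ ρ} β (r>0 ∷ ρ>0) c len with sumOver-≢0 (lower-↭ r β) c
  ... | γ , (b , δ , r≤b , p , q) , c′ = case (b ∸ r) refl
    where
    nzβ : nonZeros β ↭ nonZeros (b ∷ δ)
    nzβ = filter-↭ ℕ.nonZero? p
    nzγ : nonZeros γ ↭ nonZeros (b ∸ r ∷ δ)
    nzγ = filter-↭ ℕ.nonZero? q
    nz-b : nonZeros (b ∷ δ) ≡ b ∷ nonZeros δ
    nz-b = List.filter-accept ℕ.nonZero? (>-nonZero (ℕ.≤-trans (>-nonZero⁻¹ r {{r>0}}) r≤b))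
    lenδ : suc (length ρ) ≤ suc (length (nonZeros δ))
    lenδ = subst (suc (length ρ) ≤_) (trans (↭-length nzβ) (cong length nz-b)) len
    case : ∀ d → b ∸ r ≡ d → nonZeros β ↭ r ∷ ρ
    case zero eq = ↭-trans nzβ (↭-trans (↭-reflexive nz-b)
      (↭-trans (prep b (↭-trans (↭-sym nzγ≡) IH)) (↭-reflexive (cong (_∷ ρ) b≡r))))
      where
      b≡r : b ≡ r
      b≡r = ℕ.≤-antisym (ℕ.m∸n≡0⇒m≤n eq) r≤b
      nzγ≡ : nonZeros γ ↭ nonZeros δ
      nzγ≡ = ↭-trans nzγ (↭-reflexive (cong (λ d → nonZeros (d ∷ δ)) eq))
      IH : nonZeros γ ↭ ρ
      IH = xcoeffᵖ-triangular γ ρ>0 c′ (ℕ.≤-trans (ℕ.≤-pred lenδ) (ℕ.≤-reflexive (sym (↭-length nzγ≡))))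
    -- The part r leaves a remainder in its variable, so γ keeps as many nonzero entries as β, at
    -- least 1 + `length ρ`, whereas the induction hypothesis gives exactly `length ρ`.
    case (suc d) eq = contradiction (ℕ.≤-pred lenδ) (ℕ.<⇒≱ (ℕ.≤-reflexive
      (trans (sym (trans (↭-length nzγ) (cong (λ d → length (nonZeros (d ∷ δ))) eq))) (↭-length IH))))
      where
      IH : nonZeros γ ↭ ρ
      IH = xcoeffᵖ-triangular γ ρ>0 c′ (ℕ.≤-trans (ℕ.≤-pred lenδ) (ℕ.≤-trans (ℕ.n≤1+n _) (ℕ.≤-reflexive
        (sym (trans (↭-length nzγ) (cong (λ d → length (nonZeros (d ∷ δ))) eq))))))

  lowerHead-refl : ∀ r β F → lowerHead r r β F ≡ F (0 ∷ β)
  lowerHead-refl r β F rewrite Dec.dec-true (r ℕ.≤? r) ℕ.≤-refl = cong (λ d → F (d ∷ β)) (ℕ.n∸n≡0 r)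

  -- Giving every part its own variable is one of the distributions counted, and a count has no
  -- negative terms.
  xcoeffᵖ-diagonal : ∀ {ρ} → All NonZero ρ → xcoeffᵖ ρ ρ ≢ 0
  xcoeffᵖ-diagonal []                ()
  xcoeffᵖ-diagonal {r ∷ ρ} (_ ∷ ρ>0) eq = xcoeffᵖ-diagonal ρ>0
    (trans (sym (trans (lowerHead-refl r ρ (xcoeffᵖ ρ)) (xcoeffᵖ-0∷ ρ>0 ρ)))
      (ℕ.m+n≡0⇒m≡0 _ (trans (sym (sum-lower-∷ (xcoeffᵖ ρ) r r ρ)) eq)))

  -- Dominance and the sum of squares

  dot : List ℕ → List ℕ → ℕ
  dot []       ys       = 0
  dot (x ∷ xs) []       = 0
  dot (x ∷ xs) (y ∷ ys) = x * y + dot xs ys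

  -- Squared Euclidean distance, the shorter list being padded with zeros, just as `dot` is the
  -- scalar product. `sumSq-expand` is polarisation, ‖x‖² + ‖y‖² = 2⟨x, y⟩ + ‖x - y‖², in a form
  -- that makes sense in ℕ.
  distSq : List ℕ → List ℕ → ℕ
  distSq []       ys       = sumSq ys
  distSq (x ∷ xs) []       = sumSq (x ∷ xs)
  distSq (x ∷ xs) (y ∷ ys) = ∣ x - y ∣ * ∣ x - y ∣ + distSq xs ys

  square-expand : ∀ x y → x * x + y * y ≡ 2 * (x * y) + ∣ x - y ∣ * ∣ x - y ∣
  square-expand x y with ℕ.≤-total x y
  ... | inj₁ x≤y = subst₂ (λ w d → x * x + w * w ≡ 2 * (x * w) + d * d) (ℕ.m+[n∸m]≡n x≤y)
      (sym (ℕ.m≤n⇒∣m-n∣≡n∸m x≤y)) (ring x (y ∸ x))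
    where
    ring : ∀ x d → x * x + (x + d) * (x + d) ≡ 2 * (x * (x + d)) + d * d
    ring = solve-∀
  ... | inj₂ y≤x = subst₂ (λ w d → w * w + y * y ≡ 2 * (w * y) + d * d) (ℕ.m+[n∸m]≡n y≤x)
      (sym (ℕ.m≤n⇒∣n-m∣≡n∸m y≤x)) (ring y (x ∸ y))
    where
    ring : ∀ y d → (y + d) * (y + d) + y * y ≡ 2 * ((y + d) * y) + d * d
    ring = solve-∀

  sumSq-expand : ∀ xs ys → sumSq xs + sumSq ys ≡ 2 * dot xs ys + distSq xs ys
  sumSq-expand []       ys       = refl
  sumSq-expand (x ∷ xs) []       = ℕ.+-identityʳ _
  sumSq-expand (x ∷ xs) (y ∷ ys) = trans (shuffle (x * x) (sumSq xs) (y * y) (sumSq ys))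
    (trans (cong₂ _+_ (square-expand x y) (sumSq-expand xs ys))
      (unshuffle (x * y) (∣ x - y ∣ * ∣ x - y ∣) (dot xs ys) (distSq xs ys)))
    where
    shuffle : ∀ a b c d → a + b + (c + d) ≡ a + c + (b + d)
    shuffle = solve-∀
    unshuffle : ∀ a b c d → 2 * a + b + (2 * c + d) ≡ 2 * (a + c) + (b + d)
    unshuffle = solve-∀

  sumSq≡0 : ∀ {xs} → All NonZero xs → sumSq xs ≡ 0 → xs ≡ []
  sumSq≡0 {[]}         _  _ = refl
  sumSq≡0 {zero ∷ _}  (0≢0 ∷ _) _ = contradiction refl (≢-nonZero⁻¹ 0 {{0≢0}})

  distSq≡0 : ∀ {xs ys} → All NonZero xs → All NonZero ys → distSq xs ys ≡ 0 → xs ≡ ys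
  distSq≡0 {[]}     {ys}     _ ys>0 eq = sym (sumSq≡0 ys>0 eq)
  distSq≡0 {x ∷ xs} {[]}     xs>0 _ eq = sumSq≡0 xs>0 eq
  distSq≡0 {x ∷ xs} {y ∷ ys} (_ ∷ xs>0) (_ ∷ ys>0) eq = cong₂ _∷_
    (ℕ.∣m-n∣≡0⇒m≡n (square≡0 _ (ℕ.m+n≡0⇒m≡0 _ eq)))
    (distSq≡0 xs>0 ys>0 (ℕ.m+n≡0⇒n≡0 (∣ x - y ∣ * ∣ x - y ∣) eq))
    where
    square≡0 : ∀ d → d * d ≡ 0 → d ≡ 0
    square≡0 zero _ = refl

  -- Summation by parts: d is the excess of ys over xs accumulated so far.
  sumSq≤dot : ∀ m d xs ys → Linked _≥_ (m ∷ xs) → (∀ k → sum (take k xs) ≤ d + sum (take k ys)) →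
              sumSq xs ≤ d * m + dot xs ys
  sumSq≤dot m d []       ys       _           dom = z≤n
  sumSq≤dot m d (x ∷ xs) ys       (m≥x ∷ xs↘) dom = step ys dom
    where
    module _ (e : ℕ) (tl : List ℕ) (x≤e : x ≤ e)
             (dom′ : ∀ k → x + sum (take k xs) ≤ e + sum (take k tl)) where
      rest : ∀ k → sum (take k xs) ≤ e ∸ x + sum (take k tl)
      rest k = ℕ.+-cancelˡ-≤ x _ _ (ℕ.≤-trans (dom′ k)
        (ℕ.≤-reflexive (trans (cong (_+ sum (take k tl)) (sym (ℕ.m+[n∸m]≡n x≤e))) (ℕ.+-assoc x (e ∸ x) _))))
      head : sumSq (x ∷ xs) ≤ e * x + dot xs tl
      head = ℕ.≤-trans (ℕ.+-monoʳ-≤ (x * x) (sumSq≤dot x (e ∸ x) xs tl xs↘ rest))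
        (ℕ.≤-reflexive (trans (ring x (e ∸ x) (dot xs tl)) (cong (λ e → e * x + dot xs tl) (ℕ.m+[n∸m]≡n x≤e))))
        where
        ring : ∀ x f t → x * x + (f * x + t) ≡ (x + f) * x + t
        ring = solve-∀
    step : ∀ ys → (∀ k → sum (take k (x ∷ xs)) ≤ d + sum (take k ys)) →
           sumSq (x ∷ xs) ≤ d * m + dot (x ∷ xs) ys
    step [] dom = ℕ.≤-trans (head d [] x≤d dom′)
      (ℕ.≤-trans (ℕ.≤-reflexive (trans (cong (d * x +_) (dot[] xs)) (ℕ.+-identityʳ _)))
        (ℕ.≤-trans (ℕ.*-monoʳ-≤ d m≥x) (ℕ.m≤m+n (d * m) 0)))
      where
      dot[] : ∀ xs → dot xs [] ≡ 0
      dot[] []      = refl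
      dot[] (_ ∷ _) = refl
      x≤d : x ≤ d
      x≤d = subst₂ _≤_ (ℕ.+-identityʳ x) (ℕ.+-identityʳ d) (dom 1)
      take[] : ∀ k → take {A = ℕ} k [] ≡ []
      take[] zero    = refl
      take[] (suc k) = refl
      dom′ : ∀ k → x + sum (take k xs) ≤ d + sum (take k [])
      dom′ k = subst (λ t → x + sum (take k xs) ≤ d + sum t) (sym (take[] k)) (dom (suc k))
    step (y ∷ ys) dom = ℕ.≤-trans (head (d + y) ys x≤ dom′)
      (ℕ.≤-trans (ℕ.≤-reflexive (ring d x y (dot xs ys))) (ℕ.+-monoˡ-≤ _ (ℕ.*-monoʳ-≤ d m≥x)))
      where
      ring : ∀ d x y t → (d + y) * x + t ≡ d * x + (x * y + t)
      ring = solve-∀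
      x≤ : x ≤ d + y
      x≤ = subst₂ _≤_ (ℕ.+-identityʳ x) (cong (d +_) (ℕ.+-identityʳ y)) (dom 1)
      dom′ : ∀ k → x + sum (take k xs) ≤ d + y + sum (take k ys)
      dom′ k = subst (x + sum (take k xs) ≤_) (sym (ℕ.+-assoc d y _)) (dom (suc k))

  rank : Partition → ℕ
  rank ν = sumSq (parts ν)

  linked-∷ : ∀ {xs} → Linked _≥_ xs → ∃[ m ] Linked _≥_ (m ∷ xs)
  linked-∷ {[]}    _ = 0 , [-]
  linked-∷ {x ∷ _} l = x , ℕ.≤-refl ∷ l

  -- Summation by parts turns dominance into ‖μ‖² ≤ ⟨μ, ν⟩. By polarisation ‖μ‖² + ‖μ - ν‖² ≤ ‖ν‖²,
  -- which is strict in the ranks unless μ = ν.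
  ⊴⇒rank : ∀ {μ ν} → μ ⊴ ν → μ ≡ ν ⊎ rank μ < rank ν
  ⊴⇒rank {μ} {ν} (_ , dom) with distSq (parts μ) (parts ν) in eq
  ... | zero  = inj₁ (parts-injective (distSq≡0 (parts-positive μ) (parts-positive ν) eq))
  ... | suc d = inj₂ (ℕ.+-cancelˡ-< (rank μ) _ _ (begin-strict
    rank μ + rank μ                                    ≤⟨ ℕ.+-mono-≤ le le ⟩
    dot (parts μ) (parts ν) + dot (parts μ) (parts ν)  ≡⟨ cong (dot (parts μ) (parts ν) +_) (ℕ.+-identityʳ _) ⟨
    2 * dot (parts μ) (parts ν)                        <⟨ ℕ.m<m+n _ (s≤s z≤n) ⟩
    2 * dot (parts μ) (parts ν) + suc d                ≡⟨ cong (2 * dot (parts μ) (parts ν) +_) eq ⟨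
    2 * dot (parts μ) (parts ν) + distSq (parts μ) (parts ν) ≡⟨ sumSq-expand (parts μ) (parts ν) ⟨
    rank μ + rank ν                                    ∎))
    where
    open ℕ.≤-Reasoning
    le : rank μ ≤ dot (parts μ) (parts ν)
    le = sumSq≤dot _ 0 (parts μ) (parts ν) (proj₂ (linked-∷ (parts-sorted μ))) dom

  -- Bounds the rank of a partition of n by n², so that the threshold n² + 1 imposes no condition in
  -- degree n.
  sumSq≤square : ∀ xs → sumSq xs ≤ sum xs * sum xs
  sumSq≤square []       = z≤n
  sumSq≤square (x ∷ xs) = ℕ.≤-trans (ℕ.+-monoʳ-≤ (x * x) (sumSq≤square xs))
    (ℕ.≤-trans (ℕ.m≤m+n _ (2 * (x * sum xs))) (ℕ.≤-reflexive (ring x (sum xs))))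
    where
    ring : ∀ x s → x * x + s * s + 2 * (x * s) ≡ (x + s) * (x + s)
    ring = solve-∀

  -- Enumeration of partitions

  listsOver : {A : Set} → List A → ℕ → List (List A)
  listsOver as zero    = [ [] ]
  listsOver as (suc ℓ) = [] ∷ concatMap (λ a → map (a ∷_) (listsOver as ℓ)) as

  ∈-listsOver : {A : Set} {as : List A} {xs : List A} → ∀ ℓ → All (_∈ as) xs → length xs ≤ ℓ →
                xs ∈ listsOver as ℓ
  ∈-listsOver zero    []       _  = here refl
  ∈-listsOver (suc ℓ) []       _  = here refl
  ∈-listsOver {as = as} (suc ℓ) (_∷_ {x} {xs} x∈ xs∈) len = there (∈-concatMap⁺ (λ a → map (a ∷_) (listsOver as ℓ))
    (Any.map (λ { refl → ∈-map⁺ (x ∷_) (∈-listsOver ℓ xs∈ (ℕ.≤-pred len)) }) x∈))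

  sucs-nonZero : ∀ xs → All NonZero (map suc xs)
  sucs-nonZero []       = []
  sucs-nonZero (x ∷ xs) = _ ∷ sucs-nonZero xs

  -- All lists of at most n parts from 1, ..., n, sorted. Repetitions and partitions of size above n
  -- occur; the elimination in `span` filters by size and rank, and treating a partition twice does
  -- no harm there.
  partitions≤ : ℕ → List Partition
  partitions≤ n = map (λ xs → sortParts (map suc xs) (sucs-nonZero xs)) (listsOver (upTo n) n)

  length≤sum : ∀ {xs} → All NonZero xs → length xs ≤ sum xs
  length≤sum []                    = z≤n
  length≤sum {suc x ∷ xs} (_ ∷ xs>0) = s≤s (ℕ.≤-trans (length≤sum xs>0) (ℕ.m≤n+m _ x))

  ∈-partitions≤ : ∀ {n} ν → ∣ ν ∣ ≤ n → ν ∈ partitions≤ n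
  ∈-partitions≤ {n} ν ∣ν∣≤n = subst (_∈ partitions≤ n) (↭⇒≡ (↭-trans (sort-↭ _) (↭-reflexive (suc-pred (parts-positive ν)))))
    (∈-map⁺ _ (∈-listsOver n (All.map⁺ (below (parts-positive ν) ∣ν∣≤n))
      (subst (_≤ n) (sym (List.length-map pred (parts ν))) (ℕ.≤-trans (length≤sum (parts-positive ν)) ∣ν∣≤n))))
    where
    suc-pred : ∀ {xs} → All NonZero xs → map suc (map pred xs) ≡ xs
    suc-pred []                     = refl
    suc-pred {suc x ∷ xs} (_ ∷ xs>0) = cong (suc x ∷_) (suc-pred xs>0)
    below : ∀ {xs} → All NonZero xs → sum xs ≤ n → All (λ x → pred x ∈ upTo n) xs
    below []                      _ = []
    below {suc x ∷ xs} (_ ∷ xs>0) le = ∈-upTo⁺ (ℕ.≤-trans (s≤s (ℕ.m≤m+n x (sum xs))) le) ∷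
      below xs>0 (ℕ.≤-trans (ℕ.m≤n+m (sum xs) (suc x)) le)

-- The commutative ring ℚ[α]

module RationalFunctions where

  open import Defs hiding (_≈_)
  import Data.Integer.Base as ℤ
  import Data.Integer.Properties as ℤ
  open import Data.Rational.Base as ℚ using (ℚ; 0ℚ; 1ℚ)
  import Data.Rational.Properties as ℚ
  import Data.Rational.Unnormalised.Base as ℚᵘ
  import Data.Rational.Unnormalised.Properties as ℚᵘ
  open ≡ using (refl; sym; trans; cong; cong₂; module ≡-Reasoning)
  open ℚ⟨α⟩

  -- A record, so that the endpoints of an equation can be inferred.
  infix 4 _≋_
  record _≋_ (p q : ℚ[α]) : Set where
    constructor wrap
    field unwrap : p ≈ᵖ q
  open _≋_

  ≋-refl : ∀ {p} → p ≋ p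
  ≋-refl = wrap λ _ → refl

  ≋-sym : ∀ {p q} → p ≋ q → q ≋ p
  ≋-sym e = wrap λ k → sym (unwrap e k)

  ≋-trans : ∀ {p q r} → p ≋ q → q ≋ r → p ≋ r
  ≋-trans e f = wrap λ k → trans (unwrap e k) (unwrap f k)

  negᵖ : ℚ[α] → ℚ[α]
  negᵖ = map (λ a → ℚ.- a)

  scaleᵖ : ℚ → ℚ[α] → ℚ[α]
  scaleᵖ a = map (a ℚ.*_)

  coefᵖ-neg : ∀ p k → coefᵖ (negᵖ p) k ≡ ℚ.- coefᵖ p k
  coefᵖ-neg []      k       = refl
  coefᵖ-neg (a ∷ p) zero    = refl
  coefᵖ-neg (a ∷ p) (suc k) = coefᵖ-neg p k

  +ᵖ-cong : ∀ {p p′ q q′} → p ≋ p′ → q ≋ q′ → p +ᵖ q ≋ p′ +ᵖ q′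
  +ᵖ-cong {p} {p′} {q} {q′} e f = wrap λ k → trans (coefᵖ-+ p q k)
    (trans (cong₂ ℚ._+_ (unwrap e k) (unwrap f k)) (sym (coefᵖ-+ p′ q′ k)))

  +ᵖ-assoc : ∀ p q r → (p +ᵖ q) +ᵖ r ≋ p +ᵖ (q +ᵖ r)
  +ᵖ-assoc p q r = wrap λ k → begin
    coefᵖ ((p +ᵖ q) +ᵖ r) k                    ≡⟨ coefᵖ-+ (p +ᵖ q) r k ⟩
    coefᵖ (p +ᵖ q) k ℚ.+ coefᵖ r k             ≡⟨ cong (ℚ._+ coefᵖ r k) (coefᵖ-+ p q k) ⟩
    coefᵖ p k ℚ.+ coefᵖ q k ℚ.+ coefᵖ r k      ≡⟨ ℚ.+-assoc (coefᵖ p k) (coefᵖ q k) (coefᵖ r k) ⟩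
    coefᵖ p k ℚ.+ (coefᵖ q k ℚ.+ coefᵖ r k)    ≡⟨ cong (coefᵖ p k ℚ.+_) (coefᵖ-+ q r k) ⟨
    coefᵖ p k ℚ.+ coefᵖ (q +ᵖ r) k             ≡⟨ coefᵖ-+ p (q +ᵖ r) k ⟨
    coefᵖ (p +ᵖ (q +ᵖ r)) k                    ∎
    where open ≡-Reasoning

  +ᵖ-comm : ∀ p q → p +ᵖ q ≋ q +ᵖ p
  +ᵖ-comm p q = wrap λ k → trans (coefᵖ-+ p q k)
    (trans (ℚ.+-comm (coefᵖ p k) (coefᵖ q k)) (sym (coefᵖ-+ q p k)))

  +ᵖ-identityʳ : ∀ p → p +ᵖ [] ≋ p
  +ᵖ-identityʳ p = +ᵖ-comm p []

  +ᵖ-inverseʳ : ∀ p → p +ᵖ negᵖ p ≋ []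
  +ᵖ-inverseʳ p = wrap λ k → trans (coefᵖ-+ p (negᵖ p) k)
    (trans (cong (coefᵖ p k ℚ.+_) (coefᵖ-neg p k)) (ℚ.+-inverseʳ (coefᵖ p k)))

  negᵖ-cong : ∀ {p q} → p ≋ q → negᵖ p ≋ negᵖ q
  negᵖ-cong {p} {q} e = wrap λ k → trans (coefᵖ-neg p k) (trans (cong (λ a → ℚ.- a) (unwrap e k)) (sym (coefᵖ-neg q k)))

  scaleᵖ-cong : ∀ a {p q} → p ≋ q → scaleᵖ a p ≋ scaleᵖ a q
  scaleᵖ-cong a {p} {q} e = wrap λ k → trans (coefᵖ-scale a p k)
    (trans (cong (a ℚ.*_) (unwrap e k)) (sym (coefᵖ-scale a q k)))

  scaleᵖ-+ᵖ : ∀ a p q → scaleᵖ a (p +ᵖ q) ≋ scaleᵖ a p +ᵖ scaleᵖ a q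
  scaleᵖ-+ᵖ a p q = wrap λ k → begin
    coefᵖ (scaleᵖ a (p +ᵖ q)) k                     ≡⟨ coefᵖ-scale a (p +ᵖ q) k ⟩
    a ℚ.* coefᵖ (p +ᵖ q) k                          ≡⟨ cong (a ℚ.*_) (coefᵖ-+ p q k) ⟩
    a ℚ.* (coefᵖ p k ℚ.+ coefᵖ q k)                 ≡⟨ ℚ.*-distribˡ-+ a (coefᵖ p k) (coefᵖ q k) ⟩
    a ℚ.* coefᵖ p k ℚ.+ a ℚ.* coefᵖ q k             ≡⟨ cong₂ ℚ._+_ (coefᵖ-scale a p k) (coefᵖ-scale a q k) ⟨
    coefᵖ (scaleᵖ a p) k ℚ.+ coefᵖ (scaleᵖ a q) k   ≡⟨ coefᵖ-+ (scaleᵖ a p) (scaleᵖ a q) k ⟨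
    coefᵖ (scaleᵖ a p +ᵖ scaleᵖ a q) k              ∎
    where open ≡-Reasoning

  scaleᵖ-scaleᵖ : ∀ a b p → scaleᵖ a (scaleᵖ b p) ≋ scaleᵖ (a ℚ.* b) p
  scaleᵖ-scaleᵖ a b p = wrap λ k → trans (coefᵖ-scale a (scaleᵖ b p) k)
    (trans (cong (a ℚ.*_) (coefᵖ-scale b p k))
      (trans (sym (ℚ.*-assoc a b (coefᵖ p k))) (sym (coefᵖ-scale (a ℚ.* b) p k))))

  scaleᵖ-0 : ∀ p → scaleᵖ 0ℚ p ≋ []
  scaleᵖ-0 p = wrap λ k → trans (coefᵖ-scale 0ℚ p k) (ℚ.*-zeroˡ (coefᵖ p k))

  scaleᵖ-1 : ∀ p → scaleᵖ 1ℚ p ≋ p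
  scaleᵖ-1 p = wrap λ k → trans (coefᵖ-scale 1ℚ p k) (ℚ.*-identityˡ (coefᵖ p k))

  ∷-cong : ∀ {p q} a → p ≋ q → a ∷ p ≋ a ∷ q
  ∷-cong {p} {q} a e = wrap go
    where
    go : a ∷ p ≈ᵖ a ∷ q
    go zero    = refl
    go (suc k) = unwrap e k

  0∷[] : 0ℚ ∷ [] ≋ []
  0∷[] = wrap go
    where
    go : 0ℚ ∷ [] ≈ᵖ []
    go zero    = refl
    go (suc k) = refl

  *ᵖ-congˡ : ∀ p {q q′} → q ≋ q′ → p *ᵖ q ≋ p *ᵖ q′
  *ᵖ-congˡ []      e = ≋-refl
  *ᵖ-congˡ (a ∷ p) e = +ᵖ-cong (scaleᵖ-cong a e) (∷-cong 0ℚ (*ᵖ-congˡ p e))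

  *ᵖ-zeroʳ : ∀ p → p *ᵖ [] ≋ []
  *ᵖ-zeroʳ []      = ≋-refl
  *ᵖ-zeroʳ (a ∷ p) = ≋-trans (∷-cong 0ℚ (*ᵖ-zeroʳ p)) 0∷[]

  interchange : ∀ p q r s → (p +ᵖ q) +ᵖ (r +ᵖ s) ≋ (p +ᵖ r) +ᵖ (q +ᵖ s)
  interchange p q r s = ≋-trans (+ᵖ-assoc p q (r +ᵖ s)) (≋-trans
    (+ᵖ-cong (≋-refl {p}) (≋-trans (≋-sym (+ᵖ-assoc q r s))
      (≋-trans (+ᵖ-cong (+ᵖ-comm q r) (≋-refl {s})) (+ᵖ-assoc r q s))))
    (≋-sym (+ᵖ-assoc p r (q +ᵖ s))))

  -- `_*ᵖ_` recurses on its first factor; this is the matching recursion on the second, from which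
  -- commutativity follows by induction.
  *ᵖ-shiftʳ : ∀ p b q → p *ᵖ (b ∷ q) ≋ scaleᵖ b p +ᵖ (0ℚ ∷ p *ᵖ q)
  *ᵖ-shiftʳ []      b q = ≋-sym 0∷[]
  *ᵖ-shiftʳ (a ∷ p) b q = wrap go
    where
    open ≡-Reasoning
    IH : p *ᵖ (b ∷ q) ≋ scaleᵖ b p +ᵖ (0ℚ ∷ p *ᵖ q)
    IH = *ᵖ-shiftʳ p b q
    swapˡ : scaleᵖ a q +ᵖ (scaleᵖ b p +ᵖ (0ℚ ∷ p *ᵖ q)) ≋ scaleᵖ b p +ᵖ (scaleᵖ a q +ᵖ (0ℚ ∷ p *ᵖ q))
    swapˡ = ≋-trans (≋-sym (+ᵖ-assoc (scaleᵖ a q) (scaleᵖ b p) _))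
      (≋-trans (+ᵖ-cong (+ᵖ-comm (scaleᵖ a q) (scaleᵖ b p)) ≋-refl) (+ᵖ-assoc (scaleᵖ b p) (scaleᵖ a q) _))
    go : (a ∷ p) *ᵖ (b ∷ q) ≈ᵖ scaleᵖ b (a ∷ p) +ᵖ (0ℚ ∷ (a ∷ p) *ᵖ q)
    go zero    = cong (ℚ._+ 0ℚ) (ℚ.*-comm a b)
    go (suc k) = unwrap (≋-trans (+ᵖ-cong (≋-refl {scaleᵖ a q}) IH) swapˡ) k

  *ᵖ-comm : ∀ p q → p *ᵖ q ≋ q *ᵖ p
  *ᵖ-comm []      q = ≋-sym (*ᵖ-zeroʳ q)
  *ᵖ-comm (a ∷ p) q = ≋-trans (+ᵖ-cong ≋-refl (∷-cong 0ℚ (*ᵖ-comm p q))) (≋-sym (*ᵖ-shiftʳ q a p))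

  *ᵖ-cong : ∀ {p p′ q q′} → p ≋ p′ → q ≋ q′ → p *ᵖ q ≋ p′ *ᵖ q′
  *ᵖ-cong {p} {p′} {q} {q′} e f = ≋-trans (*ᵖ-congˡ p f)
    (≋-trans (*ᵖ-comm p q′) (≋-trans (*ᵖ-congˡ q′ e) (*ᵖ-comm q′ p′)))

  *ᵖ-distribˡ : ∀ p q r → p *ᵖ (q +ᵖ r) ≋ p *ᵖ q +ᵖ p *ᵖ r
  *ᵖ-distribˡ []      q r = ≋-refl
  *ᵖ-distribˡ (a ∷ p) q r = ≋-trans (+ᵖ-cong (scaleᵖ-+ᵖ a q r) (∷-cong 0ℚ (*ᵖ-distribˡ p q r)))
    (interchange (scaleᵖ a q) (scaleᵖ a r) (0ℚ ∷ p *ᵖ q) (0ℚ ∷ p *ᵖ r))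

  *ᵖ-distribʳ : ∀ r p q → (p +ᵖ q) *ᵖ r ≋ p *ᵖ r +ᵖ q *ᵖ r
  *ᵖ-distribʳ r p q = ≋-trans (*ᵖ-comm (p +ᵖ q) r)
    (≋-trans (*ᵖ-distribˡ r p q) (+ᵖ-cong (*ᵖ-comm r p) (*ᵖ-comm r q)))

  scaleᵖ-*ᵖ : ∀ a p q → scaleᵖ a p *ᵖ q ≋ scaleᵖ a (p *ᵖ q)
  scaleᵖ-*ᵖ a []      q = ≋-refl
  scaleᵖ-*ᵖ a (b ∷ p) q = ≋-trans
    (+ᵖ-cong (≋-sym (scaleᵖ-scaleᵖ a b q)) (∷-cong 0ℚ (scaleᵖ-*ᵖ a p q)))
    (≋-trans (+ᵖ-cong (≋-refl {scaleᵖ a (scaleᵖ b q)}) (wrap {0ℚ ∷ scaleᵖ a (p *ᵖ q)} {scaleᵖ a (0ℚ ∷ p *ᵖ q)} zero-head)) (≋-sym (scaleᵖ-+ᵖ a (scaleᵖ b q) (0ℚ ∷ p *ᵖ q))))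
    where
    zero-head : 0ℚ ∷ scaleᵖ a (p *ᵖ q) ≈ᵖ scaleᵖ a (0ℚ ∷ p *ᵖ q)
    zero-head zero    = sym (ℚ.*-zeroʳ a)
    zero-head (suc k) = refl

  shift-*ᵖ : ∀ p q → (0ℚ ∷ p) *ᵖ q ≋ 0ℚ ∷ p *ᵖ q
  shift-*ᵖ p q = +ᵖ-cong (scaleᵖ-0 q) ≋-refl

  *ᵖ-assoc : ∀ p q r → (p *ᵖ q) *ᵖ r ≋ p *ᵖ (q *ᵖ r)
  *ᵖ-assoc []      q r = ≋-refl
  *ᵖ-assoc (a ∷ p) q r = ≋-trans (*ᵖ-distribʳ r (scaleᵖ a q) (0ℚ ∷ p *ᵖ q))
    (+ᵖ-cong (scaleᵖ-*ᵖ a q r) (≋-trans (shift-*ᵖ (p *ᵖ q) r) (∷-cong 0ℚ (*ᵖ-assoc p q r))))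

  *ᵖ-identityˡ : ∀ p → [ 1ℚ ] *ᵖ p ≋ p
  *ᵖ-identityˡ p = ≋-trans (+ᵖ-cong (scaleᵖ-1 p) 0∷[]) (+ᵖ-identityʳ p)

  isEquivalence-≋ : IsEquivalence _≋_
  isEquivalence-≋ = record { refl = ≋-refl ; sym = ≋-sym ; trans = ≋-trans }

  ℚ[α]-commutativeRing : CommutativeRing 0ℓ 0ℓ
  ℚ[α]-commutativeRing = record
    { Carrier = ℚ[α] ; _≈_ = _≋_ ; _+_ = _+ᵖ_ ; _*_ = _*ᵖ_ ; -_ = negᵖ ; 0# = [] ; 1# = [ 1ℚ ]
    ; isCommutativeRing = record
      { isRing = record
        { +-isAbelianGroup = record
          { isGroup = record
            { isMonoid = record
              { isSemigroup = record
                { isMagma = record { isEquivalence = isEquivalence-≋ ; ∙-cong = +ᵖ-cong }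
                ; assoc = +ᵖ-assoc }
              ; identity = (λ _ → ≋-refl) , +ᵖ-identityʳ }
            ; inverse = (λ p → ≋-trans (+ᵖ-comm (negᵖ p) p) (+ᵖ-inverseʳ p)) , +ᵖ-inverseʳ
            ; ⁻¹-cong = negᵖ-cong }
          ; comm = +ᵖ-comm }
        ; *-cong = *ᵖ-cong
        ; *-assoc = *ᵖ-assoc
        ; *-identity = *ᵖ-identityˡ , λ p → ≋-trans (*ᵖ-comm p [ 1ℚ ]) (*ᵖ-identityˡ p)
        ; distrib = *ᵖ-distribˡ , *ᵖ-distribʳ }
      ; *-comm = *ᵖ-comm } }

  -- From the domain ℚ[α] to the field ℚ(α)

  *ᵖ-cancel-0 : ∀ d p → NonZeroᵖ d → d *ᵖ p ≋ [] → p ≋ []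
  *ᵖ-cancel-0 d p d≢0 dp≈0 = wrap λ k → go k
    where
    go : ∀ k → coefᵖ p k ≡ 0ℚ
    go k with coefᵖ p k ℚ.≟ 0ℚ
    ... | yes eq = eq
    ... | no neq with *ᵖ-nonZero d p d≢0 (k , neq)
    ...   | j , dpⱼ≢0 = contradiction (unwrap dp≈0 j) dpⱼ≢0

  -- Each law of fractions is an identity between cross-multiplied numerators and denominators. Over
  -- an arbitrary commutative ring the solver meets variables in place of lists of coefficients.
  module FractionIdentities (R : CommutativeRing 0ℓ 0ℓ) where
    open CommutativeRing R renaming (refl to ≈-refl; sym to ≈-sym; trans to ≈-trans)
    open import Relation.Binary.Reasoning.Setoid setoid
    open import Algebra.Properties.Ring ring using (-‿distribˡ-*; -‿distribʳ-*; x∙y⁻¹≈ε⇒x≈y)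
    open import Algebra.Solver.Ring.NaturalCoefficients.Default commutativeSemiring

    cancel-from-0 : ∀ d → (∀ p → d * p ≈ 0# → p ≈ 0#) → ∀ {p q} → d * p ≈ d * q → p ≈ q
    cancel-from-0 d d-reg {p} {q} dp≈dq = x∙y⁻¹≈ε⇒x≈y p q (d-reg (p - q) (begin
      d * (p - q)        ≈⟨ distribˡ d p (- q) ⟩
      d * p + d * - q    ≈⟨ +-cong dp≈dq (≈-sym (-‿distribʳ-* d q)) ⟩
      d * q - d * q      ≈⟨ -‿inverseʳ (d * q) ⟩
      0#                 ∎))

    -- Cross-multiplication is transitive only up to the factor d, the middle denominator, which
    -- `cancel-from-0` then removes.
    trans-identity : ∀ {a b c d e f} → a * d ≈ c * b → c * f ≈ e * d → d * (a * f) ≈ d * (e * b)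
    trans-identity {a} {b} {c} {d} {e} {f} p q = begin
      d * (a * f)  ≈⟨ solve 3 (λ d a f → d :* (a :* f) := (a :* d) :* f) ≈-refl d a f ⟩
      (a * d) * f  ≈⟨ *-congʳ p ⟩
      (c * b) * f  ≈⟨ solve 3 (λ c b f → (c :* b) :* f := (c :* f) :* b) ≈-refl c b f ⟩
      (c * f) * b  ≈⟨ *-congʳ q ⟩
      (e * d) * b  ≈⟨ solve 3 (λ e d b → (e :* d) :* b := d :* (e :* b)) ≈-refl e d b ⟩
      d * (e * b)  ∎

    +-cong-identity : ∀ {a b c d a′ b′ c′ d′} → a * d ≈ c * b → a′ * d′ ≈ c′ * b′ →
      (a * b′ + a′ * b) * (d * d′) ≈ (c * d′ + c′ * d) * (b * b′)
    +-cong-identity {a} {b} {c} {d} {a′} {b′} {c′} {d′} p q = begin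
      (a * b′ + a′ * b) * (d * d′)
        ≈⟨ solve 6 (λ a b d a′ b′ d′ → (a :* b′ :+ a′ :* b) :* (d :* d′) :=
             (a :* d) :* (b′ :* d′) :+ (a′ :* d′) :* (b :* d)) ≈-refl a b d a′ b′ d′ ⟩
      (a * d) * (b′ * d′) + (a′ * d′) * (b * d)
        ≈⟨ +-cong (*-congʳ p) (*-congʳ q) ⟩
      (c * b) * (b′ * d′) + (c′ * b′) * (b * d)
        ≈⟨ solve 6 (λ b c d b′ c′ d′ → (c :* b) :* (b′ :* d′) :+ (c′ :* b′) :* (b :* d) :=
             (c :* d′ :+ c′ :* d) :* (b :* b′)) ≈-refl b c d b′ c′ d′ ⟩
      (c * d′ + c′ * d) * (b * b′) ∎

    *-cong-identity : ∀ {a b c d a′ b′ c′ d′} → a * d ≈ c * b → a′ * d′ ≈ c′ * b′ →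
      (a * a′) * (d * d′) ≈ (c * c′) * (b * b′)
    *-cong-identity {a} {b} {c} {d} {a′} {b′} {c′} {d′} p q = begin
      (a * a′) * (d * d′)  ≈⟨ medial a a′ d d′ ⟩
      (a * d) * (a′ * d′)  ≈⟨ *-cong p q ⟩
      (c * b) * (c′ * b′)  ≈⟨ medial c b c′ b′ ⟩
      (c * c′) * (b * b′)  ∎
      where
      medial : ∀ w x y z → (w * x) * (y * z) ≈ (w * y) * (x * z)
      medial = solve 4 (λ w x y z → (w :* x) :* (y :* z) := (w :* y) :* (x :* z)) ≈-refl

    +-assoc-identity : ∀ a b c d e f →
      ((a * d + c * b) * f + e * (b * d)) * (b * (d * f)) ≈
      (a * (d * f) + (c * f + e * d) * b) * ((b * d) * f)
    +-assoc-identity = solve 6 (λ a b c d e f →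
      ((a :* d :+ c :* b) :* f :+ e :* (b :* d)) :* (b :* (d :* f)) :=
      (a :* (d :* f) :+ (c :* f :+ e :* d) :* b) :* ((b :* d) :* f)) ≈-refl

    +-comm-identity : ∀ a b c d → (a * d + c * b) * (d * b) ≈ (c * b + a * d) * (b * d)
    +-comm-identity = solve 4 (λ a b c d →
      (a :* d :+ c :* b) :* (d :* b) := (c :* b :+ a :* d) :* (b :* d)) ≈-refl

    -- o stands for the numerator `[ 0ℚ ]` of `0ᴷ`, which represents the zero polynomial without
    -- being the list `[]`.
    +-identity-identity : ∀ a b {o} → o ≈ 0# → (o * b + a * 1#) * b ≈ a * (1# * b)
    +-identity-identity a b {o} o≈0 = begin
      (o * b + a * 1#) * b    ≈⟨ *-congʳ (+-congʳ (≈-trans (*-congʳ o≈0) (zeroˡ b))) ⟩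
      (0# + a * 1#) * b       ≈⟨ *-congʳ (≈-trans (+-identityˡ _) (*-identityʳ a)) ⟩
      a * b                   ≈⟨ *-congˡ (*-identityˡ b) ⟨
      a * (1# * b)            ∎

    inverse-identity : ∀ a b {o} → o ≈ 0# → (- a * b + a * b) * 1# ≈ o * (b * b)
    inverse-identity a b {o} o≈0 = begin
      (- a * b + a * b) * 1#  ≈⟨ *-identityʳ _ ⟩
      - a * b + a * b         ≈⟨ distribʳ b (- a) a ⟨
      (- a + a) * b           ≈⟨ *-congʳ (-‿inverseˡ a) ⟩
      0# * b                  ≈⟨ zeroˡ b ⟩
      0#                      ≈⟨ zeroˡ (b * b) ⟨
      0# * (b * b)            ≈⟨ *-congʳ o≈0 ⟨
      o * (b * b)             ∎

    neg-cong-identity : ∀ {a b c d} → a * d ≈ c * b → - a * d ≈ - c * b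
    neg-cong-identity {a} {b} {c} {d} p =
      ≈-trans (≈-sym (-‿distribˡ-* a d)) (≈-trans (-‿cong p) (-‿distribˡ-* c b))

    distribˡ-identity : ∀ a b c d e f →
      (a * (c * f + e * d)) * ((b * d) * (b * f)) ≈ ((a * c) * (b * f) + (a * e) * (b * d)) * (b * (d * f))
    distribˡ-identity = solve 6 (λ a b c d e f →
      (a :* (c :* f :+ e :* d)) :* ((b :* d) :* (b :* f)) :=
      ((a :* c) :* (b :* f) :+ (a :* e) :* (b :* d)) :* (b :* (d :* f))) ≈-refl

    *-assoc-identity : ∀ a b c d e f → ((a * c) * e) * (b * (d * f)) ≈ (a * (c * e)) * ((b * d) * f)
    *-assoc-identity = solve 6 (λ a b c d e f →
      ((a :* c) :* e) :* (b :* (d :* f)) := (a :* (c :* e)) :* ((b :* d) :* f)) ≈-refl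

    *-comm-identity : ∀ a b c d → (a * c) * (d * b) ≈ (c * a) * (b * d)
    *-comm-identity = solve 4 (λ a b c d → (a :* c) :* (d :* b) := (c :* a) :* (b :* d)) ≈-refl

    subtract-identity : ∀ a b c d → ((a * d + - (c * b)) * d + c * (b * d)) * b ≈ a * ((b * d) * d)
    subtract-identity a b c d = begin
      ((a * d + - (c * b)) * d + c * (b * d)) * b
        -- The solver knows semiring operations only, so -cb enters as an opaque variable n, and n +
        -- cb = 0 is applied afterwards.
        ≈⟨ solve 5 (λ a b c d n → ((a :* d :+ n) :* d :+ c :* (b :* d)) :* b :=
             a :* ((b :* d) :* d) :+ (n :+ c :* b) :* (d :* b)) ≈-refl a b c d (- (c * b)) ⟩
      a * ((b * d) * d) + (- (c * b) + c * b) * (d * b)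
        ≈⟨ +-congˡ (≈-trans (*-congʳ (-‿inverseˡ (c * b))) (zeroˡ _)) ⟩
      a * ((b * d) * d) + 0#
        ≈⟨ +-identityʳ _ ⟩
      a * ((b * d) * d) ∎

    fraction-+ : ∀ p q → (p + q) * (1# * 1#) ≈ (p * 1# + q * 1#) * 1#
    fraction-+ = solve 2 (λ p q → (p :+ q) :* (con 1 :* con 1) := (p :* con 1 :+ q :* con 1) :* con 1) ≈-refl

  open FractionIdentities ℚ[α]-commutativeRing

  -ᴷ_ : ℚ⟨α⟩ → ℚ⟨α⟩
  -ᴷ frac a b b≢0 = frac (negᵖ a) b b≢0

  ≈ᴷ-trans : ∀ {x y w} → x ≈ᴷ y → y ≈ᴷ w → x ≈ᴷ w
  ≈ᴷ-trans {frac a b _} {frac c d d≢0} {frac e f _} p q = unwrap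
    (cancel-from-0 d (λ r → *ᵖ-cancel-0 d r d≢0) {a *ᵖ f} {e *ᵖ b}
      (trans-identity {a} {b} {c} {d} {e} {f} (wrap p) (wrap q)))

  ℚ⟨α⟩-commutativeRing : CommutativeRing 0ℓ 0ℓ
  ℚ⟨α⟩-commutativeRing = record
    { Carrier = ℚ⟨α⟩ ; _≈_ = _≈ᴷ_ ; _+_ = _+ᴷ_ ; _*_ = _*ᴷ_ ; -_ = -ᴷ_ ; 0# = 0ᴷ ; 1# = 1ᴷ
    ; isCommutativeRing = record
      { isRing = record
        { +-isAbelianGroup = record
          { isGroup = record
            { isMonoid = record
              { isSemigroup = record
                { isMagma = record
                  { isEquivalence = record
                    { refl = λ {x} k → refl
                    ; sym = λ p k → sym (p k)
                    ; trans = λ {x} {y} {w} → ≈ᴷ-trans {x} {y} {w} }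
                  ; ∙-cong = λ { {frac a b _} {frac c d _} {frac a′ b′ _} {frac c′ d′ _} p q →
                      unwrap (+-cong-identity {a} {b} {c} {d} {a′} {b′} {c′} {d′} (wrap p) (wrap q)) } }
                ; assoc = λ { (frac a b _) (frac c d _) (frac e f _) → unwrap (+-assoc-identity a b c d e f) } }
              ; identity = identityˡ , λ x → ≈ᴷ-trans {x +ᴷ 0ᴷ} {0ᴷ +ᴷ x} {x} (comm x 0ᴷ) (identityˡ x) }
            ; inverse = inverseˡ , λ x → ≈ᴷ-trans {x +ᴷ (-ᴷ x)} {(-ᴷ x) +ᴷ x} {0ᴷ} (comm x (-ᴷ x)) (inverseˡ x)
            ; ⁻¹-cong = λ { {frac a b _} {frac c d _} p → unwrap (neg-cong-identity {a} {b} {c} {d} (wrap p)) } }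
          ; comm = comm }
        ; *-cong = λ { {frac a b _} {frac c d _} {frac a′ b′ _} {frac c′ d′ _} p q →
            unwrap (*-cong-identity {a} {b} {c} {d} {a′} {b′} {c′} {d′} (wrap p) (wrap q)) }
        ; *-assoc = λ { (frac a b _) (frac c d _) (frac e f _) → unwrap (*-assoc-identity a b c d e f) }
        ; *-identity = *-identityˡ , λ x → ≈ᴷ-trans {x *ᴷ 1ᴷ} {1ᴷ *ᴷ x} {x} (*-comm x 1ᴷ) (*-identityˡ x)
        ; distrib = distribˡ , λ x y w → ≈ᴷ-trans {(y +ᴷ w) *ᴷ x} {x *ᴷ (y +ᴷ w)} {y *ᴷ x +ᴷ w *ᴷ x}
            (*-comm (y +ᴷ w) x) (≈ᴷ-trans {x *ᴷ (y +ᴷ w)} {x *ᴷ y +ᴷ x *ᴷ w} {y *ᴷ x +ᴷ w *ᴷ x} (distribˡ x y w)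
              (unwrap (+-cong-identity {num x *ᵖ num y} {den x *ᵖ den y} {num y *ᵖ num x} {den y *ᵖ den x}
                                       {num x *ᵖ num w} {den x *ᵖ den w} {num w *ᵖ num x} {den w *ᵖ den x}
                (wrap (*-comm x y)) (wrap (*-comm x w))))) }
      ; *-comm = *-comm } }
    where
    comm : ∀ x y → x +ᴷ y ≈ᴷ y +ᴷ x
    comm (frac a b _) (frac c d _) = unwrap (+-comm-identity a b c d)
    *-comm : ∀ x y → x *ᴷ y ≈ᴷ y *ᴷ x
    *-comm (frac a b _) (frac c d _) = unwrap (*-comm-identity a b c d)
    identityˡ : ∀ x → 0ᴷ +ᴷ x ≈ᴷ x
    identityˡ (frac a b _) = unwrap (+-identity-identity a b 0∷[])
    inverseˡ : ∀ x → (-ᴷ x) +ᴷ x ≈ᴷ 0ᴷ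
    inverseˡ (frac a b _) = unwrap (inverse-identity a b 0∷[])
    *-identityˡ : ∀ x → 1ᴷ *ᴷ x ≈ᴷ x
    *-identityˡ (frac a b _) = unwrap (*ᵖ-cong (*ᵖ-identityˡ a) (≋-sym (*ᵖ-identityˡ b)))
    distribˡ : ∀ x y w → x *ᴷ (y +ᴷ w) ≈ᴷ x *ᴷ y +ᴷ x *ᴷ w
    distribˡ (frac a b _) (frac c d _) (frac e f _) = unwrap (distribˡ-identity a b c d e f)

  -ᴷ-+ᴷ : ∀ x y → (x -ᴷ y) +ᴷ y ≈ᴷ x
  -ᴷ-+ᴷ (frac a b _) (frac c d _) = unwrap (subtract-identity a b c d)

  *ᴷ-cancel-0 : ∀ x y → NonZeroᵖ (num x) → x *ᴷ y ≈ᴷ 0ᴷ → y ≈ᴷ 0ᴷ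
  *ᴷ-cancel-0 (frac a b _) (frac c d _) a≢0 p = unwrap
    (≋-trans (≋-trans (*ᵖ-comm c [ 1ℚ ]) (*ᵖ-identityˡ c)) (≋-trans (*ᵖ-cancel-0 a c a≢0 ac≈0) (≋-sym (0*ᵖ d))))
    where
    0*ᵖ : ∀ q → [ 0ℚ ] *ᵖ q ≋ []
    0*ᵖ q = *ᵖ-cong {q = q} 0∷[] ≋-refl
    ac≈0 : a *ᵖ c ≋ []
    ac≈0 = ≋-trans (≋-sym (≋-trans (*ᵖ-comm (a *ᵖ c) [ 1ℚ ]) (*ᵖ-identityˡ (a *ᵖ c))))
      (≋-trans (wrap p) (0*ᵖ (b *ᵖ d)))

  -- Integers and their reciprocals as constants

  /1-homo-+ : ∀ i j → (i ℤ.+ j) ℚ./ 1 ≡ i ℚ./ 1 ℚ.+ j ℚ./ 1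
  /1-homo-+ i j = ℚ.toℚᵘ-injective (begin
    ℚ.toℚᵘ ((i ℤ.+ j) ℚ./ 1)                     ≈⟨ ℚ.toℚᵘ-fromℚᵘ (ℚᵘ.mkℚᵘ (i ℤ.+ j) 0) ⟩
    ℚᵘ.mkℚᵘ (i ℤ.+ j) 0                          ≈⟨ ℚᵘ.*≡* (cong (ℤ._* ℤ.+ 1) (sym (cong₂ ℤ._+_ (ℤ.*-identityʳ i) (ℤ.*-identityʳ j)))) ⟩
    ℚᵘ.mkℚᵘ i 0 ℚᵘ.+ ℚᵘ.mkℚᵘ j 0                 ≈⟨ ℚᵘ.+-cong (ℚ.toℚᵘ-fromℚᵘ (ℚᵘ.mkℚᵘ i 0)) (ℚ.toℚᵘ-fromℚᵘ (ℚᵘ.mkℚᵘ j 0)) ⟨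
    ℚ.toℚᵘ (i ℚ./ 1) ℚᵘ.+ ℚ.toℚᵘ (j ℚ./ 1)       ≈⟨ ℚ.toℚᵘ-homo-+ (i ℚ./ 1) (j ℚ./ 1) ⟨
    ℚ.toℚᵘ (i ℚ./ 1 ℚ.+ j ℚ./ 1)                 ∎)
    where open ℚᵘ.≃-Reasoning

  1/*/1 : ∀ d .{{_ : NonZero d}} → (ℤ.+ 1) ℚ./ d ℚ.* ((ℤ.+ d) ℚ./ 1) ≡ 1ℚ
  1/*/1 (suc d) = ℚ.toℚᵘ-injective (begin
    ℚ.toℚᵘ ((ℤ.+ 1) ℚ./ suc d ℚ.* ((ℤ.+ suc d) ℚ./ 1))
      ≈⟨ ℚ.toℚᵘ-homo-* ((ℤ.+ 1) ℚ./ suc d) ((ℤ.+ suc d) ℚ./ 1) ⟩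
    ℚ.toℚᵘ ((ℤ.+ 1) ℚ./ suc d) ℚᵘ.* ℚ.toℚᵘ ((ℤ.+ suc d) ℚ./ 1)
      ≈⟨ ℚᵘ.*-cong (ℚ.toℚᵘ-fromℚᵘ (ℚᵘ.mkℚᵘ (ℤ.+ 1) d)) (ℚ.toℚᵘ-fromℚᵘ (ℚᵘ.mkℚᵘ (ℤ.+ suc d) 0)) ⟩
    ℚᵘ.mkℚᵘ (ℤ.+ 1) d ℚᵘ.* ℚᵘ.mkℚᵘ (ℤ.+ suc d) 0
      ≈⟨ ℚᵘ.*≡* (cong ℤ.+_ (trans (ℕ.*-identityʳ _) (trans (ℕ.+-identityʳ (suc d)) (sym (trans (ℕ.+-identityʳ _) (ℕ.*-identityʳ (suc d))))))) ⟩
    ℚ.toℚᵘ 1ℚ ∎)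
    where open ℚᵘ.≃-Reasoning

  /1-nonZero : ∀ n → (ℤ.+ suc n) ℚ./ 1 ≢ 0ℚ
  /1-nonZero n eq = 1ℚ≢0ℚ (trans (sym (1/*/1 (suc n)))
    (trans (cong ((ℤ.+ 1) ℚ./ suc n ℚ.*_) eq) (ℚ.*-zeroʳ ((ℤ.+ 1) ℚ./ suc n))))
    where
    1ℚ≢0ℚ : 1ℚ ≢ 0ℚ
    1ℚ≢0ℚ ()

  fromℚ-+ : ∀ a b → fromℚ (a ℚ.+ b) ≈ᴷ fromℚ a +ᴷ fromℚ b
  fromℚ-+ a b = unwrap (fraction-+ [ a ] [ b ])

  fromℚ-* : ∀ a b → fromℚ (a ℚ.* b) ≈ᴷ fromℚ a *ᴷ fromℚ b
  fromℚ-* a b = unwrap (*ᵖ-cong {[ a ℚ.* b ]} {[ a ] *ᵖ [ b ]} (wrap λ { zero → sym (ℚ.+-identityʳ _) ; (suc k) → refl })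
    (*ᵖ-identityˡ [ 1ℚ ]))

  fromℕ-suc : ∀ n → fromℕ (suc n) ≈ᴷ 1ᴷ +ᴷ fromℕ n
  fromℕ-suc n k = trans (cong (λ a → coefᵖ ([ a ] *ᵖ ([ 1ℚ ] *ᵖ [ 1ℚ ])) k) (/1-homo-+ (ℤ.+ 1) (ℤ.+ n)))
    (fromℚ-+ 1ℚ ((ℤ.+ n) ℚ./ 1) k)

  fromℚ-recip : ∀ d .{{_ : NonZero d}} → fromℚ ((ℤ.+ 1) ℚ./ d) *ᴷ fromℕ d ≈ᴷ 1ᴷ
  fromℚ-recip d = ≈ᴷ-trans {fromℚ ((ℤ.+ 1) ℚ./ d) *ᴷ fromℕ d} {fromℚ ((ℤ.+ 1) ℚ./ d ℚ.* ((ℤ.+ d) ℚ./ 1))} {1ᴷ}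
    (λ k → sym (fromℚ-* ((ℤ.+ 1) ℚ./ d) ((ℤ.+ d) ℚ./ 1) k))
    (λ k → cong (λ a → coefᵖ ([ a ] *ᵖ [ 1ℚ ]) k) (1/*/1 d))

open Combinatorics

-- The properties of ℚ(α) on which the rest relies. `ι`, `_⊖_`, `α^` and `recip` are fields with
-- characteristic equations rather than terms built from the ring operations, so that the
-- specialisation gives back the definitions of the statement by computation. `ι-cancel` and
-- `α-cancel` take the place of division by z_ν and by powers of α.
record Scalars : Set₁ where
  infixl 6 _⊖_
  field
    commutativeRing : CommutativeRing 0ℓ 0ℓ
  open CommutativeRing commutativeRing public hiding (zero)
  field
    ι        : ℕ → Carrier
    ι-zero   : ι 0 ≈ 0#
    ι-suc    : ∀ n → ι (suc n) ≈ 1# + ι n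
    ι-cancel : ∀ n {x} → ι (suc n) * x ≈ 0# → x ≈ 0#
    _⊖_      : Carrier → Carrier → Carrier
    ⊖-+      : ∀ x y → (x ⊖ y) + y ≈ x
    α        : Carrier
    α-cancel : ∀ {x} → α * x ≈ 0# → x ≈ 0#
    α^       : ℕ → Carrier
    α^-zero  : α^ 0 ≈ 1#
    α^-suc   : ∀ n → α^ (suc n) ≈ α * α^ n
    recip    : (d : ℕ) .{{_ : NonZero d}} → Carrier
    recip-*  : ∀ d .{{_ : NonZero d}} → recip d * ι d ≈ 1#

-- Linear algebra over the scalars

module Linear (S : Scalars) where
  open Scalars S public
  open import Relation.Binary.Reasoning.Setoid setoid
  open import Algebra.Solver.Ring.NaturalCoefficients.Default commutativeSemiring using (solve; _:=_; _:+_; _:*_; con)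

  private variable
    A B : Set

  interchange : ∀ a b c d → (a + b) + (c + d) ≈ (a + c) + (b + d)
  interchange = solve 4 (λ a b c d → (a :+ b) :+ (c :+ d) := (a :+ c) :+ (b :+ d)) refl

  *-swapˡ : ∀ a b c → a * (b * c) ≈ b * (a * c)
  *-swapˡ = solve 3 (λ a b c → a :* (b :* c) := b :* (a :* c)) refl

  ι-+ : ∀ m n → ι (m ℕ.+ n) ≈ ι m + ι n
  ι-+ zero    n = sym (trans (+-congʳ ι-zero) (+-identityˡ (ι n)))
  ι-+ (suc m) n = begin
    ι (suc (m ℕ.+ n))     ≈⟨ ι-suc (m ℕ.+ n) ⟩
    1# + ι (m ℕ.+ n)      ≈⟨ +-congˡ (ι-+ m n) ⟩
    1# + (ι m + ι n)      ≈⟨ +-assoc 1# (ι m) (ι n) ⟨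
    1# + ι m + ι n        ≈⟨ +-congʳ (ι-suc m) ⟨
    ι (suc m) + ι n       ∎

  ι-1 : ι 1 ≈ 1#
  ι-1 = trans (ι-suc 0) (trans (+-congˡ ι-zero) (+-identityʳ 1#))

  ι-* : ∀ m n → ι (m ℕ.* n) ≈ ι m * ι n
  ι-* zero    n = trans ι-zero (sym (trans (*-congʳ ι-zero) (zeroˡ (ι n))))
  ι-* (suc m) n = begin
    ι (n ℕ.+ m ℕ.* n)     ≈⟨ ι-+ n (m ℕ.* n) ⟩
    ι n + ι (m ℕ.* n)     ≈⟨ +-cong (sym (*-identityˡ (ι n))) (ι-* m n) ⟩
    1# * ι n + ι m * ι n  ≈⟨ distribʳ (ι n) 1# (ι m) ⟨
    (1# + ι m) * ι n      ≈⟨ *-congʳ (ι-suc m) ⟨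
    ι (suc m) * ι n       ∎

  ι-≢0-cancel : ∀ {n x} → n ≢ 0 → ι n * x ≈ 0# → x ≈ 0#
  ι-≢0-cancel {zero}  n≢0 = contradiction ≡.refl n≢0
  ι-≢0-cancel {suc n} n≢0 = ι-cancel n

  ι-cong : ∀ {m n} → m ≡ n → ι m ≈ ι n
  ι-cong eq = reflexive (≡.cong ι eq)

  -- Finite sums

  ∑ : List A → (A → Carrier) → Carrier
  ∑ xs g = foldr (λ x s → g x + s) 0# xs

  ∑-cong-All : ∀ {xs : List A} {g h} → All (λ x → g x ≈ h x) xs → ∑ xs g ≈ ∑ xs h
  ∑-cong-All []       = refl
  ∑-cong-All (e ∷ es) = +-cong e (∑-cong-All es)

  ∑-cong : ∀ (xs : List A) {g h} → (∀ x → g x ≈ h x) → ∑ xs g ≈ ∑ xs h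
  ∑-cong xs e = ∑-cong-All (All.universal e xs)

  ∑-0 : ∀ (xs : List A) {g} → (∀ x → g x ≈ 0#) → ∑ xs g ≈ 0#
  ∑-0 []       e = refl
  ∑-0 (x ∷ xs) e = trans (+-cong (e x) (∑-0 xs e)) (+-identityˡ 0#)

  ∑-+ : ∀ (xs : List A) g h → ∑ xs (λ x → g x + h x) ≈ ∑ xs g + ∑ xs h
  ∑-+ []       g h = sym (+-identityˡ 0#)
  ∑-+ (x ∷ xs) g h = trans (+-congˡ (∑-+ xs g h)) (interchange (g x) (h x) (∑ xs g) (∑ xs h))

  ∑-*ˡ : ∀ (xs : List A) c g → ∑ xs (λ x → c * g x) ≈ c * ∑ xs g
  ∑-*ˡ []       c g = sym (zeroʳ c)
  ∑-*ˡ (x ∷ xs) c g = trans (+-congˡ (∑-*ˡ xs c g)) (sym (distribˡ c (g x) (∑ xs g)))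

  ∑-*ʳ : ∀ (xs : List A) g c → ∑ xs (λ x → g x * c) ≈ ∑ xs g * c
  ∑-*ʳ xs g c = trans (∑-cong xs λ x → *-comm (g x) c) (trans (∑-*ˡ xs c g) (*-comm c (∑ xs g)))

  ∑-++ : ∀ (xs ys : List A) g → ∑ (xs ++ ys) g ≈ ∑ xs g + ∑ ys g
  ∑-++ []       ys g = sym (+-identityˡ _)
  ∑-++ (x ∷ xs) ys g = trans (+-congˡ (∑-++ xs ys g)) (sym (+-assoc (g x) (∑ xs g) (∑ ys g)))

  ∑-map : ∀ (f : A → B) xs (g : B → Carrier) → ∑ (map f xs) g ≡ ∑ xs (g ∘ f)
  ∑-map f []       g = ≡.refl
  ∑-map f (x ∷ xs) g = ≡.cong (g (f x) +_) (∑-map f xs g)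

  ∑-concatMap : ∀ (f : A → List B) xs g → ∑ (concatMap f xs) g ≈ ∑ xs (λ x → ∑ (f x) g)
  ∑-concatMap f []       g = refl
  ∑-concatMap f (x ∷ xs) g = trans (∑-++ (f x) (concatMap f xs) g) (+-congˡ (∑-concatMap f xs g))

  ∑-swap : ∀ (xs : List A) (ys : List B) (g : A → B → Carrier) →
           ∑ xs (λ x → ∑ ys (λ y → g x y)) ≈ ∑ ys (λ y → ∑ xs (λ x → g x y))
  ∑-swap []       ys g = sym (∑-0 ys λ _ → refl)
  ∑-swap (x ∷ xs) ys g = trans (+-congˡ (∑-swap xs ys g)) (sym (∑-+ ys (g x) λ y → ∑ xs λ x → g x y))

  ∑-upTo-suc : ∀ n g → ∑ (upTo (suc n)) g ≈ g 0 + ∑ (upTo n) (g ∘ suc)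
  ∑-upTo-suc n g = +-congˡ (reflexive (≡.trans
    (≡.cong (λ t → ∑ t g) (≡.sym (List.map-upTo suc n))) (∑-map suc (upTo n) g)))

  ∑-upTo-last : ∀ n g → ∑ (upTo (suc n)) g ≈ ∑ (upTo n) g + g n
  ∑-upTo-last n g = begin
    ∑ (upTo (suc n)) g           ≈⟨ reflexive (≡.cong (λ t → ∑ t g) (≡.sym (List.upTo-∷ʳ n))) ⟩
    ∑ (upTo n ++ [ n ]) g        ≈⟨ ∑-++ (upTo n) [ n ] g ⟩
    ∑ (upTo n) g + (g n + 0#)    ≈⟨ +-congˡ (+-identityʳ (g n)) ⟩
    ∑ (upTo n) g + g n           ∎

  ∑-allFin-suc : ∀ n (g : Fin (suc n) → Carrier) → ∑ (allFin (suc n)) g ≈ g zero + ∑ (allFin n) (g ∘ suc)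
  ∑-allFin-suc n g = +-congˡ (reflexive (≡.trans
    (≡.cong (λ t → ∑ t g) (≡.sym (List.map-tabulate id suc))) (∑-map suc (allFin n) g)))

  indicator : Bool → Carrier → Carrier
  indicator b x = if b then x else 0#

  indicator-yes : {P : Set} (P? : Dec P) {x : Carrier} → P → indicator (does P?) x ≡ x
  indicator-yes P? p = ≡.cong (λ b → indicator b _) (Dec.dec-true P? p)

  indicator-no : {P : Set} (P? : Dec P) {x : Carrier} → ¬ P → indicator (does P?) x ≡ 0#
  indicator-no P? ¬p = ≡.cong (λ b → indicator b _) (Dec.dec-false P? ¬p)

  ∑-select : ∀ {us : List A} (_≟′_ : ∀ (x y : A) → Dec (x ≡ y)) {b} (h : A → Carrier) → Unique us → b ∈ us →
             ∑ us (λ u → indicator (does (u ≟′ b)) (h u)) ≈ h b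
  ∑-select {us = b ∷ us} _≟′_ {b} h (b∉us ∷ _) (here ≡.refl) = trans
    (+-cong (reflexive (indicator-yes (b ≟′ b) ≡.refl))
            (trans (∑-cong-All (All.map (λ b≢u → reflexive (indicator-no (_ ≟′ b) (b≢u ∘ ≡.sym))) b∉us))
                   (∑-0 us λ _ → refl)))
    (+-identityʳ (h b))
  ∑-select {us = u ∷ us} _≟′_ {b} h (u∉us ∷ us!) (there b∈us) = trans
    (+-cong (reflexive (indicator-no (u ≟′ b) λ { ≡.refl → All.lookup u∉us b∈us ≡.refl }))
            (∑-select _≟′_ h us! b∈us))
    (+-identityˡ (h b))

  -- Formal linear combinations

  infixr 7 _·_

  Lin : Set → Set
  Lin B = List (Carrier × B)

  extend : (B → Carrier) → Lin B → Carrier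
  extend φ = foldr (λ (c , b) s → c * φ b + s) 0#

  _·_ : Carrier → Lin B → Lin B
  c · f = map (λ (d , b) → c * d , b) f

  linear : (A → Lin B) → Lin A → Lin B
  linear T = concatMap (λ (c , a) → c · T a)

  extend-cong-All : ∀ {φ ψ : B → Carrier} {f : Lin B} → All (λ (_ , b) → φ b ≈ ψ b) f → extend φ f ≈ extend ψ f
  extend-cong-All = ∑-cong-All ∘ All.map *-congˡ

  extend-cong : ∀ {φ ψ : B → Carrier} f → (∀ b → φ b ≈ ψ b) → extend φ f ≈ extend ψ f
  extend-cong f e = extend-cong-All (All.universal (λ (_ , b) → e b) f)

  extend-++ : ∀ (φ : B → Carrier) f g → extend φ (f ++ g) ≈ extend φ f + extend φ g
  extend-++ φ f g = ∑-++ f g λ (c , b) → c * φ b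

  extend-· : ∀ (φ : B → Carrier) c f → extend φ (c · f) ≈ c * extend φ f
  extend-· φ c []            = sym (zeroʳ c)
  extend-· φ c ((d , b) ∷ f) = trans (+-cong (*-assoc c d (φ b)) (extend-· φ c f)) (sym (distribˡ c _ _))

  extend-linear : ∀ (φ : B → Carrier) (T : A → Lin B) f →
                  extend φ (linear T f) ≈ extend (λ a → extend φ (T a)) f
  extend-linear φ T f = trans (∑-concatMap (λ (c , a) → c · T a) f _)
    (∑-cong f λ (c , a) → extend-· φ c (T a))

  extend-concatMap : ∀ (φ : B → Carrier) (T : A → Lin B) xs →
                     extend φ (concatMap T xs) ≈ ∑ xs λ x → extend φ (T x)
  extend-concatMap φ T xs = ∑-concatMap T xs _

  extend-0 : ∀ {φ : B → Carrier} f → (∀ b → φ b ≈ 0#) → extend φ f ≈ 0#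
  extend-0 f e = ∑-0 f λ (c , b) → trans (*-congˡ (e b)) (zeroʳ c)

  extend-+ : ∀ (φ ψ : B → Carrier) f → extend (λ b → φ b + ψ b) f ≈ extend φ f + extend ψ f
  extend-+ φ ψ f = trans (∑-cong f λ (c , b) → distribˡ c (φ b) (ψ b)) (∑-+ f _ _)

  extend-*ˡ : ∀ (φ : B → Carrier) k f → extend (λ b → k * φ b) f ≈ k * extend φ f
  extend-*ˡ φ k f = trans (∑-cong f λ (c , b) → *-swapˡ c k (φ b)) (∑-*ˡ f k _)

  extend-*ʳ : ∀ (φ : B → Carrier) k f → extend (λ b → φ b * k) f ≈ extend φ f * k
  extend-*ʳ φ k f = trans (extend-cong f λ b → *-comm (φ b) k) (trans (extend-*ˡ φ k f) (*-comm k _))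

  extend-∑ : ∀ (xs : List A) (φ : A → B → Carrier) f →
             extend (λ b → ∑ xs (λ x → φ x b)) f ≈ ∑ xs (λ x → extend (φ x) f)
  extend-∑ xs φ f = trans (∑-cong f λ (c , b) → sym (∑-*ˡ xs c λ x → φ x b)) (∑-swap f xs _)

  extend-swap : ∀ (φ : A → B → Carrier) f g →
                extend (λ a → extend (φ a) g) f ≈ extend (λ b → extend (λ a → φ a b) f) g
  extend-swap φ f g = begin
    extend (λ a → extend (φ a) g) f                        ≈⟨ ∑-cong f (λ (c , a) → sym (∑-*ˡ g c _)) ⟩
    ∑ f (λ (c , a) → ∑ g (λ (d , b) → c * (d * φ a b)))    ≈⟨ ∑-swap f g _ ⟩
    ∑ g (λ (d , b) → ∑ f (λ (c , a) → c * (d * φ a b)))    ≈⟨ ∑-cong g (λ (d , b) → ∑-cong f λ (c , a) → *-swapˡ c d (φ a b)) ⟩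
    ∑ g (λ (d , b) → ∑ f (λ (c , a) → d * (c * φ a b)))    ≈⟨ ∑-cong g (λ (d , b) → ∑-*ˡ f d _) ⟩
    extend (λ b → extend (λ a → φ a b) f) g                ∎

  extend-single : ∀ (φ : B → Carrier) c b → extend φ [ (c , b) ] ≈ c * φ b
  extend-single φ c b = +-identityʳ _

  module _ {B : Set} {{_ : IsDecEquivalence {A = B} _≡_}} where

    infix 4 _≐_

    δ : B → B → Carrier
    δ a b = if does (a ≟ b) then 1# else 0#

    coeff : Lin B → B → Carrier
    coeff f b = extend (δ b) f

    _≐_ : Lin B → Lin B → Set
    f ≐ g = ∀ b → coeff f b ≈ coeff g b

    ≐-reflexive : ∀ {f g} → f ≡ g → f ≐ g
    ≐-reflexive eq b = reflexive (≡.cong (λ f → coeff f b) eq)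

    ≐-trans : ∀ {f g h} → f ≐ g → g ≐ h → f ≐ h
    ≐-trans f≐g g≐h b = trans (f≐g b) (g≐h b)

    δ-refl : ∀ b → δ b b ≈ 1#
    δ-refl b = reflexive (indicator-yes (b ≟ b) ≡.refl)

    δ-≢ : ∀ {a b} → a ≢ b → δ a b ≈ 0#
    δ-≢ {a} {b} a≢b = reflexive (indicator-no (a ≟ b) a≢b)

    δ-sym : ∀ a b → δ a b ≈ δ b a
    δ-sym a b with a ≟ b
    ... | yes ≡.refl = sym (δ-refl a)
    ... | no a≢b     = sym (δ-≢ (a≢b ∘ ≡.sym))

    δ-* : ∀ (φ : B → Carrier) a b → δ a b * φ b ≈ δ a b * φ a
    δ-* φ a b with a ≟ b
    ... | yes ≡.refl = refl
    ... | no _       = trans (zeroˡ (φ b)) (sym (zeroˡ (φ a)))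

    private
      expand : ∀ {us : List B} (φ : B → Carrier) f → Unique us → All (λ (_ , b) → b ∈ us) f →
               extend φ f ≈ ∑ us (λ u → coeff f u * φ u)
      expand {us} φ []            us! []          = sym (∑-0 us λ u → zeroˡ (φ u))
      expand {us} φ ((c , b) ∷ f) us! (b∈us ∷ f⊆us) = begin
        c * φ b + extend φ f
          ≈⟨ +-cong (*-congˡ (sym (∑-select _≟_ φ us! b∈us))) (expand φ f us! f⊆us) ⟩
        c * ∑ us (λ u → indicator (does (u ≟ b)) (φ u)) + ∑ us (λ u → coeff f u * φ u)
          ≈⟨ +-congʳ (∑-*ˡ us c _) ⟨
        ∑ us (λ u → c * indicator (does (u ≟ b)) (φ u)) + ∑ us (λ u → coeff f u * φ u)
          ≈⟨ ∑-+ us _ _ ⟨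
        ∑ us (λ u → c * indicator (does (u ≟ b)) (φ u) + coeff f u * φ u)
          ≈⟨ ∑-cong us (λ u → trans (+-congʳ (trans (*-congˡ (split u)) (sym (*-assoc c _ _)))) (sym (distribʳ (φ u) _ _))) ⟩
        ∑ us (λ u → (c * δ u b + coeff f u) * φ u) ∎
        where
        split : ∀ u → indicator (does (u ≟ b)) (φ u) ≈ δ u b * φ u
        split u with does (u ≟ b)
        ... | true  = sym (*-identityˡ (φ u))
        ... | false = sym (zeroˡ (φ u))

    -- A functional sees only the coefficients: `expand` collects like terms over a duplicate-free
    -- list of the monomials of f and g. The two functionals may differ wherever the coefficients
    -- vanish.
    extend-by-coeff : ∀ {φ ψ : B → Carrier} f g → (∀ u → coeff f u * φ u ≈ coeff g u * ψ u) →
                      extend φ f ≈ extend ψ g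
    extend-by-coeff {φ} {ψ} f g e = begin
      extend φ f                        ≈⟨ expand φ f us! (All.tabulate λ {x} x∈f → mem (∈-++⁺ˡ (∈-map⁺ proj₂ x∈f))) ⟩
      ∑ us (λ u → coeff f u * φ u)      ≈⟨ ∑-cong us e ⟩
      ∑ us (λ u → coeff g u * ψ u)      ≈⟨ expand ψ g us! (All.tabulate λ {x} x∈g → mem (∈-++⁺ʳ (map proj₂ f) (∈-map⁺ proj₂ x∈g))) ⟨
      extend ψ g                        ∎
      where
      keys us : List B
      keys = map proj₂ f ++ map proj₂ g
      us   = deduplicate _≟_ keys
      us! : Unique us
      us! = deduplicate-! _≟_ keys
      mem : ∀ {b} → b ∈ keys → b ∈ us
      mem = ∈-deduplicate⁺ _≟_

    extend-≐ : ∀ (φ : B → Carrier) {f g} → f ≐ g → extend φ f ≈ extend φ g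
    extend-≐ φ {f} {g} f≐g = extend-by-coeff f g λ u → *-congʳ (f≐g u)

    coeff-All : ∀ {P : B → Set} {f : Lin B} {b} → All (λ (_ , u) → P u) f → ¬ P b → coeff f b ≈ 0#
    coeff-All {f = f} Pf ¬Pb = trans
      (extend-cong-All (All.map (λ {x} Pu → δ-≢ λ { ≡.refl → ¬Pb Pu }) Pf)) (extend-0 f λ _ → refl)

-- The sum of squares under a change of exponents

toList-[]≔ : ∀ {N} (β : Vec ℕ N) i b → sumSq (toList (β [ i ]≔ b)) ℕ.+ lookup β i ℕ.* lookup β i ≡ sumSq (toList β) ℕ.+ b ℕ.* b
toList-[]≔ (a ∷ β) zero    b = ring (b ℕ.* b) (sumSq (toList β)) (a ℕ.* a)
  where
  ring : ∀ b s a → b ℕ.+ s ℕ.+ a ≡ a ℕ.+ s ℕ.+ b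
  ring = solve-∀
toList-[]≔ (a ∷ β) (suc i) b = ≡.trans (ℕ.+-assoc (a ℕ.* a) _ _)
  (≡.trans (≡.cong (a ℕ.* a ℕ.+_) (toList-[]≔ β i b)) (≡.sym (ℕ.+-assoc (a ℕ.* a) _ _)))

-- With b = `lookup β m`, moving one unit from the entry a + 1 to the entry b adds exactly 2 (b -
-- a), and b > a.
sumSq-spread : ∀ {N} (β : Vec ℕ N) {l m a} → l ≢ m → lookup β l ≡ suc a → suc a ≤ lookup β m →
               sumSq (toList β) < sumSq (toList (β [ l ]≔ a [ m ]≔ suc (lookup β m)))
sumSq-spread β {l} {m} {a} l≢m βl a<b = ℕ.+-cancelʳ-< (b ℕ.* b ℕ.+ suc a ℕ.* suc a) _ _ (begin-strict
  S ℕ.+ (b ℕ.* b ℕ.+ suc a ℕ.* suc a)                        <⟨ ℕ.+-monoʳ-< S gain ⟩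
  S ℕ.+ (a ℕ.* a ℕ.+ suc b ℕ.* suc b)                        ≡⟨ ℕ.+-assoc S _ _ ⟨
  S ℕ.+ a ℕ.* a ℕ.+ suc b ℕ.* suc b                          ≡⟨ ≡.cong (ℕ._+ suc b ℕ.* suc b) (≡.trans (≡.sym (toList-[]≔ β l a)) (≡.cong (λ c → S′ ℕ.+ c ℕ.* c) βl)) ⟩
  S′ ℕ.+ suc a ℕ.* suc a ℕ.+ suc b ℕ.* suc b                 ≡⟨ swapʳ S′ (suc a ℕ.* suc a) (suc b ℕ.* suc b) ⟩
  S′ ℕ.+ suc b ℕ.* suc b ℕ.+ suc a ℕ.* suc a                 ≡⟨ ≡.cong (ℕ._+ suc a ℕ.* suc a) (≡.trans (≡.sym (toList-[]≔ (β [ l ]≔ a) m (suc b)))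
                                                                   (≡.cong (λ c → S″ ℕ.+ c ℕ.* c) (Vec.lookup∘update′ (l≢m ∘ ≡.sym) β a))) ⟩
  S″ ℕ.+ b ℕ.* b ℕ.+ suc a ℕ.* suc a                         ≡⟨ ℕ.+-assoc S″ _ _ ⟩
  S″ ℕ.+ (b ℕ.* b ℕ.+ suc a ℕ.* suc a)                       ∎)
  where
  open ℕ.≤-Reasoning
  b = lookup β m
  S = sumSq (toList β)
  S′ = sumSq (toList (β [ l ]≔ a))
  S″ = sumSq (toList (β [ l ]≔ a [ m ]≔ suc b))
  swapʳ : ∀ x y z → x ℕ.+ y ℕ.+ z ≡ x ℕ.+ z ℕ.+ y
  swapʳ = solve-∀
  gain : b ℕ.* b ℕ.+ suc a ℕ.* suc a < a ℕ.* a ℕ.+ suc b ℕ.* suc b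
  gain = ≡.subst (λ b → b ℕ.* b ℕ.+ suc a ℕ.* suc a < a ℕ.* a ℕ.+ suc b ℕ.* suc b) (ℕ.m+[n∸m]≡n a<b)
    (ℕ.<-≤-trans (ℕ.m<m+n _ (s≤s z≤n)) (ℕ.≤-reflexive (ring a (b ∸ suc a))))
    where
    ring : ∀ a d → (suc a ℕ.+ d) ℕ.* (suc a ℕ.+ d) ℕ.+ suc a ℕ.* suc a ℕ.+ suc (suc (d ℕ.+ d)) ≡
                   a ℕ.* a ℕ.+ suc (suc a ℕ.+ d) ℕ.* suc (suc a ℕ.+ d)
    ring = solve-∀

-- Power sums and D_k acting on coefficients of monomials

module Monomials (S : Scalars) where
  open Linear S public
  open import Relation.Binary.Reasoning.Setoid setoid

  -- Multiplication by a variable moves the coefficient at exponent b to b + 1 and leaves nothing at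
  -- exponent zero.
  below : ℕ → (ℕ → Carrier) → Carrier
  below zero    h = 0#
  below (suc b) h = h b

  below-cong : ∀ n {h k} → (∀ b → h b ≈ k b) → below n h ≈ below n k
  below-cong zero    e = refl
  below-cong (suc b) e = e b

  below^ : ℕ → ℕ → (ℕ → Carrier) → Carrier
  below^ zero    n h = h n
  below^ (suc r) n h = below n λ b → below^ r b h

  below^-≤ : ∀ r n h → below^ r n h ≡ indicator (does (r ℕ.≤? n)) (h (n ∸ r))
  below^-≤ zero          n       h = ≡.refl
  below^-≤ (suc r)       zero    h = ≡.refl
  below^-≤ (suc zero)    (suc n) h = ≡.refl
  below^-≤ (suc (suc r)) (suc n) h = below^-≤ (suc r) n h

  module _ {N : ℕ} where

    private
      Exps = Vec ℕ N
      Fun = Exps → Carrier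

    -- The power series Σ u(β) x^β is represented by u; x i is multiplication by the variable xᵢ
    -- and θ i the operator xᵢ ∂/∂xᵢ.
    x : Fin N → Fun → Fun
    x i u β = below (lookup β i) λ b → u (β [ i ]≔ b)

    x^ : Fin N → ℕ → Fun → Fun
    x^ i zero    u = u
    x^ i (suc r) u = x i (x^ i r u)

    θ : Fin N → Fun → Fun
    θ i u β = ι (lookup β i) * u β

    x-cong : ∀ i {u v} → (∀ β → u β ≈ v β) → ∀ β → x i u β ≈ x i v β
    x-cong i e β = below-cong (lookup β i) λ b → e (β [ i ]≔ b)

    x-0 : ∀ i {u} → (∀ β → u β ≈ 0#) → ∀ β → x i u β ≈ 0#
    x-0 i e β with lookup β i
    ... | zero  = refl
    ... | suc b = e (β [ i ]≔ b)

    x-+ : ∀ i u v β → x i (λ γ → u γ + v γ) β ≈ x i u β + x i v β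
    x-+ i u v β with lookup β i
    ... | zero  = sym (+-identityˡ 0#)
    ... | suc b = refl

    x-*ˡ : ∀ i c u β → x i (λ γ → c * u γ) β ≈ c * x i u β
    x-*ˡ i c u β with lookup β i
    ... | zero  = sym (zeroʳ c)
    ... | suc b = refl

    x-∑ : {A : Set} → ∀ i (ts : List A) (u : A → Fun) β → x i (λ γ → ∑ ts (λ t → u t γ)) β ≈ ∑ ts (λ t → x i (u t) β)
    x-∑ i ts u β with lookup β i
    ... | zero  = sym (∑-0 ts λ _ → refl)
    ... | suc b = refl

    x-at : ∀ i u β {b} → lookup β i ≡ suc b → x i u β ≡ u (β [ i ]≔ b)
    x-at i u β eq = ≡.cong (λ n → below n λ b → u (β [ i ]≔ b)) eq

    x-at-0 : ∀ i u β → lookup β i ≡ 0 → x i u β ≡ 0#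
    x-at-0 i u β eq = ≡.cong (λ n → below n λ b → u (β [ i ]≔ b)) eq

    x-comm : ∀ i j u β → x i (x j u) β ≈ x j (x i u) β
    x-comm i j u β with i Fin.≟ j
    ... | yes ≡.refl = refl
    ... | no i≢j = begin
      below (lookup β i) (λ a → below (lookup (β [ i ]≔ a) j) λ b → u (β [ i ]≔ a [ j ]≔ b))
        ≈⟨ below-cong (lookup β i) (λ a → reflexive (≡.cong (λ n → below n λ b → u (β [ i ]≔ a [ j ]≔ b)) (Vec.lookup∘update′ (i≢j ∘ ≡.sym) β a))) ⟩
      below (lookup β i) (λ a → below (lookup β j) λ b → u (β [ i ]≔ a [ j ]≔ b))
        ≈⟨ exchange (lookup β i) (lookup β j) ⟩
      below (lookup β j) (λ b → below (lookup β i) λ a → u (β [ j ]≔ b [ i ]≔ a))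
        ≈⟨ below-cong (lookup β j) (λ b → reflexive (≡.cong (λ n → below n λ a → u (β [ j ]≔ b [ i ]≔ a)) (Vec.lookup∘update′ i≢j β b))) ⟨
      below (lookup β j) (λ b → below (lookup (β [ j ]≔ b) i) λ a → u (β [ j ]≔ b [ i ]≔ a)) ∎
      where
      exchange : ∀ p q → below p (λ a → below q λ b → u (β [ i ]≔ a [ j ]≔ b)) ≈
                         below q (λ b → below p λ a → u (β [ j ]≔ b [ i ]≔ a))
      exchange zero    zero    = refl
      exchange zero    (suc q) = refl
      exchange (suc p) zero    = refl
      exchange (suc p) (suc q) = reflexive (≡.cong u (Vec.[]≔-commutes β i j i≢j))

    x^-cong : ∀ i r {u v} → (∀ β → u β ≈ v β) → ∀ β → x^ i r u β ≈ x^ i r v β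
    x^-cong i zero    e = e
    x^-cong i (suc r) e = x-cong i (x^-cong i r e)

    x^-0 : ∀ i r {u} → (∀ β → u β ≈ 0#) → ∀ β → x^ i r u β ≈ 0#
    x^-0 i zero    e = e
    x^-0 i (suc r) e = x-0 i (x^-0 i r e)

    x^-+ : ∀ i r u v β → x^ i r (λ γ → u γ + v γ) β ≈ x^ i r u β + x^ i r v β
    x^-+ i zero    u v β = refl
    x^-+ i (suc r) u v β = trans (x-cong i (x^-+ i r u v) β) (x-+ i (x^ i r u) (x^ i r v) β)

    x^-*ˡ : ∀ i r c u β → x^ i r (λ γ → c * u γ) β ≈ c * x^ i r u β
    x^-*ˡ i zero    c u β = refl
    x^-*ˡ i (suc r) c u β = trans (x-cong i (x^-*ˡ i r c u) β) (x-*ˡ i c (x^ i r u) β)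

    x^-∑ : {A : Set} → ∀ i r (ts : List A) (u : A → Fun) β →
           x^ i r (λ γ → ∑ ts (λ t → u t γ)) β ≈ ∑ ts (λ t → x^ i r (u t) β)
    x^-∑ i zero    ts u β = refl
    x^-∑ i (suc r) ts u β = trans (x-cong i (x^-∑ i r ts u) β) (x-∑ i ts (λ t → x^ i r (u t)) β)

    x-x^-comm : ∀ i j s u β → x i (x^ j s u) β ≈ x^ j s (x i u) β
    x-x^-comm i j zero    u β = refl
    x-x^-comm i j (suc s) u β = trans (x-comm i j (x^ j s u) β) (x-cong j (x-x^-comm i j s u) β)

    x^-comm : ∀ i r j s u β → x^ i r (x^ j s u) β ≈ x^ j s (x^ i r u) β
    x^-comm i zero    j s u β = refl
    x^-comm i (suc r) j s u β = trans (x-cong i (x^-comm i r j s u) β) (x-x^-comm i j s (x^ i r u) β)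

    x^-x^ : ∀ i r s u → x^ i (r ℕ.+ s) u ≡ x^ i r (x^ i s u)
    x^-x^ i zero    s u = ≡.refl
    x^-x^ i (suc r) s u = ≡.cong (x i) (x^-x^ i r s u)

    x^-below^ : ∀ i r u β → x^ i r u β ≈ below^ r (lookup β i) λ b → u (β [ i ]≔ b)
    x^-below^ i zero    u β = reflexive (≡.cong u (≡.sym (Vec.[]≔-lookup β i)))
    x^-below^ i (suc r) u β = below-cong (lookup β i) λ b → trans (x^-below^ i r u (β [ i ]≔ b))
      (reflexive (≡.trans (≡.cong (λ n → below^ r n λ c → u (β [ i ]≔ b [ i ]≔ c)) (Vec.lookup∘update i β b))
        (idem r b b)))
      where
      idem : ∀ r n b → below^ r n (λ c → u (β [ i ]≔ b [ i ]≔ c)) ≡ below^ r n (λ c → u (β [ i ]≔ c))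
      idem zero    n       b = ≡.cong u (Vec.[]≔-idempotent β i)
      idem (suc r) zero    b = ≡.refl
      idem (suc r) (suc n) b = idem r n b

    -- The commutator of xᵢ ∂/∂xᵢ with xᵢ is xᵢ: at exponent b + 1 the factor splits as 1 + b, and b
    -- is the exponent that θ sees before the shift.
    θ-x : ∀ i u β → θ i (x i u) β ≈ x i u β + x i (θ i u) β
    θ-x i u β with lookup β i
    ... | zero  = trans (zeroʳ (ι 0)) (sym (+-identityˡ 0#))
    ... | suc b = begin
      ι (suc b) * v                        ≈⟨ *-congʳ (ι-suc b) ⟩
      (1# + ι b) * v                       ≈⟨ distribʳ v 1# (ι b) ⟩
      1# * v + ι b * v                     ≈⟨ +-cong (*-identityˡ v) (*-congʳ (ι-cong (≡.sym (Vec.lookup∘update i β b)))) ⟩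
      v + ι (lookup (β [ i ]≔ b) i) * v    ∎
      where v = u (β [ i ]≔ b)

    θ-x-other : ∀ {i j} → i ≢ j → ∀ u β → θ i (x j u) β ≈ x j (θ i u) β
    θ-x-other {i} {j} i≢j u β = lemma (lookup β j)
      where
      lemma : ∀ n → ι (lookup β i) * below n (λ b → u (β [ j ]≔ b)) ≈
                    below n (λ b → ι (lookup (β [ j ]≔ b) i) * u (β [ j ]≔ b))
      lemma zero    = zeroʳ _
      lemma (suc b) = *-congʳ (ι-cong (≡.sym (Vec.lookup∘update′ i≢j β b)))

    θ-x^ : ∀ i r u β → θ i (x^ i r u) β ≈ ι r * x^ i r u β + x^ i r (θ i u) β
    θ-x^ i zero    u β = sym (trans (+-congʳ (trans (*-congʳ ι-zero) (zeroˡ (u β)))) (+-identityˡ _))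
    θ-x^ i (suc r) u β = begin
      θ i (x i w) β                              ≈⟨ θ-x i w β ⟩
      x i w β + x i (θ i w) β                    ≈⟨ +-congˡ (x-cong i (θ-x^ i r u) β) ⟩
      x i w β + x i (λ γ → ι r * w γ + x^ i r (θ i u) γ) β
                                                 ≈⟨ +-congˡ (trans (x-+ i (λ γ → ι r * w γ) (x^ i r (θ i u)) β) (+-congʳ (x-*ˡ i (ι r) w β))) ⟩
      x i w β + (ι r * x i w β + x^ i (suc r) (θ i u) β)
                                                 ≈⟨ +-assoc _ _ _ ⟨
      x i w β + ι r * x i w β + x^ i (suc r) (θ i u) β
                                                 ≈⟨ +-congʳ (trans (+-congʳ (sym (*-identityˡ _))) (trans (sym (distribʳ _ 1# (ι r))) (*-congʳ (sym (ι-suc r))))) ⟩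
      ι (suc r) * x i w β + x^ i (suc r) (θ i u) β ∎
      where w = x^ i r u

    θ-x^-other : ∀ {i j} → i ≢ j → ∀ r u β → θ i (x^ j r u) β ≈ x^ j r (θ i u) β
    θ-x^-other i≢j zero    u β = refl
    θ-x^-other {j = j} i≢j (suc r) u β = trans (θ-x-other i≢j (x^ j r u) β) (x-cong j (θ-x^-other i≢j r u) β)

  private
    indicator-ι : ∀ b n → ι (if b then n else 0) ≈ indicator b (ι n)
    indicator-ι true  n = refl
    indicator-ι false n = ι-zero

  -- `lower` lists only the entries that can be lowered. Indexing by all variables, with value zero
  -- for the others, turns the count into the action of Σ xᵢ^r.
  sum-lower-x^ : ∀ {N} (F : List ℕ → ℕ) r (β : Vec ℕ N) →
    ι (sumOver F (lower r (toList β))) ≈ ∑ (allFin N) λ i → below^ r (lookup β i) λ b → ι (F (toList (β [ i ]≔ b)))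
  sum-lower-x^ F r []      = ι-zero
  sum-lower-x^ {suc N} F r (b ∷ β) = begin
    ι (sumOver F (lower r (b ∷ toList β)))
      ≈⟨ ι-cong (sum-lower-∷ F r b (toList β)) ⟩
    ι (lowerHead r b (toList β) F ℕ.+ sumOver (F ∘ (b ∷_)) (lower r (toList β)))
      ≈⟨ ι-+ (lowerHead r b (toList β) F) _ ⟩
    ι (lowerHead r b (toList β) F) + ι (sumOver (F ∘ (b ∷_)) (lower r (toList β)))
      ≈⟨ +-cong (trans (indicator-ι (does (r ℕ.≤? b)) (F (b ∸ r ∷ toList β))) (reflexive (≡.sym (below^-≤ r b λ c → ι (F (c ∷ toList β))))))
                (sum-lower-x^ (F ∘ (b ∷_)) r β) ⟩
    below^ r b (λ c → ι (F (c ∷ toList β))) +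
      ∑ (allFin N) (λ i → below^ r (lookup β i) λ c → ι (F (b ∷ toList (β [ i ]≔ c))))
      ≈⟨ ∑-allFin-suc N (λ i → below^ r (lookup (b ∷ β) i) λ c → ι (F (toList ((b ∷ β) [ i ]≔ c)))) ⟨
    ∑ (allFin (suc N)) (λ i → below^ r (lookup (b ∷ β) i) λ c → ι (F (toList ((b ∷ β) [ i ]≔ c)))) ∎

  module _ {N : ℕ} where

    private
      Exps = Vec ℕ N
      Fun = Exps → Carrier

    X : List ℕ → Fun
    X ρ β = ι (xcoeffᵖ ρ (toList β))

    X-∷ : ∀ r ρ β → X (r ∷ ρ) β ≈ ∑ (allFin N) λ i → x^ i r (X ρ) β
    X-∷ r ρ β = trans (sum-lower-x^ (xcoeffᵖ ρ) r β) (∑-cong (allFin N) λ i → sym (x^-below^ i r (X ρ) β))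

    X-∷∷ : ∀ r s ρ β → X (r ∷ s ∷ ρ) β ≈ ∑ (allFin N) λ i → ∑ (allFin N) λ j → x^ i r (x^ j s (X ρ)) β
    X-∷∷ r s ρ β = trans (X-∷ r (s ∷ ρ) β) (∑-cong (allFin N) λ i →
      trans (x^-cong i r (X-∷ s ρ) β) (x^-∑ i r (allFin N) (λ j → x^ j s (X ρ)) β))

    X-↭ : ∀ {ρ σ} → ρ ↭ σ → ∀ β → X ρ β ≈ X σ β
    X-↭ ↭.refl β = refl
    X-↭ (prep {ρ} {σ} r p) β = begin
      X (r ∷ ρ) β                              ≈⟨ X-∷ r ρ β ⟩
      ∑ (allFin N) (λ i → x^ i r (X ρ) β)      ≈⟨ ∑-cong (allFin N) (λ i → x^-cong i r (X-↭ p) β) ⟩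
      ∑ (allFin N) (λ i → x^ i r (X σ) β)      ≈⟨ X-∷ r σ β ⟨
      X (r ∷ σ) β                              ∎
    X-↭ (swap {ρ} {σ} r s p) β = begin
      X (r ∷ s ∷ ρ) β
        ≈⟨ X-∷∷ r s ρ β ⟩
      ∑ (allFin N) (λ i → ∑ (allFin N) λ j → x^ i r (x^ j s (X ρ)) β)
        ≈⟨ ∑-swap (allFin N) (allFin N) _ ⟩
      ∑ (allFin N) (λ j → ∑ (allFin N) λ i → x^ i r (x^ j s (X ρ)) β)
        ≈⟨ ∑-cong (allFin N) (λ j → ∑-cong (allFin N) λ i → trans (x^-comm i r j s (X ρ) β) (x^-cong j s (x^-cong i r (X-↭ p)) β)) ⟩
      ∑ (allFin N) (λ j → ∑ (allFin N) λ i → x^ j s (x^ i r (X σ)) β)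
        ≈⟨ X-∷∷ s r σ β ⟨
      X (s ∷ r ∷ σ) β ∎
    X-↭ (↭.trans p q) β = trans (X-↭ p β) (X-↭ q β)

    -- ∂X k ρ collects the coefficients of D_k p_ρ, as X ρ does those of p_ρ.
    ∂X : ℕ → List ℕ → Fun
    ∂X k ρ β = ι (k ℕ.* count k ρ) * X (deletePart k ρ) β

    ∂X-absent : ∀ {k ρ} → count k ρ ≡ 0 → ∀ β → ∂X k ρ β ≈ 0#
    ∂X-absent {k} {ρ} eq β = trans (*-congʳ (trans (ι-cong (≡.trans (≡.cong (k ℕ.*_) eq) (ℕ.*-zeroʳ k))) ι-zero)) (zeroˡ _)

    -- The Leibniz rule for D_k on p_r p_ρ.
    ∂X-∷ : ∀ k r ρ β → ∂X k (r ∷ ρ) β ≈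
           indicator (does (k ℕ.≟ r)) (ι r * X ρ β) + ∑ (allFin N) (λ i → x^ i r (∂X k ρ) β)
    ∂X-∷ k r ρ β = trans leibniz (+-congˡ (begin
      ι (k ℕ.* count k ρ) * X (r ∷ deletePart k ρ) β
        ≈⟨ *-congˡ (X-∷ r (deletePart k ρ) β) ⟩
      ι (k ℕ.* count k ρ) * ∑ (allFin N) (λ i → x^ i r (X (deletePart k ρ)) β)
        ≈⟨ ∑-*ˡ (allFin N) _ _ ⟨
      ∑ (allFin N) (λ i → ι (k ℕ.* count k ρ) * x^ i r (X (deletePart k ρ)) β)
        ≈⟨ ∑-cong (allFin N) (λ i → x^-*ˡ i r _ _ β) ⟨
      ∑ (allFin N) (λ i → x^ i r (∂X k ρ) β) ∎))
      where
      leibniz : ∂X k (r ∷ ρ) β ≈ indicator (does (k ℕ.≟ r)) (ι r * X ρ β) + ι (k ℕ.* count k ρ) * X (r ∷ deletePart k ρ) β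
      leibniz = case (k ℕ.≟ r)
        where
        case : Dec (k ≡ r) → _
        case (no k≢r) = begin
          ∂X k (r ∷ ρ) β
            ≈⟨ reflexive (≡.cong₂ (λ c σ → ι (k ℕ.* c) * X σ β) (count-there ρ k≢r) (deletePart-there ρ k≢r)) ⟩
          ι (k ℕ.* count k ρ) * X (r ∷ deletePart k ρ) β
            ≈⟨ +-identityˡ _ ⟨
          0# + ι (k ℕ.* count k ρ) * X (r ∷ deletePart k ρ) β
            ≈⟨ +-congʳ (reflexive (indicator-no (k ℕ.≟ r) k≢r)) ⟨
          indicator (does (k ℕ.≟ r)) (ι r * X ρ β) + ι (k ℕ.* count k ρ) * X (r ∷ deletePart k ρ) β ∎
        case (yes ≡.refl) = begin
          ∂X k (k ∷ ρ) β
            ≈⟨ reflexive (≡.cong₂ (λ c σ → ι (k ℕ.* c) * X σ β) (count-here k ρ) (deletePart-here k ρ)) ⟩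
          ι (k ℕ.* suc (count k ρ)) * X ρ β
            ≈⟨ *-congʳ (trans (ι-cong (ℕ.*-suc k (count k ρ))) (ι-+ k _)) ⟩
          (ι k + ι (k ℕ.* count k ρ)) * X ρ β
            ≈⟨ distribʳ (X ρ β) (ι k) _ ⟩
          ι k * X ρ β + ι (k ℕ.* count k ρ) * X ρ β
            ≈⟨ +-cong (reflexive (≡.sym (indicator-yes (k ℕ.≟ k) ≡.refl))) put-back ⟩
          indicator (does (k ℕ.≟ k)) (ι k * X ρ β) + ι (k ℕ.* count k ρ) * X (k ∷ deletePart k ρ) β ∎
          where
          -- Deleting k and putting it back restores ρ only if k occurs in ρ; otherwise the factor k
          -- · `count k ρ` is zero.
          put-back : ι (k ℕ.* count k ρ) * X ρ β ≈ ι (k ℕ.* count k ρ) * X (k ∷ deletePart k ρ) β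
          put-back with count k ρ ℕ.≟ 0
          ... | yes eq = trans (absent _) (sym (absent _))
            where
            absent : ∀ v → ι (k ℕ.* count k ρ) * v ≈ 0#
            absent v = trans (*-congʳ (trans (ι-cong (≡.trans (≡.cong (k ℕ.*_) eq) (ℕ.*-zeroʳ k))) ι-zero)) (zeroˡ v)
          ... | no neq = *-congˡ (sym (X-↭ (deletePart-↭ k ρ neq) β))

    -- Chain rule: xᵢ ∂p_k/∂xᵢ = k xᵢ^k and D_k = k ∂/∂p_k. The induction matches the commutator of
    -- θᵢ and xᵢ^r, which is r xᵢ^r, with the Leibniz term of D_r; the bound on the parts puts r
    -- among the summation indices.
    θ-X : ∀ {n ρ} → All (λ r → 1 ≤ r × r ≤ n) ρ → ∀ i β →
          θ i (X ρ) β ≈ ∑ (upTo n) (λ k → x^ i (suc k) (∂X (suc k) ρ) β)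
    -- The constant 1 has its only coefficient at β = 0, where the exponent of xᵢ is zero.
    θ-X {n} [] i β = trans base (sym (∑-0 (upTo n) λ k → x^-0 i (suc k) (∂X-absent {suc k} {[]} ≡.refl) β))
      where
      lookup≤sum : ∀ {M} (γ : Vec ℕ M) j → lookup γ j ≤ sum (toList γ)
      lookup≤sum (b ∷ γ) zero    = ℕ.m≤m+n b _
      lookup≤sum (b ∷ γ) (suc j) = ℕ.≤-trans (lookup≤sum γ j) (ℕ.m≤n+m _ b)
      base : ι (lookup β i) * X [] β ≈ 0#
      base with sum (toList β) | lookup≤sum β i
      ... | zero  | le = trans (*-congʳ (trans (ι-cong (ℕ.n≤0⇒n≡0 le)) ι-zero)) (zeroˡ _)
      ... | suc _ | _  = trans (*-congˡ ι-zero) (zeroʳ _)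
    θ-X {n} {r ∷ ρ} ((1≤r , r≤n) ∷ ρ≤n) i β = begin
      ι (lookup β i) * X (r ∷ ρ) β
        ≈⟨ *-congˡ (X-∷ r ρ β) ⟩
      ι (lookup β i) * ∑ (allFin N) (λ l → x^ l r (X ρ) β)
        ≈⟨ ∑-*ˡ (allFin N) _ _ ⟨
      ∑ (allFin N) (λ l → θ i (x^ l r (X ρ)) β)
        ≈⟨ ∑-cong (allFin N) split ⟩
      ∑ (allFin N) (λ l → indicator (does (l Fin.≟ i)) (ι r * x^ l r (X ρ) β) + x^ l r (θ i (X ρ)) β)
        ≈⟨ ∑-+ (allFin N) _ _ ⟩
      ∑ (allFin N) (λ l → indicator (does (l Fin.≟ i)) (ι r * x^ l r (X ρ) β)) + ∑ (allFin N) (λ l → x^ l r (θ i (X ρ)) β)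
        ≈⟨ +-cong (trans (∑-select Fin._≟_ (λ l → ι r * x^ l r (X ρ) β) (allFin⁺ N) (∈-allFin i)) pick) rest ⟩
      ∑ (upTo n) (λ k → x^ i (suc k) (λ γ → indicator (does (suc k ℕ.≟ r)) (ι r * X ρ γ)) β) +
      ∑ (upTo n) (λ k → x^ i (suc k) (λ γ → ∑ (allFin N) (λ l → x^ l r (∂X (suc k) ρ) γ)) β)
        ≈⟨ ∑-+ (upTo n) _ _ ⟨
      ∑ (upTo n) (λ k → x^ i (suc k) (λ γ → indicator (does (suc k ℕ.≟ r)) (ι r * X ρ γ)) β +
                        x^ i (suc k) (λ γ → ∑ (allFin N) (λ l → x^ l r (∂X (suc k) ρ) γ)) β)
        ≈⟨ ∑-cong (upTo n) (λ k → trans (x^-cong i (suc k) (∂X-∷ (suc k) r ρ) β) (x^-+ i (suc k) _ _ β)) ⟨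
      ∑ (upTo n) (λ k → x^ i (suc k) (∂X (suc k) (r ∷ ρ)) β) ∎
      where
      split : ∀ l → θ i (x^ l r (X ρ)) β ≈ indicator (does (l Fin.≟ i)) (ι r * x^ l r (X ρ) β) + x^ l r (θ i (X ρ)) β
      split l = case (l Fin.≟ i)
        where
        case : Dec (l ≡ i) → _
        case (yes ≡.refl) = trans (θ-x^ i r (X ρ) β) (+-congʳ (reflexive (≡.sym (indicator-yes (i Fin.≟ i) ≡.refl))))
        case (no l≢i) = trans (θ-x^-other (l≢i ∘ ≡.sym) r (X ρ) β)
          (trans (sym (+-identityˡ _)) (+-congʳ (reflexive (≡.sym (indicator-no (l Fin.≟ i) l≢i)))))
      pick : ι r * x^ i r (X ρ) β ≈ ∑ (upTo n) (λ k → x^ i (suc k) (λ γ → indicator (does (suc k ℕ.≟ r)) (ι r * X ρ γ)) β)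
      pick = pick′ 1≤r r≤n
        where
        pick′ : ∀ {r} → 1 ≤ r → r ≤ n →
          ι r * x^ i r (X ρ) β ≈ ∑ (upTo n) (λ k → x^ i (suc k) (λ γ → indicator (does (suc k ℕ.≟ r)) (ι r * X ρ γ)) β)
        pick′ {suc r} _ r<n = trans
          (trans (sym (x^-*ˡ i (suc r) (ι (suc r)) (X ρ) β)) (sym (∑-select ℕ._≟_ (λ k → x^ i (suc k) (λ γ → ι (suc r) * X ρ γ) β) (upTo⁺ n) (∈-upTo⁺ r<n))))
          (∑-cong (upTo n) pull)
          where
          pull : ∀ k → indicator (does (k ℕ.≟ r)) (x^ i (suc k) (λ γ → ι (suc r) * X ρ γ) β) ≈
                       x^ i (suc k) (λ γ → indicator (does (k ℕ.≟ r)) (ι (suc r) * X ρ γ)) β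
          pull k with does (k ℕ.≟ r)
          ... | true  = refl
          ... | false = sym (x^-0 i (suc k) (λ _ → refl) β)
      rest : ∑ (allFin N) (λ l → x^ l r (θ i (X ρ)) β) ≈
             ∑ (upTo n) (λ k → x^ i (suc k) (λ γ → ∑ (allFin N) (λ l → x^ l r (∂X (suc k) ρ) γ)) β)
      rest = begin
        ∑ (allFin N) (λ l → x^ l r (θ i (X ρ)) β)
          ≈⟨ ∑-cong (allFin N) (λ l → trans (x^-cong l r (θ-X ρ≤n i) β) (x^-∑ l r (upTo n) _ β)) ⟩
        ∑ (allFin N) (λ l → ∑ (upTo n) (λ k → x^ l r (x^ i (suc k) (∂X (suc k) ρ)) β))
          ≈⟨ ∑-swap (allFin N) (upTo n) _ ⟩
        ∑ (upTo n) (λ k → ∑ (allFin N) (λ l → x^ l r (x^ i (suc k) (∂X (suc k) ρ)) β))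
          ≈⟨ ∑-cong (upTo n) (λ k → trans (∑-cong (allFin N) λ l → x^-comm l r i (suc k) (∂X (suc k) ρ) β)
                                          (sym (x^-∑ i (suc k) (allFin N) _ β))) ⟩
        ∑ (upTo n) (λ k → x^ i (suc k) (λ γ → ∑ (allFin N) (λ l → x^ l r (∂X (suc k) ρ) γ)) β) ∎

-- The Laplace-Beltrami operator

module LaplaceBeltrami (S : Scalars) where
  open Monomials S public
  open import Relation.Binary.Reasoning.Setoid setoid
  open import Algebra.Solver.Ring.NaturalCoefficients.Default commutativeSemiring using (solve; _:=_; _:+_; _:*_; con)

  PartsIn : ℕ → List ℕ → Set
  PartsIn n = All (λ r → 1 ≤ r × r ≤ n)

  -- Row n vanishes, so the shift loses nothing at the far edge, and the second sum puts back row 0.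
  -- Both sides of `G-relation` become the same square in this way.
  ∑-shift-square : ∀ n (h : ℕ → ℕ → Carrier) → (∀ j → h n j ≈ 0#) →
    ∑ (upTo n) (λ i → ∑ (upTo n) (λ j → h (suc i) j)) + ∑ (upTo n) (h 0) ≈
    ∑ (upTo n) (λ i → ∑ (upTo n) (λ j → h i j))
  ∑-shift-square n h edge = begin
    ∑ (upTo n) (row ∘ suc) + row 0   ≈⟨ +-comm _ _ ⟩
    row 0 + ∑ (upTo n) (row ∘ suc)   ≈⟨ ∑-upTo-suc n row ⟨
    ∑ (upTo (suc n)) row             ≈⟨ ∑-upTo-last n row ⟩
    ∑ (upTo n) row + row n           ≈⟨ +-congˡ (∑-0 (upTo n) edge) ⟩
    ∑ (upTo n) row + 0#              ≈⟨ +-identityʳ _ ⟩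
    ∑ (upTo n) row                   ∎
    where
    row : ℕ → Carrier
    row i = ∑ (upTo n) (h i)

  -- k + 1 is a sum of two positive integers in k ways. The inner sums are tails of y, and y (k + 1)
  -- lies in k of them; `partial` is the corresponding summation by parts.
  ∑-antidiagonals : ∀ n (y : ℕ → Carrier) → (∀ k → n < k → y k ≈ 0#) →
    ∑ (upTo n) (λ i → ∑ (upTo n) (λ j → y (suc i ℕ.+ suc j))) ≈ ∑ (upTo n) (λ k → ι k * y (suc k))
  ∑-antidiagonals n y vanish = begin
    ∑ (upTo n) (λ i → ∑ (upTo n) (λ j → y (suc i ℕ.+ suc j)))
      ≈⟨ ∑-cong (upTo n) (λ i → ∑-cong (upTo n) λ j → reflexive (≡.cong (y ∘ suc) (ℕ.+-suc i j))) ⟩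
    ∑ (upTo n) (tail ∘ suc)
      ≈⟨ partial n ⟩
    ∑ (upTo n) (λ k → ι k * y (suc k)) + ι n * tail n
      ≈⟨ +-congˡ (trans (*-congˡ (∑-0 (upTo n) λ j → vanish _ (s≤s (ℕ.m≤m+n n j)))) (zeroʳ (ι n))) ⟩
    ∑ (upTo n) (λ k → ι k * y (suc k)) + 0#
      ≈⟨ +-identityʳ _ ⟩
    ∑ (upTo n) (λ k → ι k * y (suc k)) ∎
    where
    tail : ℕ → Carrier
    tail i = ∑ (upTo n) (λ j → y (suc i ℕ.+ j))
    tail-suc : ∀ i → tail i ≈ y (suc i) + tail (suc i)
    tail-suc i = begin
      tail i                                              ≈⟨ +-identityʳ _ ⟨
      tail i + 0#                                         ≈⟨ +-congˡ (vanish _ (s≤s (ℕ.m≤n+m n i))) ⟨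
      tail i + y (suc i ℕ.+ n)                            ≈⟨ ∑-upTo-last n _ ⟨
      ∑ (upTo (suc n)) (λ j → y (suc i ℕ.+ j))            ≈⟨ ∑-upTo-suc n _ ⟩
      y (suc i ℕ.+ 0) + ∑ (upTo n) (λ j → y (suc i ℕ.+ suc j))
                                                          ≈⟨ +-cong (reflexive (≡.cong (y ∘ suc) (ℕ.+-identityʳ i))) (∑-cong (upTo n) λ j → reflexive (≡.cong (y ∘ suc) (ℕ.+-suc i j))) ⟩
      y (suc i) + tail (suc i)                            ∎
    partial : ∀ m → ∑ (upTo m) (tail ∘ suc) ≈ ∑ (upTo m) (λ k → ι k * y (suc k)) + ι m * tail m
    partial zero    = sym (trans (+-congˡ (trans (*-congʳ ι-zero) (zeroˡ _))) (+-identityʳ 0#))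
    partial (suc m) = begin
      ∑ (upTo (suc m)) (tail ∘ suc)
        ≈⟨ ∑-upTo-last m _ ⟩
      ∑ (upTo m) (tail ∘ suc) + tail (suc m)
        ≈⟨ +-congʳ (trans (partial m) (+-congˡ (*-congˡ (tail-suc m)))) ⟩
      ∑ (upTo m) (λ k → ι k * y (suc k)) + ι m * (y (suc m) + tail (suc m)) + tail (suc m)
        ≈⟨ solve 4 (λ s c a t → s :+ c :* (a :+ t) :+ t := (s :+ c :* a) :+ (con 1 :+ c) :* t) refl _ _ _ _ ⟩
      (∑ (upTo m) (λ k → ι k * y (suc k)) + ι m * y (suc m)) + (1# + ι m) * tail (suc m)
        ≈⟨ +-cong (sym (∑-upTo-last m _)) (*-congʳ (sym (ι-suc m))) ⟩
      ∑ (upTo (suc m)) (λ k → ι k * y (suc k)) + ι (suc m) * tail (suc m) ∎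

  module _ {N : ℕ} (n : ℕ) where

    private
      Exps = Vec ℕ N
      Fun = Exps → Carrier

    -- The coefficients at x^β of Σ p_{i+j} D_i D_j, Σ p_i p_j D_{i+j} and Σ (k - 1) p_k D_k applied
    -- to p_ρ. Indices are shifted by one, so `ι k` in `XN` is the factor k - 1.
    XA XB XN : List ℕ → Fun
    XA ρ β = ∑ (upTo n) λ i → ∑ (upTo n) λ j →
      ι (suc j ℕ.* count (suc j) ρ) * (ι (suc i ℕ.* count (suc i) (deletePart (suc j) ρ)) *
        X (suc i ℕ.+ suc j ∷ deletePart (suc i) (deletePart (suc j) ρ)) β)
    XB ρ β = ∑ (upTo n) λ i → ∑ (upTo n) λ j →
      ι ((suc i ℕ.+ suc j) ℕ.* count (suc i ℕ.+ suc j) ρ) * X (suc i ∷ suc j ∷ deletePart (suc i ℕ.+ suc j) ρ) β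
    XN ρ β = ∑ (upTo n) λ k → ι k * (ι (suc k ℕ.* count (suc k) ρ) * X (suc k ∷ deletePart (suc k) ρ) β)

    XN-x^ : ∀ ρ β → XN ρ β ≈ ∑ (allFin N) λ l → ∑ (upTo n) λ k → ι k * x^ l (suc k) (∂X (suc k) ρ) β
    XN-x^ ρ β = trans (∑-cong (upTo n) term) (∑-swap (upTo n) (allFin N) _)
      where
      term : ∀ k → ι k * (ι (suc k ℕ.* count (suc k) ρ) * X (suc k ∷ deletePart (suc k) ρ) β) ≈
                   ∑ (allFin N) λ l → ι k * x^ l (suc k) (∂X (suc k) ρ) β
      term k = trans (*-congˡ (trans (*-congˡ (X-∷ (suc k) (deletePart (suc k) ρ) β)) (trans (sym (∑-*ˡ (allFin N) _ _))
        (∑-cong (allFin N) λ l → sym (x^-*ˡ l (suc k) _ (X (deletePart (suc k) ρ)) β))))) (sym (∑-*ˡ (allFin N) (ι k) _))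

    -- In each variable the chain rule in i turns Σ x^{i+j} D_i D_j into Σ x^j θ D_j. As θ x^j = j
    -- x^j + x^j θ, the terms (j - 1) x^j D_j of `XN` and x^j D_j of θ are exactly what this lacks
    -- from θ Σ x^j D_j, which is θ².
    XA-identity : ∀ {ρ} → PartsIn n ρ → ∀ β →
      XA ρ β + (XN ρ β + ∑ (allFin N) (λ l → θ l (X ρ) β)) ≈ ∑ (allFin N) λ l → θ l (θ l (X ρ)) β
    XA-identity {ρ} ρ≤n β = begin
      XA ρ β + (XN ρ β + ∑ (allFin N) (λ l → θ l (X ρ) β))
        ≈⟨ +-cong XA-x^ (+-congʳ (XN-x^ ρ β)) ⟩
      ∑ (allFin N) T + (∑ (allFin N) V + ∑ (allFin N) (λ l → θ l (X ρ) β))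
        ≈⟨ +-congˡ (∑-+ (allFin N) V _) ⟨
      ∑ (allFin N) T + ∑ (allFin N) (λ l → V l + θ l (X ρ) β)
        ≈⟨ ∑-+ (allFin N) T _ ⟨
      ∑ (allFin N) (λ l → T l + (V l + θ l (X ρ) β))
        ≈⟨ ∑-cong (allFin N) square ⟩
      ∑ (allFin N) (λ l → θ l (θ l (X ρ)) β) ∎
      where
      T V : Fin N → Carrier
      T l = ∑ (upTo n) λ j → x^ l (suc j) (θ l (∂X (suc j) ρ)) β
      V l = ∑ (upTo n) λ k → ι k * x^ l (suc k) (∂X (suc k) ρ) β

      square : ∀ l → T l + (V l + θ l (X ρ) β) ≈ θ l (θ l (X ρ)) β
      square l = begin
        T l + (V l + θ l (X ρ) β)
          ≈⟨ +-congˡ (+-congˡ (θ-X ρ≤n l β)) ⟩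
        T l + (V l + ∑ (upTo n) (λ k → x^ l (suc k) (∂X (suc k) ρ) β))
          ≈⟨ trans (+-congˡ (sym (∑-+ (upTo n) _ _))) (sym (∑-+ (upTo n) _ _)) ⟩
        ∑ (upTo n) (λ k → x^ l (suc k) (θ l (∂X (suc k) ρ)) β + (ι k * x^ l (suc k) (∂X (suc k) ρ) β + x^ l (suc k) (∂X (suc k) ρ) β))
          ≈⟨ ∑-cong (upTo n) (λ k → collect k (x^ l (suc k) (θ l (∂X (suc k) ρ)) β) (x^ l (suc k) (∂X (suc k) ρ) β) (θ-x^ l (suc k) (∂X (suc k) ρ) β)) ⟩
        ∑ (upTo n) (λ k → θ l (x^ l (suc k) (∂X (suc k) ρ)) β)
          ≈⟨ ∑-*ˡ (upTo n) _ _ ⟩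
        ι (lookup β l) * ∑ (upTo n) (λ k → x^ l (suc k) (∂X (suc k) ρ) β)
          ≈⟨ *-congˡ (θ-X ρ≤n l β) ⟨
        θ l (θ l (X ρ)) β ∎
        where
        collect : ∀ k t v {w} → w ≈ ι (suc k) * v + t → t + (ι k * v + v) ≈ w
        collect k t v e = sym (trans e (trans (+-congʳ (trans (*-congʳ (ι-suc k)) (trans (distribʳ v 1# (ι k)) (+-congʳ (*-identityˡ v)))))
          (trans (+-comm _ t) (+-congˡ (+-comm v _)))))

      XA-x^ : XA ρ β ≈ ∑ (allFin N) T
      XA-x^ = begin
        XA ρ β
          ≈⟨ ∑-cong (upTo n) (λ i → ∑-cong (upTo n) λ j → term i j) ⟩
        ∑ (upTo n) (λ i → ∑ (upTo n) λ j → ∑ (allFin N) λ l → W i j l)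
          ≈⟨ ∑-swap (upTo n) (upTo n) _ ⟩
        ∑ (upTo n) (λ j → ∑ (upTo n) λ i → ∑ (allFin N) λ l → W i j l)
          ≈⟨ ∑-cong (upTo n) (λ j → ∑-swap (upTo n) (allFin N) _) ⟩
        ∑ (upTo n) (λ j → ∑ (allFin N) λ l → ∑ (upTo n) λ i → W i j l)
          ≈⟨ ∑-swap (upTo n) (allFin N) _ ⟩
        ∑ (allFin N) (λ l → ∑ (upTo n) λ j → ∑ (upTo n) λ i → W i j l)
          ≈⟨ ∑-cong (allFin N) (λ l → ∑-cong (upTo n) λ j → euler l j) ⟩
        ∑ (allFin N) T ∎
        where
        c : ℕ → Carrier
        c j = ι (suc j ℕ.* count (suc j) ρ)
        ρ∖ : ℕ → List ℕ
        ρ∖ j = deletePart (suc j) ρ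
        W : ℕ → ℕ → Fin N → Carrier
        W i j l = c j * x^ l (suc j) (x^ l (suc i) (∂X (suc i) (ρ∖ j))) β
        term : ∀ i j → c j * (ι (suc i ℕ.* count (suc i) (ρ∖ j)) * X (suc i ℕ.+ suc j ∷ deletePart (suc i) (ρ∖ j)) β) ≈
                       ∑ (allFin N) (W i j)
        term i j = trans (*-congˡ (begin
          ι (suc i ℕ.* count (suc i) (ρ∖ j)) * X (suc i ℕ.+ suc j ∷ deletePart (suc i) (ρ∖ j)) β
            ≈⟨ *-congˡ (X-∷ (suc i ℕ.+ suc j) (deletePart (suc i) (ρ∖ j)) β) ⟩
          ι (suc i ℕ.* count (suc i) (ρ∖ j)) * ∑ (allFin N) (λ l → x^ l (suc i ℕ.+ suc j) (X (deletePart (suc i) (ρ∖ j))) β)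
            ≈⟨ ∑-*ˡ (allFin N) _ _ ⟨
          ∑ (allFin N) (λ l → ι (suc i ℕ.* count (suc i) (ρ∖ j)) * x^ l (suc i ℕ.+ suc j) (X (deletePart (suc i) (ρ∖ j))) β)
            ≈⟨ ∑-cong (allFin N) (λ l → trans (sym (x^-*ˡ l (suc i ℕ.+ suc j) _ (X (deletePart (suc i) (ρ∖ j))) β))
                 (reflexive (≡.cong (λ u → u β) (≡.trans (≡.cong (λ r → x^ l r (∂X (suc i) (ρ∖ j))) (ℕ.+-comm (suc i) (suc j)))
                   (x^-x^ l (suc j) (suc i) (∂X (suc i) (ρ∖ j))))))) ⟩
          ∑ (allFin N) (λ l → x^ l (suc j) (x^ l (suc i) (∂X (suc i) (ρ∖ j))) β) ∎))
          (sym (∑-*ˡ (allFin N) (c j) _))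
        euler : ∀ l j → ∑ (upTo n) (λ i → W i j l) ≈ x^ l (suc j) (θ l (∂X (suc j) ρ)) β
        euler l j = begin
          ∑ (upTo n) (λ i → W i j l)
            ≈⟨ ∑-*ˡ (upTo n) (c j) _ ⟩
          c j * ∑ (upTo n) (λ i → x^ l (suc j) (x^ l (suc i) (∂X (suc i) (ρ∖ j))) β)
            ≈⟨ *-congˡ (x^-∑ l (suc j) (upTo n) _ β) ⟨
          c j * x^ l (suc j) (λ γ → ∑ (upTo n) (λ i → x^ l (suc i) (∂X (suc i) (ρ∖ j)) γ)) β
            ≈⟨ *-congˡ (x^-cong l (suc j) (θ-X (deletePart-All (suc j) ρ≤n) l) β) ⟨
          c j * x^ l (suc j) (θ l (X (ρ∖ j))) β
            ≈⟨ x^-*ˡ l (suc j) (c j) _ β ⟨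
          x^ l (suc j) (λ γ → c j * θ l (X (ρ∖ j)) γ) β
            ≈⟨ x^-cong l (suc j) (λ γ → *-swapˡ (c j) _ _) β ⟩
          x^ l (suc j) (θ l (∂X (suc j) ρ)) β ∎

    -- For l ≠ m and parts at most n this is (x_m θ_l - x_l θ_m) / (x_l - x_m) applied to p_ρ,
    -- because the sum of x_l^i x_m^j over i + j = k with i, j ≥ 1 is (x_m x_l^k - x_l x_m^k) / (x_l
    -- - x_m). As a sum it needs no division.
    G : Fin N → Fin N → List ℕ → Fun
    G l m ρ β = ∑ (upTo n) λ i → ∑ (upTo n) λ j → x^ l (suc i) (x^ m (suc j) (∂X (suc i ℕ.+ suc j) ρ)) β

    XB-G : ∀ ρ β → XB ρ β ≈ ∑ (allFin N) λ l → ∑ (allFin N) λ m → G l m ρ β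
    XB-G ρ β = begin
      XB ρ β
        ≈⟨ ∑-cong (upTo n) (λ i → ∑-cong (upTo n) λ j → term i j) ⟩
      ∑ (upTo n) (λ i → ∑ (upTo n) λ j → ∑ (allFin N) λ l → ∑ (allFin N) λ m → W i j l m)
        ≈⟨ ∑-cong (upTo n) (λ i → ∑-swap (upTo n) (allFin N) _) ⟩
      ∑ (upTo n) (λ i → ∑ (allFin N) λ l → ∑ (upTo n) λ j → ∑ (allFin N) λ m → W i j l m)
        ≈⟨ ∑-swap (upTo n) (allFin N) _ ⟩
      ∑ (allFin N) (λ l → ∑ (upTo n) λ i → ∑ (upTo n) λ j → ∑ (allFin N) λ m → W i j l m)
        ≈⟨ ∑-cong (allFin N) (λ l → ∑-cong (upTo n) λ i → ∑-swap (upTo n) (allFin N) _) ⟩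
      ∑ (allFin N) (λ l → ∑ (upTo n) λ i → ∑ (allFin N) λ m → ∑ (upTo n) λ j → W i j l m)
        ≈⟨ ∑-cong (allFin N) (λ l → ∑-swap (upTo n) (allFin N) _) ⟩
      ∑ (allFin N) (λ l → ∑ (allFin N) λ m → G l m ρ β) ∎
      where
      W : ℕ → ℕ → Fin N → Fin N → Carrier
      W i j l m = x^ l (suc i) (x^ m (suc j) (∂X (suc i ℕ.+ suc j) ρ)) β
      term : ∀ i j → ι ((suc i ℕ.+ suc j) ℕ.* count (suc i ℕ.+ suc j) ρ) * X (suc i ∷ suc j ∷ deletePart (suc i ℕ.+ suc j) ρ) β ≈
                     ∑ (allFin N) λ l → ∑ (allFin N) λ m → W i j l m
      term i j = begin
        c * X (suc i ∷ suc j ∷ ρ′) β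
          ≈⟨ *-congˡ (X-∷∷ (suc i) (suc j) ρ′ β) ⟩
        c * ∑ (allFin N) (λ l → ∑ (allFin N) λ m → x^ l (suc i) (x^ m (suc j) (X ρ′)) β)
          ≈⟨ trans (sym (∑-*ˡ (allFin N) c _)) (∑-cong (allFin N) λ l → sym (∑-*ˡ (allFin N) c _)) ⟩
        ∑ (allFin N) (λ l → ∑ (allFin N) λ m → c * x^ l (suc i) (x^ m (suc j) (X ρ′)) β)
          ≈⟨ ∑-cong (allFin N) (λ l → ∑-cong (allFin N) λ m →
               trans (sym (x^-*ˡ l (suc i) c _ β)) (x^-cong l (suc i) (λ γ → sym (x^-*ˡ m (suc j) c (X ρ′) γ)) β)) ⟩
        ∑ (allFin N) (λ l → ∑ (allFin N) λ m → W i j l m) ∎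
        where
        c = ι ((suc i ℕ.+ suc j) ℕ.* count (suc i ℕ.+ suc j) ρ)
        ρ′ = deletePart (suc i ℕ.+ suc j) ρ

    ∂X-large : ∀ {ρ} → PartsIn n ρ → ∀ {k} → n < k → ∀ (β : Exps) → ∂X k ρ β ≈ 0#
    ∂X-large {ρ} ρ≤n {k} n<k = ∂X-absent {ρ = ρ} (go ρ≤n)
      where
      go : ∀ {σ} → PartsIn n σ → count k σ ≡ 0
      go [] = ≡.refl
      go {r ∷ σ} ((_ , r≤n) ∷ σ≤n) = ≡.trans (count-there σ λ { ≡.refl → ℕ.<⇒≱ n<k r≤n }) (go σ≤n)

    -- x_l^i x_l^j depends on i + j alone, so counting antidiagonals gives the x_l part of Σ (k - 1)
    -- p_k D_k. It later completes the factor α - 1 of that sum to α.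
    G-diagonal : ∀ {ρ} → PartsIn n ρ → ∀ l β → G l l ρ β ≈ ∑ (upTo n) λ k → ι k * x^ l (suc k) (∂X (suc k) ρ) β
    G-diagonal {ρ} ρ≤n l β = trans
      (∑-cong (upTo n) λ i → ∑-cong (upTo n) λ j → reflexive (≡.cong (λ u → u β) (≡.sym (x^-x^ l (suc i) (suc j) _))))
      (∑-antidiagonals n (λ k → x^ l k (∂X k ρ) β) λ k n<k → x^-0 l k (∂X-large {ρ} ρ≤n n<k) β)

    G-comm : ∀ l m ρ β → G l m ρ β ≈ G m l ρ β
    G-comm l m ρ β = trans (∑-swap (upTo n) (upTo n) _) (∑-cong (upTo n) λ j → ∑-cong (upTo n) λ i →
      trans (x^-comm l (suc i) m (suc j) _ β)
        (reflexive (≡.cong (λ k → x^ m (suc j) (x^ l (suc i) (∂X k ρ)) β) (ℕ.+-comm (suc i) (suc j)))))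

    -- (x_l − x_m) Σ_{a+b=k} x_l^a x_m^b telescopes; both sides are moved so that no subtraction occurs.
    G-relation : ∀ {ρ} → PartsIn n ρ → ∀ l m β →
      x l (G l m ρ) β + x l (θ m (X ρ)) β ≈ x m (G l m ρ) β + x m (θ l (X ρ)) β
    G-relation {ρ} ρ≤n l m β = trans left (sym right)
      where
      h : ℕ → ℕ → Carrier
      h i j = x^ l (suc i) (x^ m (suc j) (∂X (i ℕ.+ suc j) ρ)) β
      edge : ∀ {k} i j → n < k → x^ l (suc i) (x^ m (suc j) (∂X k ρ)) β ≈ 0#
      edge i j n<k = x^-0 l (suc i) (x^-0 m (suc j) (∂X-large {ρ} ρ≤n n<k)) β

      W : ℕ → ℕ → Fun
      W i j = x^ l (suc i) (x^ m (suc j) (∂X (suc i ℕ.+ suc j) ρ))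
      x-G : ∀ k → x k (G l m ρ) β ≈ ∑ (upTo n) λ i → ∑ (upTo n) λ j → x k (W i j) β
      x-G k = trans (x-∑ k (upTo n) (λ i γ → ∑ (upTo n) λ j → W i j γ) β)
                    (∑-cong (upTo n) λ i → x-∑ k (upTo n) (W i) β)

      left : x l (G l m ρ) β + x l (θ m (X ρ)) β ≈ ∑ (upTo n) (λ i → ∑ (upTo n) (h i))
      left = trans (+-cong
        (x-G l)
        (trans (x-cong l (θ-X ρ≤n m) β) (x-∑ l (upTo n) (λ k → x^ m (suc k) (∂X (suc k) ρ)) β)))
        (∑-shift-square n h λ j → edge n j (ℕ.m<m+n n (s≤s z≤n)))

      right : x m (G l m ρ) β + x m (θ l (X ρ)) β ≈ ∑ (upTo n) (λ i → ∑ (upTo n) (h i))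
      right = begin
        x m (G l m ρ) β + x m (θ l (X ρ)) β
          ≈⟨ +-cong
               (trans (x-G m) (trans (∑-cong (upTo n) λ i → ∑-cong (upTo n) (shifted i)) (∑-swap (upTo n) (upTo n) _)))
               (trans (x-cong m (θ-X ρ≤n l) β) (trans (x-∑ m (upTo n) (λ k → x^ l (suc k) (∂X (suc k) ρ)) β) (∑-cong (upTo n) first))) ⟩
        ∑ (upTo n) (λ j → ∑ (upTo n) (λ i → h i (suc j))) + ∑ (upTo n) (λ i → h i 0)
          ≈⟨ ∑-shift-square n (λ j i → h i j) (λ i → edge i n (ℕ.m≤n+m (suc n) i)) ⟩
        ∑ (upTo n) (λ j → ∑ (upTo n) (λ i → h i j))
          ≈⟨ ∑-swap (upTo n) (upTo n) _ ⟩
        ∑ (upTo n) (λ i → ∑ (upTo n) (h i)) ∎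
        where
        shifted : ∀ i j → x m (x^ l (suc i) (x^ m (suc j) (∂X (suc i ℕ.+ suc j) ρ))) β ≈ h i (suc j)
        shifted i j = trans (x-x^-comm m l (suc i) (x^ m (suc j) (∂X (suc i ℕ.+ suc j) ρ)) β)
          (reflexive (≡.cong (λ k → x^ l (suc i) (x^ m (suc (suc j)) (∂X k ρ)) β) (≡.sym (ℕ.+-suc i (suc j)))))
        first : ∀ i → x m (x^ l (suc i) (∂X (suc i) ρ)) β ≈ h i 0
        first i = trans (x-x^-comm m l (suc i) (∂X (suc i) ρ) β)
          (reflexive (≡.cong (λ k → x^ l (suc i) (x m (∂X k ρ)) β) (≡.sym (ℕ.+-comm i 1))))

    G-at-0 : ∀ l m ρ β → lookup β l ≡ 0 → G l m ρ β ≈ 0#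
    G-at-0 l m ρ β βl≡0 = ∑-0 (upTo n) λ i → ∑-0 (upTo n) λ j → reflexive (x-at-0 l (x^ l i (x^ m (suc j) (∂X (suc i ℕ.+ suc j) ρ))) β βl≡0)

  -- The relation is a recursion in the exponent of x_l; the only other coefficients of F that enter belong
  -- to exponents with a larger sum of squares.
  off-diagonal : ∀ {N} {l m : Fin N} → l ≢ m → (F G : Vec ℕ N → Carrier) →
    (∀ β → x l G β + x l (θ m F) β ≈ x m G β + x m (θ l F) β) → (∀ β → lookup β l ≡ 0 → G β ≈ 0#) →
    ∀ a β → lookup β l ≡ a → a ≤ lookup β m → (∀ γ → sumSq (toList β) < sumSq (toList γ) → F γ ≈ 0#) →
    G β + ι a * F β ≈ 0#
  off-diagonal l≢m F G rel G-0 zero β βl≡0 _ _ = trans (+-cong (G-0 β βl≡0) (trans (*-congʳ ι-zero) (zeroˡ (F β)))) (+-identityˡ 0#)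
  off-diagonal {N} {l} {m} l≢m F G rel G-0 (suc a) β βl a<b F-0 = begin
    G β + ι (suc a) * F β                              ≈⟨ +-cong xmG xmθF ⟨
    x m G γ + x m (θ l F) γ                            ≈⟨ rel γ ⟨
    x l G γ + x l (θ m F) γ                            ≈⟨ +-cong xlG xlθF ⟩
    G β⁻ + ι (lookup β⁻ m) * F β⁻                      ≈⟨ +-cong Gβ⁻≈0 (trans (*-congˡ Fβ⁻≈0) (zeroʳ _)) ⟩
    0# + 0#                                            ≈⟨ +-identityˡ 0# ⟩
    0#                                                 ∎
    where
    b = lookup β m
    γ β⁻ : Vec ℕ N
    γ = β [ m ]≔ suc b
    β⁻ = β [ l ]≔ a [ m ]≔ suc b
    γm : lookup γ m ≡ suc b
    γm = Vec.lookup∘update m β (suc b)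
    γl : lookup γ l ≡ suc a
    γl = ≡.trans (Vec.lookup∘update′ l≢m β (suc b)) βl
    γ-m : γ [ m ]≔ b ≡ β
    γ-m = ≡.trans (Vec.[]≔-idempotent β m) (Vec.[]≔-lookup β m)
    γ-l : γ [ l ]≔ a ≡ β⁻
    γ-l = Vec.[]≔-commutes β m l (l≢m ∘ ≡.sym)
    at-m : ∀ u → x m u γ ≈ u β
    at-m u = reflexive (≡.trans (x-at m u γ γm) (≡.cong u γ-m))
    at-l : ∀ u → x l u γ ≈ u β⁻
    at-l u = reflexive (≡.trans (x-at l u γ γl) (≡.cong u γ-l))
    xmG = at-m G
    xlG = at-l G
    xmθF : x m (θ l F) γ ≈ ι (suc a) * F β
    xmθF = trans (at-m (θ l F)) (*-congʳ (ι-cong βl))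
    xlθF = at-l (θ m F)
    less : sumSq (toList β) < sumSq (toList β⁻)
    less = sumSq-spread β l≢m βl a<b
    Fβ⁻≈0 : F β⁻ ≈ 0#
    Fβ⁻≈0 = F-0 β⁻ less
    Gβ⁻≈0 : G β⁻ ≈ 0#
    Gβ⁻≈0 = begin
      G β⁻                  ≈⟨ +-identityʳ _ ⟨
      G β⁻ + 0#             ≈⟨ +-congˡ (trans (*-congˡ Fβ⁻≈0) (zeroʳ (ι a))) ⟨
      G β⁻ + ι a * F β⁻     ≈⟨ off-diagonal l≢m F G rel G-0 a β⁻
                                 (≡.trans (Vec.lookup∘update′ l≢m (β [ l ]≔ a) (suc b)) (Vec.lookup∘update l β a))
                                 (ℕ.≤-trans (ℕ.≤-trans (ℕ.n≤1+n a) (ℕ.≤-trans a<b (ℕ.n≤1+n b)))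
                                   (ℕ.≤-reflexive (≡.sym (Vec.lookup∘update m (β [ l ]≔ a) (suc b)))))
                                 (λ δ lt → F-0 δ (ℕ.<-trans less lt)) ⟩
      0#                    ∎

  -- The sum runs over ordered pairs of distinct positions; for a partition λ it equals 2 Σ (i - 1)
  -- λᵢ.
  minSum : ∀ {N} → Vec ℕ N → Carrier
  minSum {N} β = ∑ (allFin N) λ l → ∑ (allFin N) λ m → if does (m Fin.≟ l) then 0# else ι (lookup β l ⊓ lookup β m)

  module _ {N : ℕ} (n : ℕ) (f : Lin Partition) (f≤n : All (λ (_ , ν) → PartsIn n (parts ν)) f) where

    private
      Fun = Vec ℕ N → Carrier

      over : (List ℕ → Fun) → Fun
      over u β = extend (λ ν → u (parts ν) β) f

      x-over : ∀ i u β → x i (over u) β ≈ over (λ ρ → x i (u ρ)) β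
      x-over i u β with lookup β i
      ... | zero  = sym (extend-0 f λ _ → refl)
      ... | suc b = refl

      θ-over : ∀ i u β → θ i (over u) β ≈ over (λ ρ → θ i (u ρ)) β
      θ-over i u β = sym (extend-*ˡ (λ ν → u (parts ν) β) (ι (lookup β i)) f)

      over-+ : ∀ u v β → over (λ ρ γ → u ρ γ + v ρ γ) β ≈ over u β + over v β
      over-+ u v β = extend-+ (λ ν → u (parts ν) β) (λ ν → v (parts ν) β) f

      F : Fun
      F = over X

      over-G-relation : ∀ l m β → x l (over (G n l m)) β + x l (θ m F) β ≈ x m (over (G n l m)) β + x m (θ l F) β
      over-G-relation l m β = begin
        x l (over (G n l m)) β + x l (θ m F) β
          ≈⟨ +-cong (x-over l (G n l m) β) (trans (x-cong l (θ-over m X) β) (x-over l (λ ρ → θ m (X ρ)) β)) ⟩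
        over (λ ρ → x l (G n l m ρ)) β + over (λ ρ → x l (θ m (X ρ))) β
          ≈⟨ over-+ (λ ρ → x l (G n l m ρ)) (λ ρ → x l (θ m (X ρ))) β ⟨
        over (λ ρ γ → x l (G n l m ρ) γ + x l (θ m (X ρ)) γ) β
          ≈⟨ extend-cong-All (All.map (λ ρ≤n → G-relation n ρ≤n l m β) f≤n) ⟩
        over (λ ρ γ → x m (G n l m ρ) γ + x m (θ l (X ρ)) γ) β
          ≈⟨ over-+ (λ ρ → x m (G n l m ρ)) (λ ρ → x m (θ l (X ρ))) β ⟩
        over (λ ρ → x m (G n l m ρ)) β + over (λ ρ → x m (θ l (X ρ))) β
          ≈⟨ +-cong (x-over m (G n l m) β) (trans (x-cong m (θ-over l X) β) (x-over m (λ ρ → θ l (X ρ)) β)) ⟨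
        x m (over (G n l m)) β + x m (θ l F) β ∎

      -- `off-diagonal` recurses on the smaller of the two exponents; the symmetry of G in l and m
      -- covers the other order.
      G-min : ∀ {l m} → l ≢ m → ∀ β → (∀ γ → sumSq (toList β) < sumSq (toList γ) → F γ ≈ 0#) →
              over (G n l m) β + ι (lookup β l ⊓ lookup β m) * F β ≈ 0#
      G-min {l} {m} l≢m β F-0 with ℕ.≤-total (lookup β l) (lookup β m)
      ... | inj₁ le = trans (+-congˡ (*-congʳ (ι-cong (ℕ.m≤n⇒m⊓n≡m le))))
        (off-diagonal l≢m F (over (G n l m)) (over-G-relation l m) (λ γ γl≡0 → extend-0 f λ ν → G-at-0 n l m (parts ν) γ γl≡0)
          (lookup β l) β ≡.refl le F-0)
      ... | inj₂ ge = trans (+-cong (extend-cong f λ ν → G-comm n l m (parts ν) β) (*-congʳ (ι-cong (ℕ.m≥n⇒m⊓n≡n ge))))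
        (off-diagonal (l≢m ∘ ≡.sym) F (over (G n m l)) (over-G-relation m l) (λ γ γm≡0 → extend-0 f λ ν → G-at-0 n m l (parts ν) γ γm≡0)
          (lookup β m) β ≡.refl ge F-0)

    -- γ is α - 1. The diagonal G_ll add one copy of `XN` to these γ copies, the off-diagonal G_lm
    -- contribute -min, and α (`XA` + `XN`) is α Σ (θ² - θ). All negative terms are moved across the
    -- equation.
    triangular-action : ∀ γ → γ + 1# ≈ α → ∀ β → (∀ δ → sumSq (toList β) < sumSq (toList δ) → over X δ ≈ 0#) →
      (α * over (XA n) β + over (XB n) β + γ * over (XN n) β) + (minSum β + α * ∑ (allFin N) (λ l → ι (lookup β l))) * over X β ≈
      α * ∑ (allFin N) (λ l → ι (lookup β l) * ι (lookup β l)) * over X β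
    triangular-action γ γ+1≈α β F-0 = begin
      (α * a + b + γ * c) + (minSum β + α * s) * v
        ≈⟨ solve 8 (λ α a b γ c k s v → (α :* a :+ b :+ γ :* c) :+ (k :+ α :* s) :* v :=
             α :* a :+ (b :+ k :* v) :+ γ :* c :+ α :* (s :* v)) refl α a b γ c (minSum β) s v ⟩
      α * a + (b + minSum β * v) + γ * c + α * (s * v)
        ≈⟨ +-congʳ (+-congʳ (+-congˡ B+min)) ⟩
      α * a + c + γ * c + α * (s * v)
        ≈⟨ solve 6 (λ α a γ c s v → α :* a :+ c :+ γ :* c :+ α :* (s :* v) :=
             α :* a :+ (γ :+ con 1) :* c :+ α :* (s :* v)) refl α a γ c s v ⟩
      α * a + (γ + 1#) * c + α * (s * v)
        ≈⟨ +-congʳ (+-congˡ (*-congʳ γ+1≈α)) ⟩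
      α * a + α * c + α * (s * v)
        ≈⟨ solve 4 (λ α a c t → α :* a :+ α :* c :+ α :* t := α :* (a :+ (c :+ t))) refl α a c (s * v) ⟩
      α * (a + (c + s * v))
        ≈⟨ *-congˡ A+N ⟩
      α * (q * v)
        ≈⟨ *-assoc α q v ⟨
      α * q * v ∎
      where
      a = over (XA n) β
      b = over (XB n) β
      c = over (XN n) β
      v = over X β
      s = ∑ (allFin N) (λ l → ι (lookup β l))
      q = ∑ (allFin N) (λ l → ι (lookup β l) * ι (lookup β l))
      E : List ℕ → Fun
      E ρ γ = ∑ (allFin N) λ l → θ l (X ρ) γ
      A+N : a + (c + s * v) ≈ q * v
      A+N = begin
        a + (c + s * v)
          ≈⟨ +-congˡ (+-congˡ (trans (sym (∑-*ʳ (allFin N) _ v)) (trans (∑-cong (allFin N) λ l → θ-over l X β) (sym (extend-∑ (allFin N) _ f))))) ⟩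
        a + (c + over (λ ρ γ → ∑ (allFin N) λ l → θ l (X ρ) γ) β)
          ≈⟨ trans (+-congˡ (sym (over-+ (XN n) E β))) (sym (over-+ (XA n) (λ ρ γ → XN n ρ γ + E ρ γ) β)) ⟩
        over (λ ρ γ → XA n ρ γ + (XN n ρ γ + ∑ (allFin N) λ l → θ l (X ρ) γ)) β
          ≈⟨ extend-cong-All (All.map (λ ρ≤n → XA-identity n ρ≤n β) f≤n) ⟩
        over (λ ρ γ → ∑ (allFin N) λ l → θ l (θ l (X ρ)) γ) β
          ≈⟨ extend-∑ (allFin N) _ f ⟩
        ∑ (allFin N) (λ l → over (λ ρ → θ l (θ l (X ρ))) β)
          ≈⟨ ∑-cong (allFin N) (λ l → trans (sym (θ-over l (λ ρ → θ l (X ρ)) β)) (trans (*-congˡ (sym (θ-over l X β))) (sym (*-assoc _ _ v)))) ⟩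
        ∑ (allFin N) (λ l → ι (lookup β l) * ι (lookup β l) * v)
          ≈⟨ ∑-*ʳ (allFin N) _ v ⟩
        q * v ∎
      B+min : b + minSum β * v ≈ c
      B+min = begin
        b + minSum β * v
          ≈⟨ +-cong (trans (extend-cong f λ ν → XB-G n (parts ν) β) (trans (extend-∑ (allFin N) _ f) (∑-cong (allFin N) λ l → extend-∑ (allFin N) _ f)))
                    (trans (sym (∑-*ʳ (allFin N) _ v)) (∑-cong (allFin N) λ l → sym (∑-*ʳ (allFin N) _ v))) ⟩
        ∑ (allFin N) (λ l → ∑ (allFin N) λ m → over (G n l m) β) +
        ∑ (allFin N) (λ l → ∑ (allFin N) λ m → (if does (m Fin.≟ l) then 0# else ι (lookup β l ⊓ lookup β m)) * v)
          ≈⟨ trans (sym (∑-+ (allFin N) _ _)) (∑-cong (allFin N) λ l → sym (∑-+ (allFin N) _ _)) ⟩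
        ∑ (allFin N) (λ l → ∑ (allFin N) λ m → over (G n l m) β + (if does (m Fin.≟ l) then 0# else ι (lookup β l ⊓ lookup β m)) * v)
          ≈⟨ ∑-cong (allFin N) (λ l → trans (∑-cong (allFin N) λ m → cancel l m)
               (∑-select Fin._≟_ (λ m → over (G n l m) β) (allFin⁺ N) (∈-allFin l))) ⟩
        ∑ (allFin N) (λ l → over (G n l l) β)
          ≈⟨ extend-∑ (allFin N) _ f ⟨
        over (λ ρ γ → ∑ (allFin N) λ l → G n l l ρ γ) β
          ≈⟨ extend-cong-All (All.map (λ {(_ , ν)} ρ≤n → trans (∑-cong (allFin N) λ l → G-diagonal n ρ≤n l β) (sym (XN-x^ n (parts ν) β))) f≤n) ⟩
        c ∎
        where
        cancel : ∀ l m → over (G n l m) β + (if does (m Fin.≟ l) then 0# else ι (lookup β l ⊓ lookup β m)) * v ≈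
                         indicator (does (m Fin.≟ l)) (over (G n l m) β)
        cancel l m with m Fin.≟ l
        ... | yes _  = trans (+-congˡ (zeroˡ v)) (+-identityʳ _)
        ... | no m≢l = G-min (m≢l ∘ ≡.sym) β F-0

-- The operators L and L* and their adjoints

module Operators (S : Scalars) where
  open LaplaceBeltrami S public
  open import Relation.Binary.Reasoning.Setoid setoid
  open import Algebra.Solver.Ring.NaturalCoefficients.Default commutativeSemiring using (solve; _:=_; _:+_; _:*_; con)

  infixr 7 _⊛_ _⊗_

  Λ : Set
  Λ = Lin Partition

  p[_] : Partition → Λ
  p[ ν ] = [ (1# , ν) ]

  p : (k : ℕ) .{{_ : NonZero k}} → Λ
  p k = p[ ⟦ k ⟧ ]

  _⊛_ : Λ → Λ → Λ
  f ⊛ g = linear (λ μ → linear (λ ν → p[ μ ∪ ν ]) g) f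

  _⊗_ : Λ → Λ → Lin (Partition × Partition)
  f ⊗ g = linear (λ μ → linear (λ ν → [ (1# , μ , ν) ]) g) f

  D : ℕ → Λ → Λ
  D k = linear (λ ν → [ (ι (k ℕ.* mult k ν) , ν ∖ k) ])

  -- The cutoff n is a parameter, whereas `∑≥1` takes it from the degree of its argument; with n
  -- fixed the operators are linear.
  opA opB opN L L* : ℕ → Λ → Λ
  opA n f = concatMap (λ i → concatMap (λ j → p (suc i ℕ.+ suc j) ⊛ D (suc i) (D (suc j) f)) (upTo n)) (upTo n)
  opB n f = concatMap (λ i → concatMap (λ j → p (suc i) ⊛ p (suc j) ⊛ D (suc i ℕ.+ suc j) f) (upTo n)) (upTo n)
  opN n f = concatMap (λ k → ι k · (p (suc k) ⊛ D (suc k) f)) (upTo n)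
  L  n f = (α · opA n f ++ opB n f) ++ (α ⊖ 1#) · opN n f
  L* n f = (α · opB n f ++ opA n f) ++ (α ⊖ 1#) · opN n f

  extend-p[] : ∀ φ ν → extend φ p[ ν ] ≈ φ ν
  extend-p[] φ ν = trans (extend-single φ 1# ν) (*-identityˡ (φ ν))

  extend-⊛ : ∀ φ k .{{_ : NonZero k}} f → extend φ (p k ⊛ f) ≈ extend (λ ν → φ (⟦ k ⟧ ∪ ν)) f
  extend-⊛ φ k f = begin
    extend φ (p k ⊛ f)
      ≈⟨ extend-linear φ (λ μ → linear (λ ν → p[ μ ∪ ν ]) f) (p k) ⟩
    extend (λ μ → extend φ (linear (λ ν → p[ μ ∪ ν ]) f)) (p k)
      ≈⟨ extend-p[] (λ μ → extend φ (linear (λ ν → p[ μ ∪ ν ]) f)) ⟦ k ⟧ ⟩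
    extend φ (linear (λ ν → p[ ⟦ k ⟧ ∪ ν ]) f)
      ≈⟨ extend-linear φ (λ ν → p[ ⟦ k ⟧ ∪ ν ]) f ⟩
    extend (λ ν → extend φ p[ ⟦ k ⟧ ∪ ν ]) f
      ≈⟨ extend-cong f (λ ν → extend-p[] φ (⟦ k ⟧ ∪ ν)) ⟩
    extend (λ ν → φ (⟦ k ⟧ ∪ ν)) f ∎

  extend-⊗ : ∀ φ f g → extend φ (f ⊗ g) ≈ extend (λ μ → extend (λ ν → φ (μ , ν)) g) f
  extend-⊗ φ f g = trans (extend-linear φ (λ μ → linear (λ ν → [ (1# , μ , ν) ]) g) f)
    (extend-cong f λ μ → trans (extend-linear φ (λ ν → [ (1# , μ , ν) ]) g)
    (extend-cong g λ ν → trans (extend-single φ 1# (μ , ν)) (*-identityˡ _)))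

  extend-D : ∀ φ k f → extend φ (D k f) ≈ extend (λ ν → ι (k ℕ.* mult k ν) * φ (ν ∖ k)) f
  extend-D φ k f = trans (extend-linear φ (λ ν → [ (ι (k ℕ.* mult k ν) , ν ∖ k) ]) f)
    (extend-cong f λ ν → extend-single φ _ (ν ∖ k))

  -- Transposes of `opA`, `opB` and `opN` on functionals of monomials. Choosing φ as a coefficient
  -- of p_κ or of x^β lets one computation serve both the degree argument and the triangularity.
  dualA dualB dualN : ℕ → (Partition → Carrier) → Partition → Carrier
  dualA n φ ν = ∑ (upTo n) λ i → ∑ (upTo n) λ j → ι (suc j ℕ.* mult (suc j) ν) *
    (ι (suc i ℕ.* mult (suc i) (ν ∖ suc j)) * φ (⟦ suc i ℕ.+ suc j ⟧ ∪ ((ν ∖ suc j) ∖ suc i)))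
  dualB n φ ν = ∑ (upTo n) λ i → ∑ (upTo n) λ j → ι ((suc i ℕ.+ suc j) ℕ.* mult (suc i ℕ.+ suc j) ν) *
    φ (⟦ suc i ⟧ ∪ (⟦ suc j ⟧ ∪ (ν ∖ (suc i ℕ.+ suc j))))
  dualN n φ ν = ∑ (upTo n) λ k → ι k * (ι (suc k ℕ.* mult (suc k) ν) * φ (⟦ suc k ⟧ ∪ (ν ∖ suc k)))

  extend-opA : ∀ n φ f → extend φ (opA n f) ≈ extend (dualA n φ) f
  extend-opA n φ f = begin
    extend φ (opA n f)
      ≈⟨ trans (extend-concatMap φ _ (upTo n)) (∑-cong (upTo n) λ i → extend-concatMap φ _ (upTo n)) ⟩
    ∑ (upTo n) (λ i → ∑ (upTo n) λ j → extend φ (p (suc i ℕ.+ suc j) ⊛ D (suc i) (D (suc j) f)))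
      ≈⟨ ∑-cong (upTo n) (λ i → ∑-cong (upTo n) λ j →
           trans (extend-⊛ φ (suc i ℕ.+ suc j) (D (suc i) (D (suc j) f)))
             (trans (extend-D _ (suc i) (D (suc j) f)) (extend-D _ (suc j) f))) ⟩
    ∑ (upTo n) (λ i → ∑ (upTo n) λ j → extend (λ ν → ι (suc j ℕ.* mult (suc j) ν) *
      (ι (suc i ℕ.* mult (suc i) (ν ∖ suc j)) * φ (⟦ suc i ℕ.+ suc j ⟧ ∪ ((ν ∖ suc j) ∖ suc i)))) f)
      ≈⟨ trans (extend-∑ (upTo n) _ f) (∑-cong (upTo n) λ i → extend-∑ (upTo n) _ f) ⟨
    extend (dualA n φ) f ∎

  extend-opB : ∀ n φ f → extend φ (opB n f) ≈ extend (dualB n φ) f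
  extend-opB n φ f = begin
    extend φ (opB n f)
      ≈⟨ trans (extend-concatMap φ _ (upTo n)) (∑-cong (upTo n) λ i → extend-concatMap φ _ (upTo n)) ⟩
    ∑ (upTo n) (λ i → ∑ (upTo n) λ j → extend φ (p (suc i) ⊛ p (suc j) ⊛ D (suc i ℕ.+ suc j) f))
      ≈⟨ ∑-cong (upTo n) (λ i → ∑-cong (upTo n) λ j →
           trans (extend-⊛ φ (suc i) (p (suc j) ⊛ D (suc i ℕ.+ suc j) f))
             (trans (extend-⊛ _ (suc j) (D (suc i ℕ.+ suc j) f)) (extend-D _ (suc i ℕ.+ suc j) f))) ⟩
    ∑ (upTo n) (λ i → ∑ (upTo n) λ j → extend (λ ν → ι ((suc i ℕ.+ suc j) ℕ.* mult (suc i ℕ.+ suc j) ν) *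
      φ (⟦ suc i ⟧ ∪ (⟦ suc j ⟧ ∪ (ν ∖ (suc i ℕ.+ suc j))))) f)
      ≈⟨ trans (extend-∑ (upTo n) _ f) (∑-cong (upTo n) λ i → extend-∑ (upTo n) _ f) ⟨
    extend (dualB n φ) f ∎

  extend-opN : ∀ n φ f → extend φ (opN n f) ≈ extend (dualN n φ) f
  extend-opN n φ f = begin
    extend φ (opN n f)
      ≈⟨ extend-concatMap φ _ (upTo n) ⟩
    ∑ (upTo n) (λ k → extend φ (ι k · (p (suc k) ⊛ D (suc k) f)))
      ≈⟨ ∑-cong (upTo n) (λ k → trans (extend-· φ (ι k) (p (suc k) ⊛ D (suc k) f))
           (trans (*-congˡ (trans (extend-⊛ φ (suc k) (D (suc k) f)) (extend-D _ (suc k) f))) (sym (extend-*ˡ _ (ι k) f)))) ⟩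
    ∑ (upTo n) (λ k → extend (λ ν → ι k * (ι (suc k ℕ.* mult (suc k) ν) * φ (⟦ suc k ⟧ ∪ (ν ∖ suc k)))) f)
      ≈⟨ extend-∑ (upTo n) _ f ⟨
    extend (dualN n φ) f ∎

  extend-sum : ∀ (φ : Partition → Carrier) c d f g h → extend φ ((c · f ++ g) ++ d · h) ≈ c * extend φ f + extend φ g + d * extend φ h
  extend-sum φ c d f g h = trans (extend-++ φ (c · f ++ g) (d · h))
    (+-cong (trans (extend-++ φ (c · f) g) (+-congʳ (extend-· φ c f))) (extend-· φ d h))

  extend-L : ∀ n φ f → extend φ (L n f) ≈ α * extend (dualA n φ) f + extend (dualB n φ) f + (α ⊖ 1#) * extend (dualN n φ) f
  extend-L n φ f = trans (extend-sum φ α (α ⊖ 1#) (opA n f) (opB n f) (opN n f))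
    (+-cong (+-cong (*-congˡ (extend-opA n φ f)) (extend-opB n φ f)) (*-congˡ (extend-opN n φ f)))

  extend-L* : ∀ n φ f → extend φ (L* n f) ≈ α * extend (dualB n φ) f + extend (dualA n φ) f + (α ⊖ 1#) * extend (dualN n φ) f
  extend-L* n φ f = trans (extend-sum φ α (α ⊖ 1#) (opB n f) (opA n f) (opN n f))
    (+-cong (+-cong (*-congˡ (extend-opB n φ f)) (extend-opA n φ f)) (*-congˡ (extend-opN n φ f)))

  -- Degrees

  -- `ν ∖ k` is ν itself when k is not a part, but then the coefficient of D_k vanishes. Claims
  -- about `ν ∖ k` thus need proof only when k occurs.
  mult-guard : ∀ k ν {y} → (mult k ν ≢ 0 → y ≈ 0#) → ι (k ℕ.* mult k ν) * y ≈ 0#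
  mult-guard k ν {y} y≈0 with mult k ν ℕ.≟ 0
  ... | yes eq = trans (*-congʳ (trans (ι-cong (≡.trans (≡.cong (k ℕ.*_) eq) (ℕ.*-zeroʳ k))) ι-zero)) (zeroˡ y)
  ... | no neq = trans (*-congˡ (y≈0 neq)) (zeroʳ _)

  Degree : ℕ → Λ → Set
  Degree n = All (λ (_ , ν) → ∣ ν ∣ ≡ n)

  -- Weaker than `Degree`, which constrains every listed term: deleting an absent part lists terms
  -- of the wrong degree with coefficient zero.
  Homogeneous : ℕ → Λ → Set
  Homogeneous n f = ∀ κ → ∣ κ ∣ ≢ n → coeff f κ ≈ 0#

  degree⇒homogeneous : ∀ {n f} → Degree n f → Homogeneous n f
  degree⇒homogeneous f-deg κ = coeff-All {b = κ} f-deg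

  homogeneous-++ : ∀ {n f g} → Homogeneous n f → Homogeneous n g → Homogeneous n (f ++ g)
  homogeneous-++ {f = f} {g} hf hg κ ≢n = trans (extend-++ (δ κ) f g) (trans (+-cong (hf κ ≢n) (hg κ ≢n)) (+-identityˡ 0#))

  homogeneous-· : ∀ {n} c {f} → Homogeneous n f → Homogeneous n (c · f)
  homogeneous-· c {f} hf κ ≢n = trans (extend-· (δ κ) c f) (trans (*-congˡ (hf κ ≢n)) (zeroʳ c))

  module _ {n : ℕ} {φ : Partition → Carrier} (φ-0 : ∀ ν → ∣ ν ∣ ≡ n → φ ν ≈ 0#) (ν : Partition) (∣ν∣≡n : ∣ ν ∣ ≡ n) where

    dualA-degree : ∀ m → dualA m φ ν ≈ 0#
    dualA-degree m = ∑-0 (upTo m) λ i → ∑-0 (upTo m) λ j →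
      mult-guard (suc j) ν λ j∈ → mult-guard (suc i) (ν ∖ suc j) λ i∈ → φ-0 _
        (≡.trans (∣k∪∣ (suc i ℕ.+ suc j) ((ν ∖ suc j) ∖ suc i)) (≡.trans (shuffle (suc i) (suc j) _)
          (≡.trans (≡.cong (suc j ℕ.+_) (∣∖∣ (suc i) (ν ∖ suc j) i∈)) (≡.trans (∣∖∣ (suc j) ν j∈) ∣ν∣≡n))))
      where
      shuffle : ∀ a b c → a ℕ.+ b ℕ.+ c ≡ b ℕ.+ (a ℕ.+ c)
      shuffle = solve-∀

    dualB-degree : ∀ m → dualB m φ ν ≈ 0#
    dualB-degree m = ∑-0 (upTo m) λ i → ∑-0 (upTo m) λ j →
      mult-guard (suc i ℕ.+ suc j) ν λ k∈ → φ-0 _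
        (≡.trans (∣k∪∣ (suc i) (⟦ suc j ⟧ ∪ (ν ∖ (suc i ℕ.+ suc j)))) (≡.trans (≡.cong (suc i ℕ.+_) (∣k∪∣ (suc j) (ν ∖ (suc i ℕ.+ suc j))))
          (≡.trans (≡.sym (ℕ.+-assoc (suc i) (suc j) _)) (≡.trans (∣∖∣ (suc i ℕ.+ suc j) ν k∈) ∣ν∣≡n))))

    dualN-degree : ∀ m → dualN m φ ν ≈ 0#
    dualN-degree m = ∑-0 (upTo m) λ k → trans (*-congˡ (mult-guard (suc k) ν λ k∈ → φ-0 _
      (≡.trans (∣k∪∣ (suc k) (ν ∖ suc k)) (≡.trans (∣∖∣ (suc k) ν k∈) ∣ν∣≡n)))) (zeroʳ (ι k))

  private
    all-zero : ∀ c d {x y z} → x ≈ 0# → y ≈ 0# → z ≈ 0# → c * x + y + d * z ≈ 0#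
    all-zero c d x≈0 y≈0 z≈0 = trans (+-cong (trans (+-cong (trans (*-congˡ x≈0) (zeroʳ c)) y≈0) (+-identityˡ 0#))
      (trans (*-congˡ z≈0) (zeroʳ d))) (+-identityˡ 0#)

    extend-degree-0 : ∀ {n} {φ : Partition → Carrier} {f} → Degree n f → (∀ ν → ∣ ν ∣ ≡ n → φ ν ≈ 0#) → extend φ f ≈ 0#
    extend-degree-0 {f = f} f-deg φ-0 = trans (extend-cong-All (All.map (φ-0 _) f-deg)) (extend-0 f λ _ → refl)

  L-homogeneous : ∀ {n f} m → Degree n f → Homogeneous n (L m f)
  L-homogeneous {n} {f} m f-deg κ ∣κ∣≢n = trans (extend-L m (δ κ) f)
    (all-zero α (α ⊖ 1#) (extend-degree-0 f-deg λ ν e → dualA-degree δ-0 ν e m)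
      (extend-degree-0 f-deg λ ν e → dualB-degree δ-0 ν e m) (extend-degree-0 f-deg λ ν e → dualN-degree δ-0 ν e m))
    where
    δ-0 : ∀ ν → ∣ ν ∣ ≡ n → δ κ ν ≈ 0#
    δ-0 ν eq = δ-≢ {a = κ} {b = ν} λ { ≡.refl → ∣κ∣≢n eq }

  L*-homogeneous : ∀ {n f} m → Degree n f → Homogeneous n (L* m f)
  L*-homogeneous {n} {f} m f-deg κ ∣κ∣≢n = trans (extend-L* m (δ κ) f)
    (all-zero α (α ⊖ 1#) (extend-degree-0 f-deg λ ν e → dualB-degree δ-0 ν e m)
      (extend-degree-0 f-deg λ ν e → dualA-degree δ-0 ν e m) (extend-degree-0 f-deg λ ν e → dualN-degree δ-0 ν e m))
    where
    δ-0 : ∀ ν → ∣ ν ∣ ≡ n → δ κ ν ≈ 0#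
    δ-0 ν eq = δ-≢ {a = κ} {b = ν} λ { ≡.refl → ∣κ∣≢n eq }

  -- Scalar products

  pairing : (Partition → Carrier) → Λ → Λ → Carrier
  pairing w f g = extend (λ μ → extend (λ ν → δ μ ν * w ν) g) f

  pairing-coeff : ∀ w f g → pairing w f g ≈ extend (λ μ → coeff g μ * w μ) f
  pairing-coeff w f g = extend-cong f λ μ → trans (extend-cong g λ ν → δ-* w μ ν) (extend-*ʳ (δ μ) (w μ) g)

  pairing-sym : ∀ w f g → pairing w f g ≈ pairing w g f
  pairing-sym w f g = trans (extend-swap (λ μ ν → δ μ ν * w ν) f g)
    (extend-cong g λ ν → extend-cong f λ μ → trans (*-congʳ (δ-sym μ ν)) (sym (δ-* w ν μ)))

  pairing-p[] : ∀ w f κ → pairing w f p[ κ ] ≈ coeff f κ * w κ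
  pairing-p[] w f κ = trans (pairing-sym w f p[ κ ]) (trans (pairing-coeff w p[ κ ] f) (extend-p[] (λ μ → coeff f μ * w μ) κ))

  pairing-congˡ : ∀ w {f g} h → f ≐ g → pairing w f h ≈ pairing w g h
  pairing-congˡ w {f} {g} h = extend-≐ _ {f} {g}

  pairing-congʳ : ∀ w f {g h} → g ≐ h → pairing w f g ≈ pairing w f h
  pairing-congʳ w f {g} {h} g≐h = trans (pairing-sym w f g) (trans (pairing-congˡ w {g} {h} f g≐h) (pairing-sym w h f))

  pairing-·ʳ : ∀ w f c g → pairing w f (c · g) ≈ c * pairing w f g
  pairing-·ʳ w f c g = trans (pairing-sym w f (c · g)) (trans (extend-· _ c g) (*-congˡ (pairing-sym w g f)))

  -- The only monomial that D_k sends to p_ν with nonzero coefficient is p_k p_ν.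
  coeff-D : ∀ k .{{_ : NonZero k}} g ν → coeff (D k g) ν ≈ ι (k ℕ.* mult k (⟦ k ⟧ ∪ ν)) * coeff g (⟦ k ⟧ ∪ ν)
  coeff-D k g ν = trans (extend-D (δ ν) k g) (trans (extend-cong g term) (extend-*ˡ (δ (⟦ k ⟧ ∪ ν)) _ g))
    where
    term : ∀ κ → ι (k ℕ.* mult k κ) * δ ν (κ ∖ k) ≈ ι (k ℕ.* mult k (⟦ k ⟧ ∪ ν)) * δ (⟦ k ⟧ ∪ ν) κ
    term κ = case ((⟦ k ⟧ ∪ ν) ≟ κ)
      where
      case : Dec (⟦ k ⟧ ∪ ν ≡ κ) → _
      case (yes ≡.refl) = *-congˡ (trans (reflexive (≡.cong (δ ν) (∪-∖ k ν))) (trans (δ-refl ν) (sym (δ-refl (⟦ k ⟧ ∪ ν)))))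
      case (no kν≢κ)    = trans (mult-guard k κ λ k∈κ → δ-≢ {a = ν} {b = κ ∖ k} λ { ≡.refl → kν≢κ (∖-∪ k κ k∈κ) })
        (sym (trans (*-congˡ (δ-≢ {a = ⟦ k ⟧ ∪ ν} {b = κ} kν≢κ)) (zeroʳ _)))

  -- Treats the Hall product (c = 1) and the Jack product (c = α) together. Multiplication by p_k is
  -- adjoint to c D_k as soon as adding a part k multiplies the weight by c k times the new
  -- multiplicity.
  module Adjunction (w : Partition → Carrier) (c : Carrier)
    (w-∪ : ∀ k .{{_ : NonZero k}} ν → w (⟦ k ⟧ ∪ ν) ≈ c * (ι (k ℕ.* mult k (⟦ k ⟧ ∪ ν)) * w ν)) where

    private
      ⟨_,_⟩ = pairing w

    ⊛-D : ∀ k .{{_ : NonZero k}} f g → ⟨ p k ⊛ f , g ⟩ ≈ c * ⟨ f , D k g ⟩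
    ⊛-D k f g = begin
      ⟨ p k ⊛ f , g ⟩
        ≈⟨ trans (pairing-coeff w (p k ⊛ f) g) (extend-⊛ _ k f) ⟩
      extend (λ ν → coeff g (⟦ k ⟧ ∪ ν) * w (⟦ k ⟧ ∪ ν)) f
        ≈⟨ extend-cong f (λ ν → trans (*-congˡ (w-∪ k ν)) (trans
             (solve 4 (λ a c m w → a :* (c :* (m :* w)) := c :* ((m :* a) :* w)) refl _ c _ (w ν))
             (*-congˡ (*-congʳ (sym (coeff-D k g ν)))))) ⟩
      extend (λ ν → c * (coeff (D k g) ν * w ν)) f
        ≈⟨ trans (extend-*ˡ _ c f) (*-congˡ (sym (pairing-coeff w f (D k g)))) ⟩
      c * ⟨ f , D k g ⟩ ∎

    -- Once all multiplications are moved across as derivatives, A has produced one factor c and B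
    -- two; the c on the left makes up the difference.
    opA-opB : ∀ n f g → c * ⟨ opA n f , g ⟩ ≈ ⟨ f , opB n g ⟩
    opA-opB n f g = begin
      c * ⟨ opA n f , g ⟩
        ≈⟨ *-congˡ (trans (extend-concatMap _ _ (upTo n)) (∑-cong (upTo n) λ i → trans (extend-concatMap _ _ (upTo n))
             (∑-cong (upTo n) λ j → ⊛-D (suc i ℕ.+ suc j) (D (suc i) (D (suc j) f)) g))) ⟩
      c * ∑ (upTo n) (λ i → ∑ (upTo n) λ j → c * ⟨ D (suc i) (D (suc j) f) , D (suc i ℕ.+ suc j) g ⟩)
        ≈⟨ trans (sym (∑-*ˡ (upTo n) c _)) (∑-cong (upTo n) λ i → sym (∑-*ˡ (upTo n) c _)) ⟩
      ∑ (upTo n) (λ i → ∑ (upTo n) λ j → c * (c * ⟨ D (suc i) (D (suc j) f) , D (suc i ℕ.+ suc j) g ⟩))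
        ≈⟨ ∑-swap (upTo n) (upTo n) _ ⟩
      ∑ (upTo n) (λ j → ∑ (upTo n) λ i → c * (c * ⟨ D (suc i) (D (suc j) f) , D (suc i ℕ.+ suc j) g ⟩))
        ≈⟨ ∑-cong (upTo n) (λ j → ∑-cong (upTo n) λ i → *-congˡ (*-congˡ (trans (pairing-sym w (D (suc i) (D (suc j) f)) (D (suc i ℕ.+ suc j) g))
             (reflexive (≡.cong (λ k → ⟨ D k g , D (suc i) (D (suc j) f) ⟩) (ℕ.+-comm (suc i) (suc j))))))) ⟩
      ∑ (upTo n) (λ j → ∑ (upTo n) λ i → c * (c * ⟨ D (suc j ℕ.+ suc i) g , D (suc i) (D (suc j) f) ⟩))
        ≈⟨ ∑-cong (upTo n) (λ j → ∑-cong (upTo n) λ i → trans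
             (⊛-D (suc j) (p (suc i) ⊛ D (suc j ℕ.+ suc i) g) f)
             (*-congˡ (⊛-D (suc i) (D (suc j ℕ.+ suc i) g) (D (suc j) f)))) ⟨
      ∑ (upTo n) (λ j → ∑ (upTo n) λ i → ⟨ p (suc j) ⊛ p (suc i) ⊛ D (suc j ℕ.+ suc i) g , f ⟩)
        ≈⟨ trans (extend-concatMap _ _ (upTo n)) (∑-cong (upTo n) λ i → extend-concatMap _ _ (upTo n)) ⟨
      ⟨ opB n g , f ⟩
        ≈⟨ pairing-sym w (opB n g) f ⟩
      ⟨ f , opB n g ⟩ ∎

    private
      opN-expand : ∀ n f g → ⟨ opN n f , g ⟩ ≈ ∑ (upTo n) λ k → ι k * (c * ⟨ D (suc k) f , D (suc k) g ⟩)
      opN-expand n f g = trans (extend-concatMap _ _ (upTo n)) (∑-cong (upTo n) λ k →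
        trans (extend-· _ (ι k) (p (suc k) ⊛ D (suc k) f)) (*-congˡ (⊛-D (suc k) (D (suc k) f) g)))

    opN-opN : ∀ n f g → ⟨ opN n f , g ⟩ ≈ ⟨ f , opN n g ⟩
    opN-opN n f g = begin
      ⟨ opN n f , g ⟩
        ≈⟨ opN-expand n f g ⟩
      ∑ (upTo n) (λ k → ι k * (c * ⟨ D (suc k) f , D (suc k) g ⟩))
        ≈⟨ ∑-cong (upTo n) (λ k → *-congˡ (*-congˡ (pairing-sym w (D (suc k) f) (D (suc k) g)))) ⟩
      ∑ (upTo n) (λ k → ι k * (c * ⟨ D (suc k) g , D (suc k) f ⟩))
        ≈⟨ opN-expand n g f ⟨
      ⟨ opN n g , f ⟩
        ≈⟨ pairing-sym w (opN n g) f ⟩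
      ⟨ f , opN n g ⟩ ∎

    opB-opA : ∀ n f g → ⟨ opB n f , g ⟩ ≈ c * ⟨ f , opA n g ⟩
    opB-opA n f g = trans (pairing-sym w (opB n f) g) (trans (sym (opA-opB n g f)) (*-congˡ (pairing-sym w (opA n g) f)))

    pairing-sum : ∀ f a d g h k → ⟨ f , (a · g ++ h) ++ d · k ⟩ ≈ a * ⟨ f , g ⟩ + ⟨ f , h ⟩ + d * ⟨ f , k ⟩
    pairing-sum f a d g h k = trans (pairing-sym w f ((a · g ++ h) ++ d · k)) (trans (extend-sum _ a d g h k)
      (+-cong (+-cong (*-congˡ (pairing-sym w g f)) (pairing-sym w h f)) (*-congˡ (pairing-sym w k f))))

    -- For c = α the summands αA and B are adjoint to each other and N to itself, so taking the
    -- adjoint only permutes the summands of L.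
    L-self-adjoint : c ≈ α → ∀ n f g → ⟨ L n f , g ⟩ ≈ ⟨ f , L n g ⟩
    L-self-adjoint c≈α n f g = begin
      ⟨ L n f , g ⟩
        ≈⟨ extend-sum _ α (α ⊖ 1#) (opA n f) (opB n f) (opN n f) ⟩
      α * ⟨ opA n f , g ⟩ + ⟨ opB n f , g ⟩ + (α ⊖ 1#) * ⟨ opN n f , g ⟩
        ≈⟨ +-cong (+-cong (trans (*-congʳ (sym c≈α)) (opA-opB n f g)) (trans (opB-opA n f g) (*-congʳ c≈α))) (*-congˡ (opN-opN n f g)) ⟩
      ⟨ f , opB n g ⟩ + α * ⟨ f , opA n g ⟩ + (α ⊖ 1#) * ⟨ f , opN n g ⟩
        ≈⟨ +-congʳ (+-comm _ _) ⟩
      α * ⟨ f , opA n g ⟩ + ⟨ f , opB n g ⟩ + (α ⊖ 1#) * ⟨ f , opN n g ⟩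
        ≈⟨ pairing-sum f α (α ⊖ 1#) (opA n g) (opB n g) (opN n g) ⟨
      ⟨ f , L n g ⟩ ∎

    -- For c = 1 the operators A and B are adjoint with no factor left over, so αB and A become αA
    -- and B.
    L*-adjoint : c ≈ 1# → ∀ n f g → ⟨ L* n f , g ⟩ ≈ ⟨ f , L n g ⟩
    L*-adjoint c≈1 n f g = begin
      ⟨ L* n f , g ⟩
        ≈⟨ extend-sum _ α (α ⊖ 1#) (opB n f) (opA n f) (opN n f) ⟩
      α * ⟨ opB n f , g ⟩ + ⟨ opA n f , g ⟩ + (α ⊖ 1#) * ⟨ opN n f , g ⟩
        ≈⟨ +-cong (+-cong (*-congˡ (trans (opB-opA n f g) c*)) (trans (sym c*) (opA-opB n f g))) (*-congˡ (opN-opN n f g)) ⟩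
      α * ⟨ f , opA n g ⟩ + ⟨ f , opB n g ⟩ + (α ⊖ 1#) * ⟨ f , opN n g ⟩
        ≈⟨ pairing-sum f α (α ⊖ 1#) (opA n g) (opB n g) (opN n g) ⟨
      ⟨ f , L n g ⟩ ∎
      where
      c* : ∀ {y} → c * y ≈ y
      c* = trans (*-congʳ c≈1) (*-identityˡ _)

  hallWeight jackWeight : Partition → Carrier
  hallWeight ν = ι (z ν)
  jackWeight ν = ι (z ν) * α^ (length (parts ν))

  hallWeight-cancel : ∀ ν {y} → y * hallWeight ν ≈ 0# → y ≈ 0#
  hallWeight-cancel ν e = ι-≢0-cancel (z-nonZero ν) (trans (*-comm _ _) e)

  hallWeight-∪ : ∀ k .{{_ : NonZero k}} ν → hallWeight (⟦ k ⟧ ∪ ν) ≈ ι (k ℕ.* mult k (⟦ k ⟧ ∪ ν)) * hallWeight ν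
  hallWeight-∪ k ν = trans (ι-cong (z-∪ k ν)) (ι-* (k ℕ.* mult k (⟦ k ⟧ ∪ ν)) (z ν))

  jackWeight-cancel : ∀ ν {y} → y * jackWeight ν ≈ 0# → y ≈ 0#
  jackWeight-cancel ν e = power (length (parts ν)) (ι-≢0-cancel (z-nonZero ν)
    (trans (solve 3 (λ z a y → z :* (a :* y) := y :* (z :* a)) refl _ _ _) e))
    where
    power : ∀ m {y} → α^ m * y ≈ 0# → y ≈ 0#
    power zero    e = trans (sym (trans (*-congʳ α^-zero) (*-identityˡ _))) e
    power (suc m) e = power m (α-cancel (trans (sym (*-assoc α (α^ m) _)) (trans (*-congʳ (sym (α^-suc m))) e)))

  jackWeight-∪ : ∀ k .{{_ : NonZero k}} ν → jackWeight (⟦ k ⟧ ∪ ν) ≈ α * (ι (k ℕ.* mult k (⟦ k ⟧ ∪ ν)) * jackWeight ν)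
  jackWeight-∪ k ν = trans (*-cong (hallWeight-∪ k ν) (trans (reflexive (≡.cong α^ (length-∪ k ν))) (α^-suc _)))
    (solve 4 (λ m z a l → (m :* z) :* (a :* l) := a :* (m :* (z :* l))) refl _ _ _ _)

  module Hall = Adjunction hallWeight 1# (λ k ν → trans (hallWeight-∪ k ν) (sym (*-identityˡ _)))
  module Jack = Adjunction jackWeight α jackWeight-∪

-- Spanning by triangular families, and the diagonal of L

module Spanning (S : Scalars) where
  open Operators S public
  open import Relation.Binary.Reasoning.Setoid setoid
  open import Algebra.Solver.Ring.NaturalCoefficients.Default commutativeSemiring using (solve; _:=_; _:+_; _:*_; con)
  open import Algebra.Properties.Ring ring using (-‿distribˡ-*; x∙y⁻¹≈ε⇒x≈y; -1*x≈-x; -0#≈0#; +-cancelʳ)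

  mcoeff : Partition → Λ → Carrier
  mcoeff μ f = extend (λ ν → ι (xcoeffᵖ (parts ν) (parts μ))) f

  mcoeff-++ : ∀ κ f c g → mcoeff κ (f ++ c · g) ≈ mcoeff κ f + c * mcoeff κ g
  mcoeff-++ κ f c g = trans (extend-++ _ f (c · g)) (+-congˡ (extend-· _ c g))

  nonZeros-parts : ∀ μ → nonZeros (parts μ) ≡ parts μ
  nonZeros-parts μ = List.filter-all ℕ.nonZero? (parts-positive μ)

  -- The matrix [m_μ] p_ν is triangular for the number of parts, with nonzero diagonal.
  faithful : ∀ {n f} → Homogeneous n f → (∀ μ → ∣ μ ∣ ≡ n → mcoeff μ f ≈ 0#) → ∀ μ → coeff f μ ≈ 0#
  faithful {n} {f} f-hom m≈0 μ with ∣ μ ∣ ℕ.≟ n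
  ... | no ∣μ∣≢n = f-hom μ ∣μ∣≢n
  ... | yes ∣μ∣≡n = go (suc n) μ ∣μ∣≡n (ℕ.m≤n+m (suc n) (length (parts μ)))
    where
    go : ∀ t μ → ∣ μ ∣ ≡ n → n < length (parts μ) ℕ.+ t → coeff f μ ≈ 0#
    go zero    μ ∣μ∣≡n n<ℓ = contradiction
      (ℕ.≤-trans (≡.subst (n <_) (ℕ.+-identityʳ _) n<ℓ) (ℕ.≤-trans (length≤sum (parts-positive μ)) (ℕ.≤-reflexive ∣μ∣≡n)))
      (ℕ.<-irrefl ≡.refl)
    go (suc t) μ ∣μ∣≡n n<ℓ = ι-≢0-cancel (xcoeffᵖ-diagonal (parts-positive μ)) (begin
      ι (xcoeffᵖ (parts μ) (parts μ)) * coeff f μ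
        ≈⟨ *-comm _ _ ⟩
      coeff f μ * ι (xcoeffᵖ (parts μ) (parts μ))
        ≈⟨ extend-*ʳ (δ μ) _ f ⟨
      extend (λ u → δ μ u * ι (xcoeffᵖ (parts μ) (parts μ))) f
        ≈⟨ extend-by-coeff f f agree ⟨
      mcoeff μ f
        ≈⟨ m≈0 μ ∣μ∣≡n ⟩
      0# ∎)
      where
      d : Partition → Carrier
      d u = δ μ u * ι (xcoeffᵖ (parts μ) (parts μ))
      agree : ∀ u → coeff f u * ι (xcoeffᵖ (parts u) (parts μ)) ≈ coeff f u * d u
      agree u = case (μ ≟ u) (∣ u ∣ ℕ.≟ n) (xcoeffᵖ (parts u) (parts μ) ℕ.≟ 0) (length (parts u) ℕ.≤? length (parts μ))
        where
        both-0 : coeff f u ≈ 0# → coeff f u * ι (xcoeffᵖ (parts u) (parts μ)) ≈ coeff f u * d u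
        both-0 e = trans (trans (*-congʳ e) (zeroˡ _)) (sym (trans (*-congʳ e) (zeroˡ _)))
        case : Dec (μ ≡ u) → Dec (∣ u ∣ ≡ n) → Dec (xcoeffᵖ (parts u) (parts μ) ≡ 0) →
               Dec (length (parts u) ≤ length (parts μ)) → coeff f u * ι (xcoeffᵖ (parts u) (parts μ)) ≈ coeff f u * d u
        case (yes ≡.refl) _ _ _ = *-congˡ (sym (trans (*-congʳ (δ-refl μ)) (*-identityˡ _)))
        case (no _) (no ∣u∣≢n) _ _ = both-0 (f-hom u ∣u∣≢n)
        case (no μ≢u) (yes _) (yes xc≡0) _ = *-congˡ (trans (trans (ι-cong xc≡0) ι-zero)
          (sym (trans (*-congʳ (δ-≢ {a = μ} {b = u} μ≢u)) (zeroˡ _))))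
        case (no μ≢u) (yes _) (no xc≢0) (yes le) = contradiction
          (↭⇒≡ (≡.subst (_↭ parts u) (nonZeros-parts μ) (xcoeffᵖ-triangular (parts μ) (parts-positive u) xc≢0
            (≡.subst (λ β → length (parts u) ≤ length β) (≡.sym (nonZeros-parts μ)) le)))) μ≢u
        case (no _) (yes ∣u∣≡n) (no _) (no nle) = both-0 (go t u ∣u∣≡n
          (ℕ.≤-trans n<ℓ (ℕ.≤-trans (ℕ.≤-reflexive (ℕ.+-suc (length (parts μ)) t)) (ℕ.+-monoˡ-≤ t (ℕ.≰⇒> nle)))))

  module _ (P : Partition → Λ) (P-degree : ∀ ν → Degree ∣ ν ∣ (P ν))
    (P-monic : ∀ ν → mcoeff ν (P ν) ≈ 1#)
    (P-triangular : ∀ ν μ → rank ν ≤ rank μ → μ ≢ ν → mcoeff μ (P ν) ≈ 0#) where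

    -- In effect, f lies in the span of the P μ of rank below r; the functional Φ replaces an
    -- explicit expansion. At r = 0 all monomial coefficients vanish, and `faithful` gives f = 0.
    span : ∀ n Φ r → (∀ μ → ∣ μ ∣ ≡ n → rank μ < r → extend Φ (P μ) ≈ 0#) →
           ∀ f → Homogeneous n f → (∀ κ → ∣ κ ∣ ≡ n → r ≤ rank κ → mcoeff κ f ≈ 0#) → extend Φ f ≈ 0#
    span n Φ zero Φ-0 f f-hom f-low = extend-by-coeff {ψ = Φ} f [] λ u → *-congʳ (faithful {f = f} f-hom (λ μ e → f-low μ e z≤n) u)
    -- The coefficients at partitions of rank exactly r are removed one by one by subtracting
    -- multiples of P μ. P μ has coefficient zero at every other partition of its rank or above, so
    -- earlier removals stay intact.
    span n Φ (suc r) Φ-0 f f-hom f-low = eliminate E (All.all-filter on-rank? (partitions≤ n)) f f-hom initially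
      where
      OnRank : Partition → Set
      OnRank μ = ∣ μ ∣ ≡ n × rank μ ≡ r
      on-rank? : ∀ μ → Dec (OnRank μ)
      on-rank? μ = (∣ μ ∣ ℕ.≟ n) Dec.×-dec (rank μ ℕ.≟ r)
      E : List Partition
      E = filter on-rank? (partitions≤ n)
      initially : ∀ κ → ∣ κ ∣ ≡ n → r ≤ rank κ → κ ∉ E → mcoeff κ f ≈ 0#
      initially κ ∣κ∣≡n r≤ κ∉E = f-low κ ∣κ∣≡n (ℕ.≤∧≢⇒< r≤ λ r≡ → κ∉E
        (∈-filter⁺ on-rank? (∈-partitions≤ κ (ℕ.≤-reflexive ∣κ∣≡n)) (∣κ∣≡n , ≡.sym r≡)))
      eliminate : ∀ E → All OnRank E → ∀ f → Homogeneous n f →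
        (∀ κ → ∣ κ ∣ ≡ n → r ≤ rank κ → κ ∉ E → mcoeff κ f ≈ 0#) → extend Φ f ≈ 0#
      eliminate [] _ f f-hom f-low = span n Φ r (λ μ e lt → Φ-0 μ e (ℕ.m≤n⇒m≤1+n lt)) f f-hom
        λ κ e r≤ → f-low κ e r≤ λ ()
      eliminate (μ ∷ E) ((∣μ∣≡n , rank≡r) ∷ onE) f f-hom f-low = begin
        extend Φ f                          ≈⟨ +-identityʳ _ ⟨
        extend Φ f + 0#                     ≈⟨ +-congˡ (trans (*-congˡ (Φ-0 μ ∣μ∣≡n (ℕ.≤-reflexive (≡.cong suc rank≡r)))) (zeroʳ c)) ⟨
        extend Φ f + c * extend Φ (P μ)     ≈⟨ trans (extend-++ Φ f (c · P μ)) (+-congˡ (extend-· Φ c (P μ))) ⟨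
        extend Φ (f ++ c · P μ)             ≈⟨ eliminate E onE (f ++ c · P μ)
                                                 (homogeneous-++ {f = f} f-hom (homogeneous-· c {P μ} (≡.subst (λ m → Homogeneous m (P μ)) ∣μ∣≡n (degree⇒homogeneous (P-degree μ))))) low ⟩
        0#                                  ∎
        where
        c = - mcoeff μ f
        low : ∀ κ → ∣ κ ∣ ≡ n → r ≤ rank κ → κ ∉ E → mcoeff κ (f ++ c · P μ) ≈ 0#
        low κ ∣κ∣≡n r≤ κ∉E with κ ≟ μ
        ... | yes ≡.refl = trans (mcoeff-++ κ f c (P κ)) (trans (+-congˡ (trans (*-congˡ (P-monic κ)) (*-identityʳ c))) (-‿inverseʳ _))
        ... | no κ≢μ = trans (mcoeff-++ κ f c (P μ)) (trans (+-cong
          (f-low κ ∣κ∣≡n r≤ λ { (here eq) → κ≢μ eq ; (there κ∈E) → κ∉E κ∈E })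
          (trans (*-congˡ (P-triangular μ κ (≡.subst (_≤ rank κ) (≡.sym rank≡r) r≤) κ≢μ)) (zeroʳ c))) (+-identityˡ 0#))

    extend-agree : ∀ n Φ Ψ → (∀ μ → ∣ μ ∣ ≡ n → extend Φ (P μ) ≈ extend Ψ (P μ)) →
                   ∀ f → Homogeneous n f → extend Φ f ≈ extend Ψ f
    -- No partition of n has rank above n², so the threshold n² + 1 admits every homogeneous f.
    extend-agree n Φ Ψ agree f f-hom = x∙y⁻¹≈ε⇒x≈y _ _ (trans (sym (difference f)) (span n (λ ν → Φ ν - Ψ ν) (suc (n ℕ.* n))
      (λ μ e _ → trans (difference (P μ)) (trans (+-congʳ (agree μ e)) (-‿inverseʳ _))) f f-hom
      λ κ ∣κ∣≡n large → contradiction (≡.subst (λ m → rank κ ≤ m ℕ.* m) ∣κ∣≡n (sumSq≤square (parts κ))) (ℕ.<⇒≱ large)))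
      where
      difference : ∀ f → extend (λ ν → Φ ν - Ψ ν) f ≈ extend Φ f - extend Ψ f
      difference f = trans (extend-+ Φ (λ ν → - Ψ ν) f) (+-congˡ (trans (extend-cong f λ ν → sym (-1*x≈-x (Ψ ν)))
        (trans (extend-*ˡ Ψ (- 1#) f) (-1*x≈-x _))))

  -- Contents

  content : ℕ × ℕ → Carrier
  content (i , j) = α * ι j ⊖ ι i

  C₁ : Partition → Carrier
  C₁ ν = foldr (λ b s → content b + s) 0# (boxes ν)

  ε : Partition → Carrier
  ε ν = ι 2 * C₁ ν

  private
    ι-2 : ι 2 ≈ 1# + 1#
    ι-2 = trans (ι-suc 1) (+-congˡ ι-1)

    triangular-number : ∀ r → ι 2 * ∑ (upTo r) ι + ι r ≈ ι r * ι r
    triangular-number zero = trans (+-cong (zeroʳ (ι 2)) ι-zero) (trans (+-identityˡ 0#) (sym (trans (*-congʳ ι-zero) (zeroˡ _))))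
    triangular-number (suc r) = begin
      ι 2 * ∑ (upTo (suc r)) ι + ι (suc r)
        ≈⟨ +-cong (*-cong ι-2 (∑-upTo-last r ι)) (ι-suc r) ⟩
      (1# + 1#) * (∑ (upTo r) ι + ι r) + (1# + ι r)
        ≈⟨ solve 2 (λ s r → (con 1 :+ con 1) :* (s :+ r) :+ (con 1 :+ r) := ((con 1 :+ con 1) :* s :+ r) :+ (con 1 :+ (r :+ r))) refl _ _ ⟩
      ((1# + 1#) * ∑ (upTo r) ι + ι r) + (1# + (ι r + ι r))
        ≈⟨ +-congʳ (trans (+-congʳ (*-congʳ (sym ι-2))) (triangular-number r)) ⟩
      ι r * ι r + (1# + (ι r + ι r))
        ≈⟨ solve 1 (λ r → r :* r :+ (con 1 :+ (r :+ r)) := (con 1 :+ r) :* (con 1 :+ r)) refl (ι r) ⟩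
      (1# + ι r) * (1# + ι r)
        ≈⟨ *-cong (ι-suc r) (ι-suc r) ⟨
      ι (suc r) * ι (suc r) ∎

    row : ∀ i r → ∑ (map (i ,_) (upTo r)) content + ι i * ι r ≈ α * ∑ (upTo r) ι
    row i r = begin
      ∑ (map (i ,_) (upTo r)) content + ι i * ι r
        ≈⟨ +-cong (reflexive (∑-map (i ,_) (upTo r) content)) (sym (constant r)) ⟩
      ∑ (upTo r) (λ j → content (i , j)) + ∑ (upTo r) (λ _ → ι i)
        ≈⟨ ∑-+ (upTo r) _ _ ⟨
      ∑ (upTo r) (λ j → content (i , j) + ι i)
        ≈⟨ ∑-cong (upTo r) (λ j → ⊖-+ (α * ι j) (ι i)) ⟩
      ∑ (upTo r) (λ j → α * ι j)
        ≈⟨ ∑-*ˡ (upTo r) α ι ⟩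
      α * ∑ (upTo r) ι ∎
      where
      constant : ∀ r → ∑ (upTo r) (λ _ → ι i) ≈ ι i * ι r
      constant zero    = sym (trans (*-congˡ ι-zero) (zeroʳ _))
      constant (suc r) = trans (∑-upTo-last r _) (trans (+-congʳ (constant r)) (trans (+-comm _ _)
        (sym (trans (*-congˡ (ι-suc r)) (trans (distribˡ (ι i) 1# (ι r)) (+-congʳ (*-identityʳ (ι i))))))))

  entries squares : ∀ {N} → Vec ℕ N → Carrier
  entries {N} β = ∑ (allFin N) λ l → ι (lookup β l)
  squares {N} β = ∑ (allFin N) λ l → ι (lookup β l) * ι (lookup β l)

  private
    -- The new entry is maximal, so each pair containing it, in either order, contributes the other
    -- entry.
    minSum-∷ : ∀ {N} b (β : Vec ℕ N) → (∀ m → lookup β m ≤ b) → minSum (b ∷ β) ≈ entries β + entries β + minSum β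
    minSum-∷ {N} b β β≤b = begin
      minSum (b ∷ β)
        ≈⟨ ∑-allFin-suc N _ ⟩
      ∑ (allFin (suc N)) (c zero) + ∑ (allFin N) (λ l → ∑ (allFin (suc N)) (c (suc l)))
        ≈⟨ +-cong (trans (∑-allFin-suc N (c zero)) (trans (+-identityˡ _) (∑-cong (allFin N) λ m → ι-cong (ℕ.m≥n⇒m⊓n≡n (β≤b m)))))
                  (∑-cong (allFin N) λ l → trans (∑-allFin-suc N (c (suc l))) (+-congʳ (ι-cong (ℕ.m≤n⇒m⊓n≡m (β≤b l))))) ⟩
      entries β + ∑ (allFin N) (λ l → ι (lookup β l) + ∑ (allFin N) (λ m → c (suc l) (suc m)))
        ≈⟨ +-congˡ (∑-+ (allFin N) _ _) ⟩
      entries β + (entries β + minSum β)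
        ≈⟨ +-assoc _ _ _ ⟨
      entries β + entries β + minSum β ∎
      where
      c : Fin (suc N) → Fin (suc N) → Carrier
      c l m = if does (m Fin.≟ l) then 0# else ι (lookup (b ∷ β) l ⊓ lookup (b ∷ β) m)

    lookup-fromList-≤ : ∀ {b xs} → All (b ≥_) xs → ∀ m → lookup (Vec.fromList xs) m ≤ b
    lookup-fromList-≤ (b≥x ∷ _)  zero    = b≥x
    lookup-fromList-≤ (_ ∷ b≥xs) (suc m) = lookup-fromList-≤ b≥xs m

    -- Generalised to a diagram whose first row has index i: every content is then lowered by i,
    -- which the term 2 i · `entries β` compensates.
    contents : ∀ i {xs} → AllPairs _≥_ xs → let β = Vec.fromList xs in
      ι 2 * ∑ (boxesFrom i xs) content + (ι 2 * (ι i * entries β) + minSum β + α * entries β) ≈ α * squares β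
    contents i [] = begin
      ι 2 * 0# + (ι 2 * (ι i * 0#) + 0# + α * 0#)
        ≈⟨ solve 3 (λ t i a → t :* con 0 :+ (t :* (i :* con 0) :+ con 0 :+ a :* con 0) := a :* con 0) refl (ι 2) (ι i) α ⟩
      α * 0# ∎
    contents i (_∷_ {x} {xs} x≥ xs↘) = begin
      ι 2 * ∑ (boxesFrom i (x ∷ xs)) content + (ι 2 * (ι i * entries (x ∷ β)) + minSum (x ∷ β) + α * entries (x ∷ β))
        ≈⟨ +-cong (*-congˡ (∑-++ (map (i ,_) (upTo x)) _ content))
             (+-cong (+-cong (*-congˡ (*-congˡ entries-∷)) (minSum-∷ x β (lookup-fromList-≤ x≥))) (*-congˡ entries-∷)) ⟩
      ι 2 * (r + k) + (ι 2 * (ι i * (ι x + e)) + (e + e + m) + α * (ι x + e))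
        ≈⟨ solve 8 (λ t r k i x e m a →
             t :* (r :+ k) :+ (t :* (i :* (x :+ e)) :+ (e :+ e :+ m) :+ a :* (x :+ e)) :=
             (t :* (r :+ i :* x) :+ a :* x) :+ (t :* k :+ ((t :* (i :* e) :+ (e :+ e)) :+ m :+ a :* e)))
             refl (ι 2) r k (ι i) (ι x) e m α ⟩
      (ι 2 * (r + ι i * ι x) + α * ι x) + (ι 2 * k + ((ι 2 * (ι i * e) + (e + e)) + m + α * e))
        ≈⟨ +-cong (+-congʳ (*-congˡ (row i x))) (+-congˡ (+-congʳ (+-congʳ double))) ⟩
      (ι 2 * (α * ∑ (upTo x) ι) + α * ι x) + (ι 2 * k + (ι 2 * (ι (suc i) * e) + m + α * e))
        ≈⟨ +-cong (trans (+-congʳ (*-swapˡ (ι 2) α _)) (trans (sym (distribˡ α _ _)) (*-congˡ (triangular-number x)))) (contents (suc i) xs↘) ⟩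
      α * (ι x * ι x) + α * squares β
        ≈⟨ trans (sym (distribˡ α _ _)) (*-congˡ (sym (∑-allFin-suc (length xs) (λ l → ι (lookup (x ∷ β) l) * ι (lookup (x ∷ β) l))))) ⟩
      α * squares (x ∷ β) ∎
      where
      β = Vec.fromList xs
      r = ∑ (map (i ,_) (upTo x)) content
      k = ∑ (boxesFrom (suc i) xs) content
      e = entries β
      m = minSum β
      entries-∷ : entries (x ∷ β) ≈ ι x + e
      entries-∷ = ∑-allFin-suc (length xs) λ l → ι (lookup (x ∷ β) l)
      double : ι 2 * (ι i * e) + (e + e) ≈ ι 2 * (ι (suc i) * e)
      double = begin
        ι 2 * (ι i * e) + (e + e)            ≈⟨ +-congˡ (trans (+-cong (sym (*-identityˡ e)) (sym (*-identityˡ e))) (trans (sym (distribʳ e 1# 1#)) (*-congʳ (sym ι-2)))) ⟩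
        ι 2 * (ι i * e) + ι 2 * e            ≈⟨ solve 3 (λ t i e → t :* (i :* e) :+ t :* e := t :* ((con 1 :+ i) :* e)) refl _ _ _ ⟩
        ι 2 * ((1# + ι i) * e)               ≈⟨ *-congˡ (*-congʳ (ι-suc i)) ⟨
        ι 2 * (ι (suc i) * e)                ∎

  -- Rearranged, 2C₁(λ) = α Σ λᵢ (λᵢ - 1) - Σ min(λ_l, λ_m) over ordered pairs l ≠ m, the diagonal
  -- entry given by `triangular-action`.
  ε-identity : ∀ ν → let β = Vec.fromList (parts ν) in ε ν + (minSum β + α * entries β) ≈ α * squares β
  ε-identity ν = trans (+-congˡ (+-congʳ (sym (trans (+-congʳ (trans (*-congˡ (trans (*-congʳ ι-zero) (zeroˡ _))) (zeroʳ (ι 2)))) (+-identityˡ _)))))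
    (contents 0 (Linked⇒AllPairs (λ x≥y y≥z → ℕ.≤-trans y≥z x≥y) (parts-sorted ν)))

  -- Triangularity of L

  partsIn : ∀ {n} ν → ∣ ν ∣ ≡ n → PartsIn n (parts ν)
  partsIn ν ≡.refl = go (parts-positive ν) ℕ.≤-refl
    where
    go : ∀ {n xs} → All NonZero xs → sum xs ≤ n → PartsIn n xs
    go []                  _  = []
    go {xs = x ∷ xs} (x>0 ∷ xs>0) le = (ℕ.>-nonZero⁻¹ x {{x>0}} , ℕ.≤-trans (ℕ.m≤m+n x (sum xs)) le) ∷
      go xs>0 (ℕ.≤-trans (ℕ.m≤n+m (sum xs) x) le)

  private
    module _ {N : ℕ} (n : ℕ) (β : Vec ℕ N) (ν : Partition) where

      φ : Partition → Carrier
      φ κ = X (parts κ) β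

      X-∪ : ∀ k .{{_ : NonZero k}} κ → φ (⟦ k ⟧ ∪ κ) ≈ X (k ∷ parts κ) β
      X-∪ k κ = X-↭ (parts-∪ k κ) β

      dualA-X : dualA n φ ν ≈ XA n (parts ν) β
      dualA-X = ∑-cong (upTo n) λ i → ∑-cong (upTo n) λ j → *-congˡ (*-congˡ (X-∪ (suc i ℕ.+ suc j) ((ν ∖ suc j) ∖ suc i)))

      dualB-X : dualB n φ ν ≈ XB n (parts ν) β
      dualB-X = ∑-cong (upTo n) λ i → ∑-cong (upTo n) λ j → *-congˡ
        (trans (X-∪ (suc i) (⟦ suc j ⟧ ∪ (ν ∖ (suc i ℕ.+ suc j)))) (X-↭ (prep (suc i) (parts-∪ (suc j) (ν ∖ (suc i ℕ.+ suc j)))) β))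

      dualN-X : dualN n φ ν ≈ XN n (parts ν) β
      dualN-X = ∑-cong (upTo n) λ k → *-congˡ (*-congˡ (X-∪ (suc k) (ν ∖ suc k)))

  mcoeff-L : ∀ {n f} → Degree n f → ∀ κ → (∀ μ → rank κ < rank μ → mcoeff μ f ≈ 0#) →
             mcoeff κ (L n f) ≈ ε κ * mcoeff κ f
  -- M is added on both sides to meet the subtraction-free forms of `triangular-action` and
  -- `ε-identity`.
  mcoeff-L {n} {f} f-deg κ above-0 = +-cancelʳ _ _ _ (begin
    mcoeff κ (L n f) + M * mcoeff κ f
      ≈⟨ +-cong image (*-congˡ (mcoeff-X f)) ⟩
    (α * extend (λ ν → XA n (parts ν) β) f + extend (λ ν → XB n (parts ν) β) f + (α ⊖ 1#) * extend (λ ν → XN n (parts ν) β) f) + M * extend (λ ν → X (parts ν) β) f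
      ≈⟨ triangular-action n f (All.map (λ {(_ , ν)} e → partsIn ν e) f-deg) (α ⊖ 1#) (⊖-+ α 1#) β above ⟩
    α * squares β * extend (λ ν → X (parts ν) β) f
      ≈⟨ *-cong (sym (ε-identity κ)) (sym (mcoeff-X f)) ⟩
    (ε κ + M) * mcoeff κ f
      ≈⟨ distribʳ _ (ε κ) M ⟩
    ε κ * mcoeff κ f + M * mcoeff κ f ∎)
    where
    β = Vec.fromList (parts κ)
    M = minSum β + α * entries β
    toList-β : toList β ≡ parts κ
    toList-β = Vec.toList∘fromList (parts κ)
    mcoeff-X : ∀ g → mcoeff κ g ≈ extend (λ ν → X (parts ν) β) g
    mcoeff-X g = extend-cong g λ ν → ι-cong (≡.cong (xcoeffᵖ (parts ν)) (≡.sym toList-β))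
    image : mcoeff κ (L n f) ≈ α * extend (λ ν → XA n (parts ν) β) f + extend (λ ν → XB n (parts ν) β) f + (α ⊖ 1#) * extend (λ ν → XN n (parts ν) β) f
    image = trans (mcoeff-X (L n f)) (trans (extend-L n _ f)
      (+-cong (+-cong (*-congˡ (extend-cong f (dualA-X n β))) (extend-cong f (dualB-X n β))) (*-congˡ (extend-cong f (dualN-X n β)))))
    -- δ may be unsorted and contain zeros, while `above-0` speaks of partitions; the coefficient
    -- and the sum of squares see only the partition made by `normalise`.
    above : ∀ δ → sumSq (toList β) < sumSq (toList δ) → extend (λ ν → X (parts ν) δ) f ≈ 0#
    above δ lt = trans (extend-cong f λ ν → ι-cong (blind-normalise (xcoeffᵖ-blind (parts-positive ν)) (toList δ)))
      (above-0 (normalise (toList δ)) (≡.subst₂ _<_ (≡.cong sumSq toList-β) (blind-normalise sumSq-blind (toList δ)) lt))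

  -- Jack functions as eigenvectors of L

  module Eigen (P : Partition → Λ) (P-degree : ∀ ν → Degree ∣ ν ∣ (P ν))
    (P-monic : ∀ ν → mcoeff ν (P ν) ≈ 1#) (P-triangular : ∀ ν μ → ¬ (μ ⊴ ν) → mcoeff μ (P ν) ≈ 0#)
    (P-orthogonal : ∀ μ ν → μ ≢ ν → pairing jackWeight (P μ) (P ν) ≈ 0#) where

    rank-triangular : ∀ ν μ → rank ν ≤ rank μ → μ ≢ ν → mcoeff μ (P ν) ≈ 0#
    rank-triangular ν μ le μ≢ν = P-triangular ν μ λ μ⊴ν → case (⊴⇒rank μ⊴ν)
      where
      case : μ ≡ ν ⊎ rank μ < rank ν → _
      case (inj₁ eq) = contradiction eq μ≢ν
      case (inj₂ lt) = contradiction le (ℕ.<⇒≱ lt)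

    private
      ⟨_,_⟩ = pairing jackWeight

      ⟨⟩-span : ∀ n g r → (∀ μ → ∣ μ ∣ ≡ n → rank μ < r → ⟨ P μ , g ⟩ ≈ 0#) →
        ∀ f → Homogeneous n f → (∀ κ → ∣ κ ∣ ≡ n → r ≤ rank κ → mcoeff κ f ≈ 0#) → ⟨ f , g ⟩ ≈ 0#
      ⟨⟩-span n g = span P P-degree P-monic rank-triangular n (λ μ → extend (λ ν → δ μ ν * jackWeight ν) g)

      -- At κ = ν this is the diagonal entry. At other κ of at least this rank both sides are zero,
      -- so `ε ν` may replace `ε κ`.
      L-mcoeff : ∀ ν κ → rank ν ≤ rank κ → mcoeff κ (L ∣ ν ∣ (P ν)) ≈ ε ν * mcoeff κ (P ν)
      L-mcoeff ν κ le = trans (mcoeff-L (P-degree ν) κ λ μ lt → rank-triangular ν μ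
          (ℕ.≤-trans le (ℕ.<⇒≤ lt)) λ { ≡.refl → ℕ.<⇒≱ lt le }) (agree (κ ≟ ν))
        where
        agree : Dec (κ ≡ ν) → ε κ * mcoeff κ (P ν) ≈ ε ν * mcoeff κ (P ν)
        agree (yes ≡.refl) = refl
        agree (no κ≢ν) = trans (trans (*-congˡ zero-κ) (zeroʳ _)) (sym (trans (*-congˡ zero-κ) (zeroʳ _)))
          where zero-κ = rank-triangular ν κ le κ≢ν

      residue : Partition → Λ
      residue ν = L ∣ ν ∣ (P ν) ++ (- ε ν) · P ν

      residue-homogeneous : ∀ ν → Homogeneous ∣ ν ∣ (residue ν)
      residue-homogeneous ν = homogeneous-++ {f = L ∣ ν ∣ (P ν)} (L-homogeneous ∣ ν ∣ (P-degree ν))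
        (homogeneous-· (- ε ν) {P ν} (degree⇒homogeneous (P-degree ν)))

      extend-residue : ∀ Φ ν → extend Φ (residue ν) ≈ extend Φ (L ∣ ν ∣ (P ν)) - ε ν * extend Φ (P ν)
      extend-residue Φ ν = trans (extend-++ Φ (L ∣ ν ∣ (P ν)) ((- ε ν) · P ν))
        (+-congˡ (trans (extend-· Φ (- ε ν) (P ν)) (sym (-‿distribˡ-* (ε ν) _))))

      residue-mcoeff : ∀ ν κ → rank ν ≤ rank κ → mcoeff κ (residue ν) ≈ 0#
      residue-mcoeff ν κ le = trans (extend-residue _ ν) (trans (+-congʳ (L-mcoeff ν κ le)) (-‿inverseʳ _))

      -- For μ below ν move L to P μ, whose image lies in the span of the P κ with κ not above μ.
      residue-orthogonal : ∀ ν μ → ∣ μ ∣ ≡ ∣ ν ∣ → ⟨ P μ , residue ν ⟩ ≈ 0#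
      residue-orthogonal ν μ ∣μ∣≡∣ν∣ = trans (pairing-sym jackWeight (P μ) (residue ν)) (case (rank ν ℕ.≤? rank μ))
        where
        case : Dec (rank ν ≤ rank μ) → ⟨ residue ν , P μ ⟩ ≈ 0#
        case (yes le) = ⟨⟩-span ∣ ν ∣ (P μ) (rank ν)
          (λ κ _ lt → P-orthogonal κ μ λ { ≡.refl → ℕ.<⇒≱ lt le })
          (residue ν) (residue-homogeneous ν) (λ κ _ → residue-mcoeff ν κ)
        case (no nle) = begin
          ⟨ residue ν , P μ ⟩
            ≈⟨ extend-residue _ ν ⟩
          ⟨ L ∣ ν ∣ (P ν) , P μ ⟩ - ε ν * ⟨ P ν , P μ ⟩
            ≈⟨ +-cong moved (trans (-‿cong (trans (*-congˡ (P-orthogonal ν μ λ { ≡.refl → nle ℕ.≤-refl })) (zeroʳ _))) -0#≈0#) ⟩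
          0# + 0#
            ≈⟨ +-identityˡ 0# ⟩
          0# ∎
          where
          lt = ℕ.≰⇒> nle
          moved : ⟨ L ∣ ν ∣ (P ν) , P μ ⟩ ≈ 0#
          moved = trans (Jack.L-self-adjoint refl ∣ ν ∣ (P ν) (P μ)) (trans (pairing-sym jackWeight (P ν) (L ∣ ν ∣ (P μ)))
            (≡.subst (λ n → ⟨ L n (P μ) , P ν ⟩ ≈ 0#) ∣μ∣≡∣ν∣ (⟨⟩-span ∣ μ ∣ (P ν) (suc (rank μ))
              (λ κ _ κ≤μ → P-orthogonal κ ν λ { ≡.refl → ℕ.<⇒≱ lt (ℕ.≤-pred κ≤μ) })
              (L ∣ μ ∣ (P μ)) (L-homogeneous ∣ μ ∣ (P-degree μ))
              λ κ _ μ<κ → trans (L-mcoeff μ κ (ℕ.<⇒≤ μ<κ))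
                (trans (*-congˡ (rank-triangular μ κ (ℕ.<⇒≤ μ<κ) λ { ≡.refl → ℕ.<-irrefl ≡.refl μ<κ })) (zeroʳ _)))))

    -- The residue is orthogonal to every P μ of its degree, hence to every p_κ, and the Jack weight
    -- can be cancelled from each coefficient.
    L-eigen : ∀ ν Φ → extend Φ (L ∣ ν ∣ (P ν)) ≈ ε ν * extend Φ (P ν)
    L-eigen ν Φ = x∙y⁻¹≈ε⇒x≈y _ _ (trans (sym (extend-residue Φ ν)) (extend-by-coeff {ψ = Φ} (residue ν) [] λ κ → *-congʳ (vanishes κ)))
      where
      vanishes : ∀ κ → coeff (residue ν) κ ≈ 0#
      vanishes κ with ∣ κ ∣ ℕ.≟ ∣ ν ∣
      ... | no ≢ = residue-homogeneous ν κ ≢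
      ... | yes e = jackWeight-cancel κ (trans (sym (pairing-p[] jackWeight (residue ν) κ))
        (trans (pairing-sym jackWeight (residue ν) p[ κ ]) (⟨⟩-span ∣ ν ∣ (residue ν) (suc (∣ ν ∣ ℕ.* ∣ ν ∣))
          (λ μ ∣μ∣≡ _ → residue-orthogonal ν μ ∣μ∣≡) p[ κ ] (degree⇒homogeneous {f = p[ κ ]} (e ∷ []))
          λ μ ∣μ∣≡ large → contradiction (≡.subst (λ m → rank μ ≤ m ℕ.* m) ∣μ∣≡ (sumSq≤square (parts μ))) (ℕ.<⇒≱ large))))

-- The Goulden-Jackson product with the stable series

module GouldenJackson (S : Scalars) where
  open Spanning S public
  open import Relation.Binary.Reasoning.Setoid setoid
  open import Algebra.Solver.Ring.NaturalCoefficients.Default commutativeSemiring using (solve; _:=_; _:+_; _:*_; con)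

  open import Algebra.Properties.Ring ring using (x∙y⁻¹≈ε⇒x≈y; -‿distribˡ-*)

  hall : Λ → Λ → Carrier
  hall = pairing hallWeight

  hall² : Lin (Partition × Partition) → Lin (Partition × Partition) → Carrier
  hall² s t = extend (λ (μ , ν) → extend (λ (μ′ , ν′) → hall p[ μ ] p[ μ′ ] * hall p[ ν ] p[ ν′ ]) t) s

  hall-p[] : ∀ ν k → hall p[ ν ] k ≈ extend (λ κ → δ ν κ * hallWeight κ) k
  hall-p[] ν k = extend-p[] (λ μ → extend (λ κ → δ μ κ * hallWeight κ) k) ν

  hall-expandʳ : ∀ ν k → extend (λ κ → hall p[ ν ] p[ κ ]) k ≈ hall p[ ν ] k
  hall-expandʳ ν k = trans
    (extend-cong k λ κ → trans (hall-p[] ν p[ κ ]) (extend-p[] (λ ν′ → δ ν ν′ * hallWeight ν′) κ))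
    (sym (hall-p[] ν k))

  hall-expandˡ : ∀ f k → extend (λ κ → hall p[ κ ] k) f ≈ hall f k
  hall-expandˡ f k = extend-cong f λ κ → hall-p[] κ k

  hall²-⊗ : ∀ f g h k → hall² (f ⊗ g) (h ⊗ k) ≈ hall f h * hall g k
  hall²-⊗ f g h k = begin
    hall² (f ⊗ g) (h ⊗ k)
      ≈⟨ extend-⊗ _ f g ⟩
    extend (λ μ → extend (λ ν → extend (λ (μ′ , ν′) → hall p[ μ ] p[ μ′ ] * hall p[ ν ] p[ ν′ ]) (h ⊗ k)) g) f
      ≈⟨ extend-cong f (λ μ → extend-cong g λ ν → inner μ ν) ⟩
    extend (λ μ → extend (λ ν → hall p[ μ ] h * hall p[ ν ] k) g) f
      ≈⟨ extend-cong f (λ μ → trans (extend-*ˡ _ (hall p[ μ ] h) g) (*-congˡ (hall-expandˡ g k))) ⟩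
    extend (λ μ → hall p[ μ ] h * hall g k) f
      ≈⟨ trans (extend-*ʳ _ (hall g k) f) (*-congʳ (hall-expandˡ f h)) ⟩
    hall f h * hall g k ∎
    where
    inner : ∀ μ ν → extend (λ (μ′ , ν′) → hall p[ μ ] p[ μ′ ] * hall p[ ν ] p[ ν′ ]) (h ⊗ k) ≈ hall p[ μ ] h * hall p[ ν ] k
    inner μ ν = begin
      extend (λ (μ′ , ν′) → hall p[ μ ] p[ μ′ ] * hall p[ ν ] p[ ν′ ]) (h ⊗ k)
        ≈⟨ extend-⊗ _ h k ⟩
      extend (λ μ′ → extend (λ ν′ → hall p[ μ ] p[ μ′ ] * hall p[ ν ] p[ ν′ ]) k) h
        ≈⟨ extend-cong h (λ μ′ → trans (extend-*ˡ _ (hall p[ μ ] p[ μ′ ]) k) (*-congˡ (hall-expandʳ ν k))) ⟩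
      extend (λ μ′ → hall p[ μ ] p[ μ′ ] * hall p[ ν ] k) h
        ≈⟨ trans (extend-*ʳ _ (hall p[ ν ] k) h) (*-congʳ (hall-expandʳ μ h)) ⟩
      hall p[ μ ] h * hall p[ ν ] k ∎

  hall-separates : ∀ {n f g} → Homogeneous n f → Homogeneous n g →
    (∀ h → Degree n h → hall f h ≈ hall g h) → f ≐ g
  hall-separates {n} {f} {g} f-hom g-hom agree κ with ∣ κ ∣ ℕ.≟ n
  ... | no ≢ = trans (f-hom κ ≢) (sym (g-hom κ ≢))
  ... | yes e = x∙y⁻¹≈ε⇒x≈y _ _ (hallWeight-cancel κ (begin
    (coeff f κ - coeff g κ) * hallWeight κ
      ≈⟨ trans (distribʳ _ _ _) (+-congˡ (sym (-‿distribˡ-* _ _))) ⟩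
    coeff f κ * hallWeight κ - coeff g κ * hallWeight κ
      ≈⟨ +-cong (sym (pairing-p[] hallWeight f κ)) (-‿cong (sym (pairing-p[] hallWeight g κ))) ⟩
    hall f p[ κ ] - hall g p[ κ ]
      ≈⟨ +-congʳ (agree p[ κ ] (e ∷ [])) ⟩
    hall g p[ κ ] - hall g p[ κ ]
      ≈⟨ -‿inverseʳ _ ⟩
    0# ∎))

  private
    ∑-first : ∀ n g → (∀ k → g (suc k) ≈ 0#) → ∑ (upTo (suc n)) g ≈ g 0
    ∑-first n g g-0 = trans (∑-upTo-suc n g) (trans (+-congˡ (∑-0 (upTo n) g-0)) (+-identityʳ (g 0)))

    absent : ∀ k m {y} → ι (suc (suc k) ℕ.* mult (suc (suc k)) (rows m 1)) * y ≈ 0#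
    absent k m = mult-guard (suc (suc k)) (rows m 1) λ k∈ → contradiction (mult-rows-other k m) k∈

    dualB-ones : ∀ n φ m → dualB m φ (rows n 1) ≈ 0#
    dualB-ones n φ m = ∑-0 (upTo m) λ i → ∑-0 (upTo m) λ j →
      mult-guard (suc i ℕ.+ suc j) (rows n 1) λ k∈ → contradiction
        (≡.trans (≡.cong (λ k → mult (suc k) (rows n 1)) (ℕ.+-suc i j)) (mult-rows-other (i ℕ.+ j) n)) k∈

    dualN-ones : ∀ n φ m → dualN m φ (rows n 1) ≈ 0#
    dualN-ones n φ m = ∑-0 (upTo m) λ where
      zero    → trans (*-congʳ ι-zero) (zeroˡ _)
      (suc k) → trans (*-congˡ (absent k n)) (zeroʳ _)

    dualA-ones : ∀ n φ → dualA (suc n) φ (rows (suc n) 1) ≈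
                 ι (suc n) * (ι (1 ℕ.* mult 1 (rows n 1)) * φ (⟦ 2 ⟧ ∪ (rows n 1 ∖ 1)))
    dualA-ones n φ = begin
      dualA (suc n) φ (rows (suc n) 1)
        ≈⟨ ∑-first n _ (λ i → ∑-0 (upTo (suc n)) λ where
             zero    → trans (*-congˡ (trans (reflexive (≡.cong (λ ν → ι (suc (suc i) ℕ.* mult (suc (suc i)) ν) * φ (⟦ suc (suc i) ℕ.+ 1 ⟧ ∪ (ν ∖ suc (suc i)))) (rows-∖ n)))
                         (absent i n))) (zeroʳ _)
             (suc j) → absent j (suc n)) ⟩
      ∑ (upTo (suc n)) (λ j → ι (suc j ℕ.* mult (suc j) (rows (suc n) 1)) *
        (ι (1 ℕ.* mult 1 (rows (suc n) 1 ∖ suc j)) * φ (⟦ 1 ℕ.+ suc j ⟧ ∪ ((rows (suc n) 1 ∖ suc j) ∖ 1))))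
        ≈⟨ ∑-first n _ (λ j → absent j (suc n)) ⟩
      ι (1 ℕ.* mult 1 (rows (suc n) 1)) * (ι (1 ℕ.* mult 1 (rows (suc n) 1 ∖ 1)) * φ (⟦ 2 ⟧ ∪ ((rows (suc n) 1 ∖ 1) ∖ 1)))
        ≈⟨ *-cong (ι-cong (≡.trans (ℕ.*-identityˡ _) (mult-rows-1 (suc n))))
             (reflexive (≡.cong (λ ν → ι (1 ℕ.* mult 1 ν) * φ (⟦ 2 ⟧ ∪ (ν ∖ 1))) (rows-∖ n))) ⟩
      ι (suc n) * (ι (1 ℕ.* mult 1 (rows n 1)) * φ (⟦ 2 ⟧ ∪ (rows n 1 ∖ 1))) ∎

    -- In p₁ⁿ only parts 1 can be removed: D_{i+j} gives zero, and Σ (k - 1) p_k D_k has the factor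
    -- zero at k = 1. What survives is the term i = j = 1 of A, equal to n (n - 1) p₂ p₁^{n-2}, the
    -- degree n component of the stable series.
    L*-ones : ∀ n φ → extend φ (L* n p[ rows n 1 ]) ≈ dualA n φ (rows n 1)
    L*-ones n φ = trans (extend-L* n φ p[ rows n 1 ]) (trans (+-cong (+-cong
      (trans (*-congˡ (trans (extend-p[] (dualB n φ) (rows n 1)) (dualB-ones n φ n))) (zeroʳ α)) (extend-p[] (dualA n φ) (rows n 1)))
      (trans (*-congˡ (trans (extend-p[] (dualN n φ) (rows n 1)) (dualN-ones n φ n))) (zeroʳ _)))
      (trans (+-identityʳ _) (+-identityˡ _)))

  -- In degrees 0 and 1 the series has no component, and L* p₁ⁿ vanishes because two parts 1 cannot
  -- be removed.
  p̂₂-small : ∀ n → ¬ (2 ≤ n) → ∀ φ → extend φ [] ≈ extend φ (L* n p[ rows n 1 ])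
  p̂₂-small zero          _   φ = sym (L*-ones 0 φ)
  p̂₂-small (suc zero)    _   φ = sym (trans (L*-ones 1 φ) (trans (dualA-ones 0 φ) (trans (*-congˡ (trans (*-congʳ ι-zero) (zeroˡ _))) (zeroʳ _))))
  p̂₂-small (suc (suc n)) 2≰n φ = contradiction (s≤s (s≤s z≤n)) 2≰n

  p̂₂-large : ∀ n → 2 ≤ n → ∀ φ →
             extend φ (ι (n fallingBy 2) · p[ ⟦ 2 ⟧ ∪ rows (n ∸ 2) 1 ]) ≈ extend φ (L* n p[ rows n 1 ])
  p̂₂-large (suc zero)    (s≤s ()) φ
  p̂₂-large (suc (suc n)) _        φ = sym (trans (L*-ones (suc (suc n)) φ) (trans (dualA-ones (suc n) φ)
    (trans (*-congˡ (*-cong (ι-cong (≡.trans (ℕ.*-identityˡ _) (mult-rows-1 (suc n)))) (reflexive (≡.cong (λ ν → φ (⟦ 2 ⟧ ∪ ν)) (rows-∖ n)))))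
      (trans (sym (*-assoc _ _ _)) (trans (*-congʳ (trans (sym (ι-* (suc (suc n)) (suc n))) (ι-cong falling)))
        (sym (trans (extend-· φ (ι (suc (suc n) fallingBy 2)) p[ ⟦ 2 ⟧ ∪ rows n 1 ]) (*-congˡ (extend-p[] φ (⟦ 2 ⟧ ∪ rows n 1))))))))))
    where
    falling : suc (suc n) ℕ.* suc n ≡ suc (suc n) fallingBy 2
    falling = ≡.trans (ℕ.*-comm (suc (suc n)) (suc n)) (≡.cong (suc n ℕ.*_) (≡.sym (ℕ.*-identityʳ (suc (suc n)))))

  L*-[] : ∀ n → L* n [] ≐ []
  L*-[] n κ = trans (extend-L* n (δ κ) []) (trans (+-cong (trans (+-congʳ (zeroʳ α)) (+-identityˡ 0#)) (zeroʳ _)) (+-identityˡ 0#))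

  module Theorem
    (P J Q : Partition → Λ)
    (P-degree : ∀ ν → Degree ∣ ν ∣ (P ν))
    (P-monic : ∀ ν → mcoeff ν (P ν) ≈ 1#)
    (P-triangular : ∀ ν μ → ¬ (μ ⊴ ν) → mcoeff μ (P ν) ≈ 0#)
    (P-orthogonal : ∀ μ ν → μ ≢ ν → pairing jackWeight (P μ) (P ν) ≈ 0#)
    (J-degree : ∀ ν → Degree ∣ ν ∣ (J ν))
    (J-multiple : ∀ ν → ∃[ c ] J ν ≐ c · P ν)
    (J-p₁ : ∀ ν → coeff (J ν) (rows ∣ ν ∣ 1) ≈ 1#)
    (Q-degree : ∀ ν → Degree ∣ ν ∣ (Q ν))
    (Q-dual : ∀ μ ν → hall (P μ) (Q ν) ≈ δ μ ν)
    (Γ : Λ → Lin (Partition × Partition))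
    (Γ-cong : ∀ {f g} → f ≐ g → Γ f ≐ Γ g)
    (Γ-++ : ∀ f g → Γ (f ++ g) ≐ Γ f ++ Γ g)
    (Γ-· : ∀ c f → Γ (c · f) ≐ c · Γ f)
    (Γ-J : ∀ ν → Γ (J ν) ≐ recip (∣ ν ∣ !) {{ℕ.>-nonZero (ℕ.1≤n! ∣ ν ∣)}} · (J ν ⊗ J ν))
    (p̂₂ : ℕ → Λ)
    (p̂₂-L* : ∀ n φ → extend φ (p̂₂ n) ≈ extend φ (L* n p[ rows n 1 ]))
    where

    open Eigen P P-degree P-monic P-triangular P-orthogonal

    agree-on-P : ∀ n Φ Ψ → (∀ μ → ∣ μ ∣ ≡ n → extend Φ (P μ) ≈ extend Ψ (P μ)) →
                 ∀ f → Degree n f → extend Φ f ≈ extend Ψ f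
    agree-on-P n Φ Ψ agree f f-deg =
      extend-agree P P-degree P-monic rank-triangular n Φ Ψ agree f (degree⇒homogeneous f-deg)

    -- Comparing the coefficients of p₁ⁿ in J = c P gives c d = 1, where d is that of P. Thus P = d
    -- J, without dividing by c.
    P-from-J : ∀ Φ ν → extend Φ (P ν) ≈ coeff (P ν) (rows ∣ ν ∣ 1) * extend Φ (J ν)
    P-from-J Φ ν with J-multiple ν
    ... | c , J≐cP = begin
      extend Φ (P ν)
        ≈⟨ *-identityˡ _ ⟨
      1# * extend Φ (P ν)
        ≈⟨ *-congʳ (trans (sym (J-p₁ ν)) (trans (J≐cP (rows ∣ ν ∣ 1)) (extend-· _ c (P ν)))) ⟩
      c * d * extend Φ (P ν)
        ≈⟨ solve 3 (λ c d e → c :* d :* e := d :* (c :* e)) refl _ _ _ ⟩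
      d * (c * extend Φ (P ν))
        ≈⟨ *-congˡ (trans (extend-≐ Φ {J ν} {c · P ν} J≐cP) (extend-· Φ c (P ν))) ⟨
      d * extend Φ (J ν) ∎
      where d = coeff (P ν) (rows ∣ ν ∣ 1)

    hall-L*-P : ∀ f ν → hall (L* ∣ ν ∣ f) (P ν) ≈ ε ν * hall f (P ν)
    hall-L*-P f ν = trans (Hall.L*-adjoint refl ∣ ν ∣ f (P ν)) (trans (pairing-sym hallWeight f (L ∣ ν ∣ (P ν)))
      (trans (L-eigen ν _) (*-congˡ (pairing-sym hallWeight (P ν) f))))

    hall-L*-J : ∀ f ν → hall (L* ∣ ν ∣ f) (J ν) ≈ ε ν * hall f (J ν)
    hall-L*-J f ν with J-multiple ν
    ... | c , J≐cP = begin
      hall (L* ∣ ν ∣ f) (J ν)            ≈⟨ scaled (L* ∣ ν ∣ f) ⟩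
      c * hall (L* ∣ ν ∣ f) (P ν)        ≈⟨ *-congˡ (hall-L*-P f ν) ⟩
      c * (ε ν * hall f (P ν))           ≈⟨ *-swapˡ c (ε ν) _ ⟩
      ε ν * (c * hall f (P ν))           ≈⟨ *-congˡ (scaled f) ⟨
      ε ν * hall f (J ν)                 ∎
      where
      scaled : ∀ g → hall g (J ν) ≈ c * hall g (P ν)
      scaled g = trans (pairing-congʳ hallWeight g {J ν} {c · P ν} J≐cP) (pairing-·ʳ hallWeight g c (P ν))

    hall-p̂₂-J : ∀ ν → hall (p̂₂ ∣ ν ∣) (J ν) ≈ ε ν * ι (∣ ν ∣ !)
    hall-p̂₂-J ν = begin
      hall (p̂₂ ∣ ν ∣) (J ν)                              ≈⟨ p̂₂-L* ∣ ν ∣ _ ⟩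
      hall (L* ∣ ν ∣ p[ rows ∣ ν ∣ 1 ]) (J ν)            ≈⟨ hall-L*-J p[ rows ∣ ν ∣ 1 ] ν ⟩
      ε ν * hall p[ rows ∣ ν ∣ 1 ] (J ν)                 ≈⟨ *-congˡ (trans (pairing-sym hallWeight p[ rows ∣ ν ∣ 1 ] (J ν)) (pairing-p[] hallWeight (J ν) (rows ∣ ν ∣ 1))) ⟩
      ε ν * (coeff (J ν) (rows ∣ ν ∣ 1) * hallWeight (rows ∣ ν ∣ 1))
                                                         ≈⟨ *-congˡ (trans (*-cong (J-p₁ ν) (ι-cong (z-rows ∣ ν ∣))) (*-identityˡ _)) ⟩
      ε ν * ι (∣ ν ∣ !)                                  ∎

    Γ-extend : ∀ Ψ h → extend Ψ (Γ h) ≈ extend (λ ν → extend Ψ (Γ p[ ν ])) h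
    -- `Γ []` need not be the empty list; homogeneity with the scalar zero shows that it represents
    -- zero.
    Γ-extend Ψ []            = trans (extend-≐ Ψ {Γ []} {0# · Γ []} (Γ-· 0# [])) (trans (extend-· Ψ 0# (Γ [])) (zeroˡ _))
    Γ-extend Ψ ((c , ν) ∷ h) = begin
      extend Ψ (Γ ((c , ν) ∷ h))
        ≈⟨ extend-≐ Ψ {Γ ((c , ν) ∷ h)} {Γ (c · p[ ν ] ++ h)} (Γ-cong {(c , ν) ∷ h} {c · p[ ν ] ++ h} split) ⟩
      extend Ψ (Γ (c · p[ ν ] ++ h))
        ≈⟨ trans (extend-≐ Ψ {Γ (c · p[ ν ] ++ h)} {Γ (c · p[ ν ]) ++ Γ h} (Γ-++ (c · p[ ν ]) h)) (extend-++ Ψ (Γ (c · p[ ν ])) (Γ h)) ⟩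
      extend Ψ (Γ (c · p[ ν ])) + extend Ψ (Γ h)
        ≈⟨ +-cong (trans (extend-≐ Ψ {Γ (c · p[ ν ])} {c · Γ p[ ν ]} (Γ-· c p[ ν ])) (extend-· Ψ c (Γ p[ ν ]))) (Γ-extend Ψ h) ⟩
      c * extend Ψ (Γ p[ ν ]) + extend (λ ν → extend Ψ (Γ p[ ν ])) h ∎
      where
      split : (c , ν) ∷ h ≐ c · p[ ν ] ++ h
      split κ = +-congʳ (*-congʳ (sym (*-identityʳ c)))

    -- The factor 1/n! of the coproduct cancels the n! in ⟨p̂₂ , J⟩, which comes from z of (1ⁿ).
    product-on-J : ∀ f ν → hall² (p̂₂ ∣ ν ∣ ⊗ f) (Γ (J ν)) ≈ hall (L* ∣ ν ∣ f) (J ν)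
    product-on-J f ν = begin
      hall² s (Γ (J ν))
        ≈⟨ extend-cong s (λ _ → extend-≐ _ {Γ (J ν)} {r · (J ν ⊗ J ν)} (Γ-J ν)) ⟩
      hall² s (r · (J ν ⊗ J ν))
        ≈⟨ trans (extend-cong s λ _ → extend-· _ r (J ν ⊗ J ν)) (extend-*ˡ _ r s) ⟩
      r * hall² s (J ν ⊗ J ν)
        ≈⟨ *-congˡ (trans (hall²-⊗ (p̂₂ ∣ ν ∣) f (J ν) (J ν)) (*-congʳ (hall-p̂₂-J ν))) ⟩
      r * (ε ν * ι (∣ ν ∣ !) * hall f (J ν))
        ≈⟨ solve 4 (λ r e n h → r :* (e :* n :* h) := (r :* n) :* (e :* h)) refl r _ _ _ ⟩
      r * ι (∣ ν ∣ !) * (ε ν * hall f (J ν))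
        ≈⟨ trans (*-congʳ (recip-* (∣ ν ∣ !) {{n!≢0}})) (*-identityˡ _) ⟩
      ε ν * hall f (J ν)
        ≈⟨ hall-L*-J f ν ⟨
      hall (L* ∣ ν ∣ f) (J ν) ∎
      where
      n!≢0 = ℕ.>-nonZero (ℕ.1≤n! ∣ ν ∣)
      r = recip (∣ ν ∣ !) {{n!≢0}}
      s = p̂₂ ∣ ν ∣ ⊗ f

    product-is-L* : ∀ {n f g} → Degree n f → Degree n g →
      (∀ h → Degree n h → hall g h ≈ hall² (p̂₂ n ⊗ f) (Γ h)) → g ≐ L* n f
    product-is-L* {n} {f} {g} f-deg g-deg adjunction = hall-separates {f = g} {L* n f}
      (degree⇒homogeneous g-deg) (L*-homogeneous n f-deg) λ h h-deg → trans (adjunction h h-deg) (begin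
        hall² (p̂₂ n ⊗ f) (Γ h)     ≈⟨ left h ⟩
        extend Φ h                 ≈⟨ agree-on-P n Φ Ψ on-P h h-deg ⟩
        extend Ψ h                 ≈⟨ right h ⟨
        hall (L* n f) h            ∎)
      where
      -- Both sides of the adjunction are rewritten as linear functionals of h. They then need
      -- comparison only on the P μ, and through `P-from-J` only on the J μ.
      Θ : Partition × Partition → Carrier
      Θ (μ′ , ν′) = extend (λ (μ , ν) → hall p[ μ ] p[ μ′ ] * hall p[ ν ] p[ ν′ ]) (p̂₂ n ⊗ f)
      Φ Ψ : Partition → Carrier
      Φ ν = extend Θ (Γ p[ ν ])
      Ψ μ = extend (λ ν → δ μ ν * hallWeight ν) (L* n f)
      left : ∀ h → hall² (p̂₂ n ⊗ f) (Γ h) ≈ extend Φ h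
      left h = trans (extend-swap _ (p̂₂ n ⊗ f) (Γ h)) (Γ-extend Θ h)
      right : ∀ h → hall (L* n f) h ≈ extend Ψ h
      right h = pairing-sym hallWeight (L* n f) h
      on-P : ∀ μ → ∣ μ ∣ ≡ n → extend Φ (P μ) ≈ extend Ψ (P μ)
      on-P μ ∣μ∣≡n = trans (P-from-J Φ μ) (trans (*-congˡ (trans (sym (left (J μ)))
        (trans (≡.subst (λ m → hall² (p̂₂ m ⊗ f) (Γ (J μ)) ≈ hall (L* m f) (J μ)) ∣μ∣≡n (product-on-J f μ)) (right (J μ)))))
        (sym (P-from-J Ψ μ)))

    -- L* is the Hall adjoint of L, so it acts on the Hall-dual basis with the eigenvalues of L on
    -- the P μ; testing against P μ leaves only μ = ν.
    L*-eigen : ∀ ν → L* ∣ ν ∣ (Q ν) ≐ ε ν · Q ν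
    L*-eigen ν = hall-separates {f = L* n (Q ν)} {ε ν · Q ν} (L*-homogeneous n (Q-degree ν))
      (homogeneous-· (ε ν) {Q ν} (degree⇒homogeneous (Q-degree ν)))
      λ h h-deg → trans (pairing-sym hallWeight (L* n (Q ν)) h) (trans
        (agree-on-P n (functional (L* n (Q ν))) (functional (ε ν · Q ν)) on-P h h-deg) (pairing-sym hallWeight h (ε ν · Q ν)))
      where
      n = ∣ ν ∣
      functional : Λ → Partition → Carrier
      functional f μ = extend (λ ν → δ μ ν * hallWeight ν) f
      on-P : ∀ μ → ∣ μ ∣ ≡ n → hall (P μ) (L* n (Q ν)) ≈ hall (P μ) (ε ν · Q ν)
      on-P μ ∣μ∣≡n = begin
        hall (P μ) (L* n (Q ν))         ≈⟨ pairing-sym hallWeight (P μ) (L* n (Q ν)) ⟩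
        hall (L* n (Q ν)) (P μ)         ≈⟨ ≡.subst (λ m → hall (L* m (Q ν)) (P μ) ≈ ε μ * hall (Q ν) (P μ)) ∣μ∣≡n (hall-L*-P (Q ν) μ) ⟩
        ε μ * hall (Q ν) (P μ)          ≈⟨ *-congˡ (trans (pairing-sym hallWeight (Q ν) (P μ)) (Q-dual μ ν)) ⟩
        ε μ * δ μ ν                     ≈⟨ trans (*-comm _ _) (trans (sym (δ-* ε μ ν)) (*-comm _ _)) ⟩
        ε ν * δ μ ν                     ≈⟨ *-congˡ (Q-dual μ ν) ⟨
        ε ν * hall (P μ) (Q ν)          ≈⟨ pairing-·ʳ hallWeight (P μ) (ε ν) (Q ν) ⟨
        hall (P μ) (ε ν · Q ν)          ∎

open import Defs
open import Data.Nat using (_+_; _∸_)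
open import Data.Product using (_×_)
import Data.Integer.Base as ℤ
import Data.Rational.Base as ℚ
open ≡ using (refl; sym; trans; cong; subst)
open RationalFunctions

-- Specialisation to ℚ(α)

scalars : Scalars
scalars = record
  { commutativeRing = ℚ⟨α⟩-commutativeRing
  ; ι = fromℕ
  ; ι-zero = λ _ → refl
  ; ι-suc = fromℕ-suc
  ; ι-cancel = λ n {x} → *ᴷ-cancel-0 (fromℕ (suc n)) x (0 , /1-nonZero n)
  ; _⊖_ = _-ᴷ_
  ; ⊖-+ = -ᴷ-+ᴷ
  ; α = α
  -- The witness 1 is the degree in which the polynomial α has its nonzero coefficient.
  ; α-cancel = λ {x} → *ᴷ-cancel-0 α x (1 , λ ())
  ; α^ = α ^ᴷ_
  ; α^-zero = λ _ → refl
  ; α^-suc = λ _ _ → refl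
  ; recip = λ d → fromℚ ((ℤ.+ 1) ℚ./ d)
  ; recip-* = λ d → fromℚ-recip d
  }

module GJ = GouldenJackson scalars

≐-trans⇒≈ : (f g h : Λ) → f GJ.≐ g → g GJ.≐ h → f ≈ h
≐-trans⇒≈ f g h = GJ.≐-trans {f = f} {g} {h}

differentialOperator : Λ → Λ
differentialOperator f =
    α · ∑≥1 (λ i → ∑≥1 λ j g → p i ⊛ p j ⊛ D (i + j) g) f
  ⊕ ∑≥1 (λ i → ∑≥1 λ j g → p (i + j) ⊛ D i (D j g)) f
  ⊕ (α -ᴷ 1ᴷ) · ∑≥1 (λ k g → fromℕ (k ∸ 1) · (p k ⊛ D k g)) f

-- Holds by unfolding: every `∑≥1` takes the cutoff `deg f`, nested sums included, and k - 1 is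
-- computed from the shifted index.
L*-differentialOperator : ∀ f → GJ.L* (deg f) f ≡ differentialOperator f
L*-differentialOperator f = refl

deg-homogeneous : ∀ {n t} f → All (λ (_ , κ) → ∣ κ ∣ ≡ n) (t ∷ f) → deg (t ∷ f) ≡ n
deg-homogeneous {n} f (∣ν∣≡n ∷ f-deg) = trans (cong (ℕ._⊔ deg f) ∣ν∣≡n) (ℕ.m≥n⇒m⊔n≡m (bound f f-deg))
  where
  bound : ∀ f → All (λ (_ , κ) → ∣ κ ∣ ≡ n) f → deg f ℕ.≤ n
  bound []      []          = ℕ.z≤n
  bound (_ ∷ f) (e ∷ f-deg) = ℕ.⊔-lub (ℕ.≤-reflexive e) (bound f f-deg)

L*-homogeneous-≐ : ∀ {n} (f : Λ^ n) → GJ.L* n (poly f) GJ.≐ differentialOperator (poly f)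
-- The empty combination has `deg` 0 whatever its nominal degree n, so the cutoffs may differ; both
-- sides are zero.
L*-homogeneous-≐ {n} (graded [] _)          = GJ.L*-[] n
L*-homogeneous-≐     (graded (t ∷ f) f-deg) =
  GJ.≐-reflexive (trans (cong (λ m → GJ.L* m (t ∷ f)) (sym (deg-homogeneous f f-deg))) (L*-differentialOperator (t ∷ f)))

p̂-small : ∀ n → ¬ (2 ℕ.≤ n) → poly (p̂ ⟦ 2 ⟧ n) ≡ []
p̂-small n 2≰n with ∣ ⟦ 2 ⟧ ∣ ℕ.≤? n
... | no  _   = refl
... | yes 2≤n = contradiction 2≤n 2≰n

p̂-large : ∀ n → 2 ℕ.≤ n → poly (p̂ ⟦ 2 ⟧ n) ≡ fromℕ (n fallingBy 2) · p[ ⟦ 2 ⟧ ∪ rows (n ∸ 2) 1 ]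
p̂-large n 2≤n with ∣ ⟦ 2 ⟧ ∣ ℕ.≤? n
... | no 2≰n = contradiction 2≤n 2≰n
... | yes _  = refl

p̂₂-L* : ∀ n φ → GJ.extend φ (poly (p̂ ⟦ 2 ⟧ n)) GJ.≈ GJ.extend φ (GJ.L* n GJ.p[ rows n 1 ])
p̂₂-L* n φ = case (2 ℕ.≤? n)
  where
  case : Dec (2 ℕ.≤ n) → GJ.extend φ (poly (p̂ ⟦ 2 ⟧ n)) GJ.≈ GJ.extend φ (GJ.L* n GJ.p[ rows n 1 ])
  case (no 2≰n)  = subst (λ f → GJ.extend φ f GJ.≈ GJ.extend φ (GJ.L* n GJ.p[ rows n 1 ])) (sym (p̂-small n 2≰n)) (GJ.p̂₂-small n 2≰n φ)
  case (yes 2≤n) = subst (λ f → GJ.extend φ f GJ.≈ GJ.extend φ (GJ.L* n GJ.p[ rows n 1 ])) (sym (p̂-large n 2≤n)) (GJ.p̂₂-large n 2≤n φ)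

theorem7p1 : (P J Q′ : Family) (Γ : Λ → Λ⊗Λ) (_✶_ : Product) →
    IsMonicJack P →
    IsIntegralJack P J →
    IsHallDual P Q′ →
    IsCoproduct J Γ →
    IsGouldenJackson Γ _✶_ →
    (∀ {n} (f : Λ^ n) →
    poly (Δ _✶_ ⟦ 2 ⟧ f) ≈
    α · ∑≥1 (λ i → ∑≥1 λ j g → p i ⊛ p j ⊛ D (i + j) g) (poly f)
    ⊕ ∑≥1 (λ i → ∑≥1 λ j g → p (i + j) ⊛ D i (D j g)) (poly f)
    ⊕ (α -ᴷ 1ᴷ) · ∑≥1 (λ k g → fromℕ (k ∸ 1) · (p k ⊛ D k g)) (poly f))
    × (∀ ν → poly (Δ _✶_ ⟦ 2 ⟧ (Q′ ν)) ≈ (fromℕ 2 *ᴷ C₁ ν) · poly (Q′ ν))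
theorem7p1 P J Q′ Γ _✶_ P-jack J-jack Q-dual Γ-coproduct ✶-gj =
  (λ {n} f → ≐-trans⇒≈ (poly (Δ _✶_ ⟦ 2 ⟧ f)) (GJ.L* n (poly f)) (differentialOperator (poly f))
    (Δ-is-L* f) (L*-homogeneous-≐ f)) ,
  (λ ν → ≐-trans⇒≈ (poly (Δ _✶_ ⟦ 2 ⟧ (Q′ ν))) (GJ.L* ∣ ν ∣ (poly (Q′ ν))) (GJ.ε ν GJ.· poly (Q′ ν))
    (Δ-is-L* (Q′ ν)) (T.L*-eigen ν))
  where
  module T = GJ.Theorem (λ ν → poly (P ν)) (λ ν → poly (J ν)) (λ ν → poly (Q′ ν))
    (λ ν → homogeneous (P ν)) (IsMonicJack.monic P-jack) (IsMonicJack.triangular P-jack) (IsMonicJack.orthogonal P-jack)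
    (λ ν → homogeneous (J ν)) (IsIntegralJack.multiple J-jack) (IsIntegralJack.p₁-coeff J-jack)
    (λ ν → homogeneous (Q′ ν)) Q-dual
    Γ (IsCoproduct.cong-≈ Γ-coproduct) (IsCoproduct.homo-⊕ Γ-coproduct) (IsCoproduct.homo-· Γ-coproduct)
    (IsCoproduct.on-Jack Γ-coproduct) (λ n → poly (p̂ ⟦ 2 ⟧ n)) p̂₂-L*

  Δ-is-L* : ∀ {n} (f : Λ^ n) → poly (Δ _✶_ ⟦ 2 ⟧ f) GJ.≐ GJ.L* n (poly f)
  Δ-is-L* {n} f = T.product-is-L* (homogeneous f) (homogeneous (p̂ ⟦ 2 ⟧ n ✶ f))
    λ h h-deg → ✶-gj (p̂ ⟦ 2 ⟧ n) f (graded h h-deg)
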